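{- Let $\Gamma$ be a $2$-walk-regular graph which is not a complete multipartite graph, with valency $k\geq 3$ and with an eigenvalue $\theta\neq\pm k$ of multiplicity $3$. Then either $\Gamma$ is a cubic graph with $a_1=a_2=0$, or $\Gamma$ is distance-regular. Moreover, if $\Gamma$ is distance-regular, then $\Gamma$ is the cube, the dodecahedron, or the icosahedron.
   Context: All graphs are finite, simple and connected. A graph is $2$-walk-regular if it has diameter at least $2$ and for every $\ell\geq0$ the number of walks of length $\ell$ between $x$ and $y$ depends only on $\mathrm{dist}(x,y)$ whenever $\mathrm{dist}(x,y)\leq 2$. Such a graph is regular, and for $j\in\{1,2\}$ the number $a_j$ of neighbors of $y$ at distance $j$ from $x$ (for $\mathrm{dist}(x,y)=j$) is a constant. Eigenvalues and multiplicities are those of the adjacency matrix. A graph of diameter $D$ is distance-regular if for all $0\leq j\leq D$ and all $x,y$ with $\mathrm{dist}(x,y)=j$, the numbers of neighbors of $y$ at distance $j-1,j,j+1$ from $x$ depend only on $j$. -}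

module Defs where

open import Level using (Level) renaming (suc to lsuc; _⊔_ to _⊔ˡ_)
open import Data.Bool using (Bool; true; false; if_then_else_; _∧_; _∨_)
open import Data.Nat using (ℕ; zero; suc; _≤_; _≡ᵇ_)
import Data.Nat as Nat
open import Data.Nat.ListAction using (sum)
open import Data.Bool.ListAction using (any)
open import Data.Fin using (Fin; toℕ; _≟_)
open import Data.List using (List; []; _∷_; map; allFin; foldr)
open import Data.Product using (Σ; ∃; _×_; _,_)
open import Data.Sum using (_⊎_)
open import Relation.Nullary using (¬_; Dec; yes; no)
open import Relation.Nullary.Decidable using (⌊_⌋)
open import Relation.Binary.PropositionalEquality using (_≡_)
open import Function.Bundles using (_⇔_)
open import Algebra.Bundles using (CommutativeRing; Semiring)
import Algebra.Definitions.RawSemiring as RS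

record Graph : Set where
  field
    n          : ℕ
    adj        : Fin n → Fin n → Bool
    adj-sym    : ∀ x y → adj x y ≡ adj y x
    adj-irrefl : ∀ x → adj x x ≡ false

[_] : Bool → ℕ
[ b ] = if b then 1 else 0

Σᴺ : ∀ {n} → (Fin n → ℕ) → ℕ
Σᴺ {n} f = sum (map f (allFin n))

module _ (G : Graph) where
  open Graph G

  walks : ℕ → Fin n → Fin n → ℕ
  walks zero    x y = [ ⌊ x ≟ y ⌋ ]
  walks (suc ℓ) x y = Σᴺ (λ z → [ adj x z ] Nat.* walks ℓ z y)

  Connected : Set
  Connected = ∀ x y → ∃ λ ℓ → ¬ (walks ℓ x y ≡ 0)

  search : ℕ → ℕ → Fin n → Fin n → ℕ
  search zero    d x y = d
  search (suc f) d x y = if walks d x y ≡ᵇ 0 then search f (suc d) x y else d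

  -- graph distance (correct for connected graphs: a shortest walk has length < n)
  dist : Fin n → Fin n → ℕ
  dist x y = search n 0 x y

  degree : Fin n → ℕ
  degree x = Σᴺ (λ z → [ adj x z ])

  Regular : ℕ → Set
  Regular k = ∀ x → degree x ≡ k

  DiameterAtLeast2 : Set
  DiameterAtLeast2 = ∃ λ x → ∃ λ y → 2 ≤ dist x y

  TwoWalkRegular : Set
  TwoWalkRegular = DiameterAtLeast2 ×
    (∀ ℓ x y x′ y′ → dist x y ≡ dist x′ y′ → dist x y ≤ 2 →
       walks ℓ x y ≡ walks ℓ x′ y′)

  cCount aCount bCount : Fin n → Fin n → ℕ
  cCount x y = Σᴺ (λ z → [ adj y z ∧ (suc (dist x z) ≡ᵇ dist x y) ])
  aCount x y = Σᴺ (λ z → [ adj y z ∧ (dist x z ≡ᵇ dist x y) ])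
  bCount x y = Σᴺ (λ z → [ adj y z ∧ (dist x z ≡ᵇ suc (dist x y)) ])

  DistanceRegular : Set
  DistanceRegular = ∀ x y x′ y′ → dist x y ≡ dist x′ y′ →
    (cCount x y ≡ cCount x′ y′) × (aCount x y ≡ aCount x′ y′) × (bCount x y ≡ bCount x′ y′)

  aZero : ℕ → Set
  aZero j = ∀ x y → dist x y ≡ j → aCount x y ≡ 0

  CompleteMultipartite : Set
  CompleteMultipartite = Σ ℕ λ m → Σ (Fin n → Fin m) λ part →
    ∀ x y → (adj x y ≡ true) ⇔ (¬ (part x ≡ part y))

  IsomorphicTo : (m : ℕ) → (Fin m → Fin m → Bool) → Set
  IsomorphicTo m adjH = Σ (Fin n → Fin m) λ f → Σ (Fin m → Fin n) λ g →
    (∀ x → g (f x) ≡ x) × (∀ y → f (g y) ≡ y) × (∀ x y → adjH (f x) (f y) ≡ adj x y)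

fromEdges : (m : ℕ) → List (ℕ × ℕ) → Fin m → Fin m → Bool
fromEdges m es x y = any (λ { (a , b) →
  ((toℕ x ≡ᵇ a) ∧ (toℕ y ≡ᵇ b)) ∨ ((toℕ x ≡ᵇ b) ∧ (toℕ y ≡ᵇ a)) }) es

cubeAdj : Fin 8 → Fin 8 → Bool
cubeAdj = fromEdges 8
  ((0 , 1) ∷ (0 , 2) ∷ (0 , 4) ∷ (1 , 3) ∷ (1 , 5) ∷ (2 , 3) ∷ (2 , 6) ∷
   (3 , 7) ∷ (4 , 5) ∷ (4 , 6) ∷ (5 , 7) ∷ (6 , 7) ∷ [])

dodecahedronAdj : Fin 20 → Fin 20 → Bool
dodecahedronAdj = fromEdges 20
  ((0 , 1) ∷ (1 , 2) ∷ (2 , 3) ∷ (3 , 4) ∷ (4 , 0) ∷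
   (5 , 6) ∷ (6 , 7) ∷ (7 , 8) ∷ (8 , 9) ∷ (9 , 10) ∷ (10 , 11) ∷ (11 , 12) ∷
   (12 , 13) ∷ (13 , 14) ∷ (14 , 5) ∷
   (0 , 5) ∷ (1 , 7) ∷ (2 , 9) ∷ (3 , 11) ∷ (4 , 13) ∷
   (15 , 6) ∷ (16 , 8) ∷ (17 , 10) ∷ (18 , 12) ∷ (19 , 14) ∷
   (15 , 16) ∷ (16 , 17) ∷ (17 , 18) ∷ (18 , 19) ∷ (19 , 15) ∷ [])

icosahedronAdj : Fin 12 → Fin 12 → Bool
icosahedronAdj = fromEdges 12
  ((0 , 1) ∷ (0 , 2) ∷ (0 , 3) ∷ (0 , 4) ∷ (0 , 5) ∷
   (1 , 2) ∷ (2 , 3) ∷ (3 , 4) ∷ (4 , 5) ∷ (5 , 1) ∷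
   (6 , 7) ∷ (7 , 8) ∷ (8 , 9) ∷ (9 , 10) ∷ (10 , 6) ∷
   (1 , 6) ∷ (1 , 7) ∷ (2 , 7) ∷ (2 , 8) ∷ (3 , 8) ∷ (3 , 9) ∷ (4 , 9) ∷
   (4 , 10) ∷ (5 , 10) ∷ (5 , 6) ∷
   (11 , 6) ∷ (11 , 7) ∷ (11 , 8) ∷ (11 , 9) ∷ (11 , 10) ∷ [])

record Field (c ℓ : Level) : Set (lsuc (c ⊔ˡ ℓ)) where
  field
    commutativeRing : CommutativeRing c ℓ
  open CommutativeRing commutativeRing public
  field
    1≉0     : ¬ (1# ≈ 0#)
    inverse : ∀ x → ¬ (x ≈ 0#) → ∃ λ y → x * y ≈ 1#
  open RS (Semiring.rawSemiring semiring) public using () renaming (_×_ to _×ᵣ_)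

module _ {c ℓ} (F : Field c ℓ) where
  open Field F

  CharZero : Set ℓ
  CharZero = ∀ m → ¬ ((suc m ×ᵣ 1#) ≈ 0#)

  ΣF : ∀ {n} → (Fin n → Carrier) → Carrier
  ΣF {n} f = foldr _+_ 0# (map f (allFin n))

  module _ (G : Graph) where
    open Graph G

    A : Fin n → Fin n → Carrier
    A x y = if adj x y then 1# else 0#

    IsEigenvector : Carrier → (Fin n → Carrier) → Set ℓ
    IsEigenvector θ v = ∀ x → ΣF (λ y → A x y * v y) ≈ θ * v x

    LinearlyIndependent : ∀ {m} → (Fin m → Fin n → Carrier) → Set (c ⊔ˡ ℓ)
    LinearlyIndependent {m} vs = ∀ (coef : Fin m → Carrier) →
      (∀ x → ΣF (λ i → coef i * vs i x) ≈ 0#) → ∀ i → coef i ≈ 0#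

    -- θ is an eigenvalue of A of multiplicity m
    -- (= dimension of the θ-eigenspace; A is symmetric, so geometric = algebraic)
    EigenvalueOfMultiplicity : Carrier → ℕ → Set (c ⊔ˡ ℓ)
    EigenvalueOfMultiplicity θ m =
      (Σ (Fin m → Fin n → Carrier) λ vs → (∀ i → IsEigenvector θ (vs i)) × LinearlyIndependent vs)
      × (∀ (ws : Fin (suc m) → Fin n → Carrier) → (∀ i → IsEigenvector θ (ws i)) →
           ¬ LinearlyIndependent ws)

{-# OPTIONS --safe #-}

-- Let Q be a multiple of the projection onto the θ-eigenspace. Since θ is a root of an integer polynomial and integer
-- symmetric matrices are semisimple, Q can be written as a polynomial in A; hence Q x y depends only on the numbers
-- of walks from x to y, and after normalisation Q is the Gram matrix U of a representation of the vertices by unit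
-- vectors of a nondegenerate space of dimension at most 3, with values 1, u₁, u₂ at distances 0, 1, 2.
-- The neighbours of x lie in a plane section, so at most two of them have a given inner product with a neighbour y.
-- If u₂ = 1, vertices at distance two coincide and the graph is complete multipartite; otherwise the number a₁ of
-- triangles on an edge is at most 2 and k ≤ a₁ + 3, which leaves six pairs (k, a₁). Only (3, 0) and (5, 2) survive:
-- (4, 1) is locally 2K₂ and would contain paths of vectors with unboundedly growing denominators, (5, 2) is locally
-- a pentagon, hence the icosahedron, and the other three are combinatorially impossible or complete multipartite.
-- In the cubic triangle-free case the two ways of extending a path of length two to one of length three are mirror images
-- with different inner products. So a 2-path lies in at most one pentagon, and two such extensions cannot both
-- end at distance three in a distance-regular graph; this leaves the cube (c₂ = 2), the dodecahedron (one pentagon on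
-- every 2-path) and graphs with a₁ = a₂ = 0 that are not distance-regular.

module Submission where

open import Defs
open import Data.Nat using (ℕ; _≤_)
open import Data.Product using (_×_)
open import Data.Sum using (_⊎_)
open import Relation.Nullary using (¬_)
open import Relation.Binary.PropositionalEquality using (_≡_)

open import Level using (Level; _⊔_)
open import Algebra.Bundles using (CommutativeRing)
import Algebra.Properties.CommutativeMonoid.Sum
import Algebra.Properties.Ring
import Algebra.Properties.Semiring.Mult
import Algebra.Properties.Semiring.Sum
import Algebra.Solver.Ring
open import Algebra.Solver.Ring.AlmostCommutativeRing using (fromCommutativeRing; _-Raw-AlmostCommutative⟶_)
open import Data.Bool using (Bool; true; false; if_then_else_; _∧_)
import Data.Bool.Properties as Boolₚ
open import Data.Empty using (⊥; ⊥-elim)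
open import Data.Fin as Fin using (Fin; zero; suc; punchIn; #_)
open import Data.Fin.Permutation using (permutation)
open import Data.Fin.Patterns using (0F; 1F; 2F; 3F; 4F)
import Data.Fin.Properties as Finₚ
open import Data.Integer as ℤ using (ℤ; -[1+_]; _⊖_) renaming (+_ to pos)
import Data.Integer.Properties as ℤₚ
open import Data.List using (List; []; _∷_; map; allFin; foldr; tabulate; length; lookup)
import Data.List.Membership.DecPropositional as DecMem
open import Data.List.Membership.Propositional using (_∈_; _∉_)
open import Data.List.Membership.Propositional.Properties using (∈-lookup; ∈-tabulate⁺; ∈-tabulate⁻)
import Data.List.Properties as Listₚ
open import Data.List.Relation.Unary.All as All using (All; []; _∷_)
import Data.List.Relation.Unary.All.Properties as Allₚ
open import Data.List.Relation.Unary.AllPairs using ([]; _∷_)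
open import Data.List.Relation.Unary.Any using (Any; here; there; index)
import Data.List.Relation.Unary.Any.Properties as Anyₚ
open import Data.List.Relation.Unary.Unique.Propositional using (Unique)
import Data.List.Relation.Unary.Unique.Propositional.Properties as Uniqueₚ
open import Data.Maybe using (nothing; just)
open import Data.Nat as ℕ using (zero; suc; _<_; z≤n; s≤s)
import Data.Nat.Properties as ℕₚ
open import Data.Product using (Σ; ∃; _,_; proj₁; proj₂)
import Data.Product.Properties as Productₚ
open import Data.Sum using (inj₁; inj₂)
open import Data.Unit using (tt)
open import Data.Vec using (Vec; []; _∷_) renaming (lookup to lookupᵛ)
open import Data.Vec.Functional using (insertAt)
import Data.Vec.Functional.Properties as Vecₚ
open import Relation.Binary.Definitions using (tri<; tri≈; tri>)
open import Relation.Binary.PropositionalEquality as ≡ using (_≢_; ≢-sym)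
open import Relation.Nullary using (Dec; yes; no)
open import Relation.Nullary.Decidable using (⌊_⌋; ¬?; from-yes; _→-dec_; _×-dec_; _⊎-dec_)

-- Linear algebra

-- `F` is an arbitrary field of characteristic zero. It carries no order, so nothing over it is
-- positive definite, and its equality is not decidable. The first obstacle is met by staying with
-- integer vectors as long as definiteness is needed, since there a sum of squares vanishes only
-- trivially. Afterwards lengths and angles are replaced by vanishing 2 by 2 minors: the complement
-- of an edge in the eigenspace is at most a line, where two vectors of equal nonzero norm are equal
-- or opposite. As to the second, bases, pivots and case distinctions on equations in `F` exist only
-- under a double negation. This loses nothing, because all that the combinatorial part takes from
-- the geometry is a contradiction, while counts of neighbours and walks are compared in ℕ.
-- Distance-regularity is never derived from the geometry: it is read off from an explicit distance
-- matrix after the graph has been recognised.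

em : ∀ {ℓ} {P : Set ℓ} → ¬ ¬ (P ⊎ ¬ P)
em k = k (inj₂ λ p → k (inj₁ p))

-- Double negation shift, valid because there are only finitely many indices. It lets a proof of `⊥`
-- assume finitely many equations decided at once.
¬¬-finite : ∀ {ℓ m} {P : Fin m → Set ℓ} → (∀ i → ¬ ¬ P i) → ¬ ¬ (∀ i → P i)
¬¬-finite {m = zero} f k = k λ ()
¬¬-finite {m = suc m} {P} f k =
  f zero λ p → ¬¬-finite {P = λ i → P (suc i)} (λ i → f (suc i)) λ ps → k λ { zero → p ; (suc i) → ps i }

finite-split : ∀ {ℓ m} {P Q : Fin m → Set ℓ} → (∀ i → P i ⊎ Q i) → (∀ i → P i) ⊎ ∃ Q
finite-split {m = zero} f = inj₁ λ ()
finite-split {m = suc m} {P} {Q} f with f zero | finite-split {P = λ i → P (suc i)} {λ i → Q (suc i)} (λ i → f (suc i))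
... | inj₂ q | _ = inj₂ (zero , q)
... | inj₁ p | inj₂ (i , q) = inj₂ (suc i , q)
... | inj₁ p | inj₁ ps = inj₁ λ { zero → p ; (suc i) → ps i }

module Initial {c ℓ : Level} (R : CommutativeRing c ℓ) where
  open CommutativeRing R hiding (zero)
  open Algebra.Properties.Ring ring
  open Algebra.Properties.Semiring.Mult semiring using (×-homo-+; ×1-homo-*) renaming (_×_ to _×′_)
  open import Relation.Binary.Reasoning.Setoid setoid

  ι : ℤ → Carrier
  ι (pos m) = m ×′ 1#
  ι (-[1+ m ]) = - (suc m ×′ 1#)

  private
    cancel : ∀ x y → (1# + x) - (1# + y) ≈ x - y
    cancel x y = begin
      (1# + x) + - (1# + y) ≈⟨ +-congˡ (-‿+-comm 1# y) ⟨
      (1# + x) + (- 1# + - y) ≈⟨ +-congʳ (+-comm 1# x) ⟩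
      (x + 1#) + (- 1# + - y) ≈⟨ +-assoc _ _ _ ⟩
      x + (1# + (- 1# + - y)) ≈⟨ +-congˡ (+-assoc _ _ _) ⟨
      x + ((1# + - 1#) + - y) ≈⟨ +-congˡ (+-congʳ (-‿inverseʳ 1#)) ⟩
      x + (0# + - y) ≈⟨ +-congˡ (+-identityˡ _) ⟩
      x - y ∎

    ι-⊖ : ∀ m n → ι (m ⊖ n) ≈ m ×′ 1# - n ×′ 1#
    ι-⊖ zero zero = sym (-‿inverseʳ 0#)
    ι-⊖ (suc m) zero = begin
      suc m ×′ 1# ≈⟨ +-identityʳ _ ⟨
      suc m ×′ 1# + 0# ≈⟨ +-congˡ -0#≈0# ⟨
      suc m ×′ 1# - 0# ∎
    ι-⊖ zero (suc n) = sym (+-identityˡ _)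
    ι-⊖ (suc m) (suc n) = begin
      ι (suc m ⊖ suc n) ≡⟨ ≡.cong ι (ℤₚ.[1+m]⊖[1+n]≡m⊖n m n) ⟩
      ι (m ⊖ n) ≈⟨ ι-⊖ m n ⟩
      m ×′ 1# - n ×′ 1# ≈⟨ cancel _ _ ⟨
      suc m ×′ 1# - suc n ×′ 1# ∎

  ι-neg : ∀ x → ι (ℤ.- x) ≈ - ι x
  ι-neg (pos zero) = sym -0#≈0#
  ι-neg (pos (suc m)) = refl
  ι-neg -[1+ m ] = sym (-‿involutive _)

  ι-+ : ∀ x y → ι (x ℤ.+ y) ≈ ι x + ι y
  ι-+ (pos m) (pos n) = ×-homo-+ 1# m n
  ι-+ (pos m) (-[1+ n ]) = ι-⊖ m (suc n)
  ι-+ (-[1+ m ]) (pos n) = trans (ι-⊖ n (suc m)) (+-comm _ _)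
  ι-+ (-[1+ m ]) (-[1+ n ]) = begin
    - ((2 ℕ.+ (m ℕ.+ n)) ×′ 1#) ≡⟨ ≡.cong (λ t → - (suc t ×′ 1#)) (ℕₚ.+-suc m n) ⟨
    - ((suc m ℕ.+ suc n) ×′ 1#) ≈⟨ -‿cong (×-homo-+ 1# (suc m) (suc n)) ⟩
    - (suc m ×′ 1# + suc n ×′ 1#) ≈⟨ -‿+-comm _ _ ⟨
    - (suc m ×′ 1#) + - (suc n ×′ 1#) ∎

  ι-*⁺ : ∀ m y → ι (pos m ℤ.* y) ≈ ι (pos m) * ι y
  ι-*⁺ zero y = begin
    ι (pos 0 ℤ.* y) ≡⟨ ≡.cong ι (ℤₚ.*-zeroˡ y) ⟩
    0# ≈⟨ zeroˡ _ ⟨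
    0# * ι y ∎
  ι-*⁺ (suc m) y = begin
    ι (pos (suc m) ℤ.* y) ≡⟨ ≡.cong ι (ℤₚ.suc-* (pos m) y) ⟩
    ι (y ℤ.+ pos m ℤ.* y) ≈⟨ ι-+ y _ ⟩
    ι y + ι (pos m ℤ.* y) ≈⟨ +-cong (sym (*-identityˡ _)) (ι-*⁺ m y) ⟩
    1# * ι y + ι (pos m) * ι y ≈⟨ distribʳ _ _ _ ⟨
    (1# + ι (pos m)) * ι y ∎

  ι-* : ∀ x y → ι (x ℤ.* y) ≈ ι x * ι y
  ι-* (pos m) y = ι-*⁺ m y
  ι-* x@(-[1+ m ]) y = begin
    ι (x ℤ.* y) ≡⟨ ≡.cong ι (ℤₚ.neg-distribˡ-* (pos (suc m)) y) ⟨
    ι (ℤ.- (pos (suc m) ℤ.* y)) ≈⟨ ι-neg (pos (suc m) ℤ.* y) ⟩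
    - ι (pos (suc m) ℤ.* y) ≈⟨ -‿cong (ι-*⁺ (suc m) y) ⟩
    - (ι (pos (suc m)) * ι y) ≈⟨ -‿distribˡ-* _ _ ⟩
    ι x * ι y ∎

  private
    hom : CommutativeRing.rawRing ℤₚ.+-*-commutativeRing -Raw-AlmostCommutative⟶ fromCommutativeRing R
    hom = record
      { ⟦_⟧ = ι ; +-homo = ι-+ ; *-homo = ι-* ; -‿homo = ι-neg
      ; 0-homo = refl ; 1-homo = +-identityʳ 1# }

    -- The ring solver only has to recognise some equal coefficients. Comparing them in ℤ serves
    -- this, so equality in the ring need not be decidable.
    weakly : ∀ x y → _
    weakly x y with x ℤ.≟ y
    ... | yes eq = just (reflexive (≡.cong ι eq))
    ... | no _ = nothing

  module Solver where
    open Algebra.Solver.Ring _ _ hom weakly public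

    :0 :1 :2 : ∀ {n} → Polynomial n
    :0 = con (pos 0)
    :1 = con (pos 1)
    :2 = con (pos 2)

module Sums {c ℓ : Level} (R : CommutativeRing c ℓ) where
  open CommutativeRing R hiding (zero)
  private module S = Algebra.Properties.Semiring.Sum semiring

  abstract
    ∑ : ∀ {n} → (Fin n → Carrier) → Carrier
    ∑ = S.sum

    ∑-cong : ∀ {n} {f g : Fin n → Carrier} → (∀ i → f i ≈ g i) → ∑ f ≈ ∑ g
    ∑-cong = S.sum-cong-≋

    ∑-empty : (f : Fin 0 → Carrier) → ∑ f ≈ 0#
    ∑-empty f = refl

    ∑-suc : ∀ {n} (f : Fin (suc n) → Carrier) → ∑ f ≈ f zero + ∑ (λ i → f (suc i))
    ∑-suc f = refl

    ∑-0 : ∀ n → ∑ {n} (λ _ → 0#) ≈ 0#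
    ∑-0 = S.sum-replicate-zero

    ∑-+ : ∀ {n} (f g : Fin n → Carrier) → ∑ (λ i → f i + g i) ≈ ∑ f + ∑ g
    ∑-+ = S.∑-distrib-+

    ∑-comm : ∀ {m n} (f : Fin m → Fin n → Carrier) →
             ∑ (λ i → ∑ (λ j → f i j)) ≈ ∑ (λ j → ∑ (λ i → f i j))
    ∑-comm = S.∑-comm

    *-∑ : ∀ {n} x (f : Fin n → Carrier) → x * ∑ f ≈ ∑ (λ i → x * f i)
    *-∑ = S.*-distribˡ-sum

    ∑-* : ∀ {n} x (f : Fin n → Carrier) → ∑ f * x ≈ ∑ (λ i → f i * x)
    ∑-* = S.*-distribʳ-sum

    ∑-remove : ∀ {n} (p : Fin (suc n)) f → ∑ f ≈ f p + ∑ (λ i → f (punchIn p i))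
    ∑-remove p f = S.sum-remove {i = p} f

  foldr-∑ : ∀ {n} (f : Fin n → Carrier) → foldr _+_ 0# (map f (allFin n)) ≈ ∑ f
  foldr-∑ f = trans (reflexive (≡.cong (foldr _+_ 0#) (Listₚ.map-tabulate (λ i → i) f))) (go f)
    where
    go : ∀ {n} (f : Fin n → Carrier) → foldr _+_ 0# (tabulate f) ≈ ∑ f
    go {zero} f = sym (∑-empty f)
    go {suc n} f = trans (+-congˡ (go (λ i → f (suc i)))) (sym (∑-suc f))

  ∑-zero : ∀ {n} {f : Fin n → Carrier} → (∀ i → f i ≈ 0#) → ∑ f ≈ 0#
  ∑-zero {n} eq = trans (∑-cong eq) (∑-0 n)

  ∑-suc-zero : ∀ {n} (f : Fin (suc n) → Carrier) → f zero ≈ 0# → ∑ (λ i → f (suc i)) ≈ 0# → ∑ f ≈ 0#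
  ∑-suc-zero f z s = trans (∑-suc f) (trans (+-cong z s) (+-identityˡ _))

  δ : ∀ {n} → Fin n → Fin n → Carrier
  δ zero zero = 1#
  δ zero (suc j) = 0#
  δ (suc i) zero = 0#
  δ (suc i) (suc j) = δ i j

  δ-refl : ∀ {n} (i : Fin n) → δ i i ≡ 1#
  δ-refl zero = ≡.refl
  δ-refl (suc i) = δ-refl i

  δ-≢ : ∀ {n} {i j : Fin n} → i ≢ j → δ i j ≡ 0#
  δ-≢ {i = zero} {zero} ne = ⊥-elim (ne ≡.refl)
  δ-≢ {i = zero} {suc j} ne = ≡.refl
  δ-≢ {i = suc i} {zero} ne = ≡.refl
  δ-≢ {i = suc i} {suc j} ne = δ-≢ (λ eq → ne (≡.cong suc eq))

  δ-sym : ∀ {n} (i j : Fin n) → δ i j ≡ δ j i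
  δ-sym zero zero = ≡.refl
  δ-sym zero (suc j) = ≡.refl
  δ-sym (suc i) zero = ≡.refl
  δ-sym (suc i) (suc j) = δ-sym i j

  ∑-δ : ∀ {n} (i : Fin n) (f : Fin n → Carrier) → ∑ (λ j → δ i j * f j) ≈ f i
  ∑-δ zero f = trans (∑-suc _)
    (trans (+-cong (*-identityˡ _) (∑-zero λ j → zeroˡ _)) (+-identityʳ _))
  ∑-δ (suc i) f = trans (∑-suc _)
    (trans (+-cong (zeroˡ _) (∑-δ i (λ j → f (suc j)))) (+-identityˡ _))

module Dependence {c ℓ : Level} (R : CommutativeRing c ℓ)
  (1≉0 : ¬ CommutativeRing._≈_ R (CommutativeRing.1# R) (CommutativeRing.0# R))
  (nonzero : ∀ x y → ¬ CommutativeRing._≈_ R x (CommutativeRing.0# R) →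
     ¬ CommutativeRing._≈_ R y (CommutativeRing.0# R) →
     ¬ CommutativeRing._≈_ R (CommutativeRing._*_ R x y) (CommutativeRing.0# R)) where
  open CommutativeRing R hiding (zero)
  open Sums R
  open Initial.Solver R
  open import Relation.Binary.Reasoning.Setoid setoid

  Relation : ∀ {r m} → (Fin r → Fin m → Carrier) → (Fin r → Carrier) → Set ℓ
  Relation M c = (∃ λ i → ¬ c i ≈ 0#) × (∀ j → ∑ (λ i → c i * M i j) ≈ 0#)

  -- Elimination without division: each remaining row is multiplied by the pivot before a multiple
  -- of the pivot row is subtracted. So the lemma serves ℤ, for the powers of a matrix, as well as
  -- the field, for vectors of the eigenspace. The double negation pays for the search for a pivot.
  dependent : ∀ {r m} → m ≤ r → (M : Fin (suc r) → Fin m → Carrier) → ¬ ¬ (∃ (Relation M))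
  dependent {m = zero} _ M k = k ((λ _ → 1#) , (zero , 1≉0) , λ ())
  dependent {suc r} {suc m} (s≤s m≤r) M k =
    ¬¬-finite (λ i → em) λ dec → cases (finite-split dec)
    where
    cases : _ → ⊥
    cases (inj₁ zeros) = dependent m≤r (λ i j → M (suc i) (suc j)) λ
      { (c , (i , ci≉0) , rel) → k ((λ { zero → 0# ; (suc i) → c i }) , (suc i , ci≉0) , λ
        { zero → ∑-suc-zero _ (zeroˡ _) (∑-zero λ i → trans (*-congˡ (zeros (suc i))) (zeroʳ _))
        ; (suc j) → ∑-suc-zero _ (zeroˡ _) (rel j) }) }
    cases (inj₂ (p , pivot≉0)) = dependent m≤r M′ λ
      { (c , (i , ci≉0) , rel) → k (C c , (punchIn p i , λ eq → nonzero _ _ ci≉0 pivot≉0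
            (trans (reflexive (≡.sym (Vecₚ.insertAt-punchIn (λ i → c i * pivot) p (last c) i))) eq))
          , λ { zero → first c ; (suc j) → rest c j (rel j) }) }
      where
      pivot = M p zero
      q : Fin (suc r) → Fin (suc (suc r))
      q = punchIn p
      M′ : Fin (suc r) → Fin m → Carrier
      M′ i j = pivot * M (q i) (suc j) - M (q i) zero * M p (suc j)
      -- The other coefficients are scaled by the pivot, so this one makes the first column cancel.
      last : (Fin (suc r) → Carrier) → Carrier
      last c = - ∑ (λ i → c i * M (q i) zero)
      C : (Fin (suc r) → Carrier) → Fin (suc (suc r)) → Carrier
      C c = insertAt (λ i → c i * pivot) p (last c)
      split : ∀ c j → ∑ (λ i → C c i * M i j) ≈ last c * M p j + ∑ (λ i → c i * pivot * M (q i) j)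
      split c j = trans (∑-remove p (λ i → C c i * M i j))
        (+-cong (*-congʳ (reflexive (Vecₚ.insertAt-lookup (λ i → c i * pivot) p (last c))))
                (∑-cong λ i → *-congʳ (reflexive (Vecₚ.insertAt-punchIn (λ i → c i * pivot) p (last c) i))))
      first : ∀ c → ∑ (λ i → C c i * M i zero) ≈ 0#
      first c = begin
        ∑ (λ i → C c i * M i zero) ≈⟨ split c zero ⟩
        - s * pivot + ∑ (λ i → c i * pivot * M (q i) zero) ≈⟨ +-congˡ (∑-cong λ i → solve 3 (λ x y z → x :* y :* z := x :* z :* y) refl (c i) pivot (M (q i) zero)) ⟩
        - s * pivot + ∑ (λ i → c i * M (q i) zero * pivot) ≈⟨ +-congˡ (∑-* pivot _) ⟨
        - s * pivot + s * pivot ≈⟨ solve 2 (λ s p → :- s :* p :+ s :* p := :0) refl s pivot ⟩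
        0# ∎
        where s = ∑ (λ i → c i * M (q i) zero)
      rest : ∀ c j → ∑ (λ i → c i * M′ i j) ≈ 0# → ∑ (λ i → C c i * M i (suc j)) ≈ 0#
      rest c j rel = begin
        ∑ (λ i → C c i * M i (suc j)) ≈⟨ split c (suc j) ⟩
        - s * e + ∑ (λ i → c i * pivot * M (q i) (suc j)) ≈⟨ +-congˡ (∑-cong λ i → solve 5 (λ c p x y e → c :* p :* x := c :* (p :* x :- y :* e) :+ c :* y :* e) refl (c i) pivot (M (q i) (suc j)) (M (q i) zero) e) ⟩
        - s * e + ∑ (λ i → c i * M′ i j + c i * M (q i) zero * e) ≈⟨ +-congˡ (∑-+ _ _) ⟩
        - s * e + (∑ (λ i → c i * M′ i j) + ∑ (λ i → c i * M (q i) zero * e)) ≈⟨ +-congˡ (+-cong rel (sym (∑-* e _))) ⟩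
        - s * e + (0# + s * e) ≈⟨ solve 2 (λ s p → :- s :* p :+ (:0 :+ s :* p) := :0) refl s e ⟩
        0# ∎
        where
        s = ∑ (λ i → c i * M (q i) zero)
        e = M p (suc j)

module Kernel {c ℓ : Level} (F : Field c ℓ) where
  open Field F hiding (zero)
  open Sums commutativeRing
  open Initial.Solver commutativeRing
  open import Relation.Binary.Reasoning.Setoid setoid

  -- Coordinates with respect to b are read off at the positions p.
  record EchelonBasis {n : ℕ} (V : (Fin n → Carrier) → Set ℓ) : Set (c ⊔ ℓ) where
    field
      d : ℕ
      p : Fin d → Fin n
      b : Fin d → Fin n → Carrier
      b∈V : ∀ i → V (b i)
      dual : ∀ i j → b i (p j) ≈ δ i j
      spans : ∀ v → V v → ∀ x → v x ≈ ∑ (λ i → v (p i) * b i x)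

  private
    δ-injective : ∀ {m n} (f : Fin m → Fin n) → (∀ {i j} → f i ≡ f j → i ≡ j) →
                  ∀ i j → δ (f i) (f j) ≡ δ i j
    δ-injective f inj i j with i Fin.≟ j
    ... | yes ≡.refl = ≡.trans (δ-refl (f i)) (≡.sym (δ-refl i))
    ... | no ne = ≡.trans (δ-≢ (λ eq → ne (inj eq))) (≡.sym (δ-≢ ne))

    linear : ∀ {n} (M u w : Fin n → Carrier) e →
      ∑ (λ x → M x * (u x - e * w x)) ≈ ∑ (λ x → M x * u x) - e * ∑ (λ x → M x * w x)
    linear M u w e = begin
      ∑ (λ x → M x * (u x - e * w x))
        ≈⟨ ∑-cong (λ x → solve 4 (λ m u w e → m :* (u :- e :* w) := m :* u :+ (:- e) :* (m :* w)) refl (M x) (u x) (w x) e) ⟩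
      ∑ (λ x → M x * u x + (- e) * (M x * w x)) ≈⟨ ∑-+ _ _ ⟩
      ∑ (λ x → M x * u x) + ∑ (λ x → (- e) * (M x * w x)) ≈⟨ +-congˡ (*-∑ _ _) ⟨
      ∑ (λ x → M x * u x) + (- e) * ∑ (λ x → M x * w x)
        ≈⟨ solve 3 (λ a e s → a :+ (:- e) :* s := a :- e :* s) refl _ e _ ⟩
      ∑ (λ x → M x * u x) - e * ∑ (λ x → M x * w x) ∎

  Solution : ∀ {m n} → (Fin m → Fin n → Carrier) → (Fin n → Carrier) → Set ℓ
  Solution M v = ∀ j → ∑ (λ x → M j x * v x) ≈ 0#

  -- Equations are imposed one at a time. If the new functional vanishes on the basis, nothing
  -- changes. Otherwise a vector `b q` on which it does not vanish is spent on correcting the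
  -- others; as `b q` is zero at their positions, these still read off coordinates.
  kernel : ∀ {m n} (M : Fin m → Fin n → Carrier) → ¬ ¬ EchelonBasis (Solution M)
  kernel {zero} {n} M k = k record
    { d = n ; p = λ i → i ; b = δ ; b∈V = λ _ () ; dual = λ _ _ → refl
    ; spans = λ v _ x → begin
        v x ≈⟨ ∑-δ x v ⟨
        ∑ (λ i → δ x i * v i) ≈⟨ ∑-cong (λ i → trans (*-comm _ _) (*-congˡ (reflexive (δ-sym x i)))) ⟩
        ∑ (λ i → v i * δ i x) ∎ }
  kernel {suc m} {n} M k = kernel (λ j → M (suc j)) λ B →
    ¬¬-finite (λ i → em {P = ∑ (λ x → M zero x * EchelonBasis.b B i x) ≈ 0#}) λ dec → cases B (finite-split dec)
    where
    cases : (B : EchelonBasis (Solution (λ j → M (suc j)))) →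
      (∀ i → ∑ (λ x → M zero x * EchelonBasis.b B i x) ≈ 0#) ⊎
      (∃ λ i → ¬ ∑ (λ x → M zero x * EchelonBasis.b B i x) ≈ 0#) → ⊥
    cases B (inj₁ zeros) = k record
      { d = d ; p = p ; b = b ; dual = dual
      ; b∈V = λ { i zero → zeros i ; i (suc j) → b∈V i j }
      ; spans = λ v sol → spans v (λ j → sol (suc j)) }
      where open EchelonBasis B
    cases record { d = suc d ; p = p ; b = b ; b∈V = b∈V ; dual = dual ; spans = spans } (inj₂ (q , cq≉0)) = k record
      { d = d ; p = λ i → p (punchIn q i) ; b = b′
      ; b∈V = λ { i zero → trans (linear (M zero) (b (punchIn q i)) (b q) _) (row₀ i)
                ; i (suc j) → trans (linear (M (suc j)) (b (punchIn q i)) (b q) _)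
                    (trans (+-cong (b∈V (punchIn q i) j) (-‿cong (*-congˡ (b∈V q j)))) (solve 1 (λ e → :0 :- e :* :0 := :0) refl _)) }
      ; dual = λ i j → begin
          b (punchIn q i) (p (punchIn q j)) - e i * b q (p (punchIn q j))
            ≈⟨ +-cong (dual _ _) (-‿cong (*-congˡ (dual _ _))) ⟩
          δ (punchIn q i) (punchIn q j) - e i * δ q (punchIn q j)
            ≡⟨ ≡.cong₂ (λ s t → s - e i * t) (δ-injective (punchIn q) (Finₚ.punchIn-injective q _ _) i j)
                 (δ-≢ (λ eq → Finₚ.punchInᵢ≢i q j (≡.sym eq))) ⟩
          δ i j - e i * 0# ≈⟨ solve 2 (λ d e → d :- e :* :0 := d) refl _ _ ⟩
          δ i j ∎
      ; spans = span′ }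
      where
      C : Fin (suc d) → Carrier
      C i = ∑ (λ x → M zero x * b i x)
      r : Carrier
      r = proj₁ (inverse (C q) cq≉0)
      cr : C q * r ≈ 1#
      cr = proj₂ (inverse (C q) cq≉0)
      e : Fin d → Carrier
      e i = C (punchIn q i) * r
      b′ : Fin d → Fin n → Carrier
      b′ i x = b (punchIn q i) x - e i * b q x
      row₀ : ∀ i → C (punchIn q i) - e i * C q ≈ 0#
      row₀ i = begin
        C (punchIn q i) - C (punchIn q i) * r * C q
          ≈⟨ solve 3 (λ c r q → c :- c :* r :* q := c :- c :* (q :* r)) refl _ r (C q) ⟩
        C (punchIn q i) - C (punchIn q i) * (C q * r) ≈⟨ +-congˡ (-‿cong (*-congˡ cr)) ⟩
        C (punchIn q i) - C (punchIn q i) * 1#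
          ≈⟨ trans (+-congˡ (-‿cong (*-identityʳ _))) (-‿inverseʳ _) ⟩
        0# ∎
      span′ : ∀ v → Solution M v → ∀ x → v x ≈ ∑ (λ i → v (p (punchIn q i)) * b′ i x)
      span′ v sol x = begin
        v x ≈⟨ spans v v∈ x ⟩
        ∑ (λ i → v (p i) * b i x) ≈⟨ ∑-remove q _ ⟩
        v (p q) * b q x + S ≈⟨ +-congʳ (*-congʳ vpq) ⟩
        (- T * r) * b q x + S ≈⟨ solve 4 (λ t r b s → (:- t :* r) :* b :+ s := s :+ t :* (:- (r :* b))) refl T r (b q x) S ⟩
        S + T * (- (r * b q x)) ≈⟨ +-congˡ (∑-* _ _) ⟩
        S + ∑ (λ i → v (p′ i) * C (punchIn q i) * (- (r * b q x))) ≈⟨ ∑-+ _ _ ⟨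
        ∑ (λ i → v (p′ i) * b (punchIn q i) x + v (p′ i) * C (punchIn q i) * (- (r * b q x)))
          ≈⟨ ∑-cong (λ i → solve 5 (λ v b c r bq → v :* b :+ v :* c :* (:- (r :* bq)) := v :* (b :- c :* r :* bq)) refl
               (v (p′ i)) (b (punchIn q i) x) (C (punchIn q i)) r (b q x)) ⟩
        ∑ (λ i → v (p′ i) * b′ i x) ∎
        where
        v∈ : Solution (λ j → M (suc j)) v
        v∈ j = sol (suc j)
        p′ : Fin d → Fin n
        p′ i = p (punchIn q i)
        S T : Carrier
        S = ∑ (λ i → v (p′ i) * b (punchIn q i) x)
        T = ∑ (λ i → v (p′ i) * C (punchIn q i))
        -- The new equation in coordinates: it determines the coordinate of `v` at the position that
        -- is given up.
        eqn : v (p q) * C q + T ≈ 0#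
        eqn = begin
          v (p q) * C q + T ≈⟨ ∑-remove q (λ i → v (p i) * C i) ⟨
          ∑ (λ i → v (p i) * C i) ≈⟨ ∑-cong (λ i → *-∑ _ _) ⟩
          ∑ (λ i → ∑ (λ y → v (p i) * (M zero y * b i y))) ≈⟨ ∑-comm _ ⟩
          ∑ (λ y → ∑ (λ i → v (p i) * (M zero y * b i y))) ≈⟨ ∑-cong (λ y → ∑-cong λ i → solve 3 (λ v m b → v :* (m :* b) := m :* (v :* b)) refl _ _ _) ⟩
          ∑ (λ y → ∑ (λ i → M zero y * (v (p i) * b i y))) ≈⟨ ∑-cong (λ y → *-∑ _ _) ⟨
          ∑ (λ y → M zero y * ∑ (λ i → v (p i) * b i y)) ≈⟨ ∑-cong (λ y → *-congˡ (spans v v∈ y)) ⟨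
          ∑ (λ y → M zero y * v y) ≈⟨ sol zero ⟩
          0# ∎
        vpq : v (p q) ≈ - T * r
        vpq = begin
          v (p q) ≈⟨ *-identityʳ _ ⟨
          v (p q) * 1# ≈⟨ *-congˡ cr ⟨
          v (p q) * (C q * r) ≈⟨ solve 4 (λ v c r t → v :* (c :* r) := (v :* c :+ t) :* r :+ :- t :* r) refl _ _ r T ⟩
          (v (p q) * C q + T) * r + - T * r ≈⟨ +-congʳ (*-congʳ eqn) ⟩
          0# * r + - T * r ≈⟨ trans (+-congʳ (zeroˡ r)) (+-identityˡ _) ⟩
          - T * r ∎

  module _ (G : Graph) where
    open Graph G

    module _ (θ : Carrier) (mult : EigenvalueOfMultiplicity F G θ 3) where
      private
        M : Fin n → Fin n → Carrier
        M x y = A F G x y - θ * δ x y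

        expand : ∀ v x → ∑ (λ y → M x y * v y) ≈ ΣF F (λ y → A F G x y * v y) - θ * v x
        expand v x = begin
          ∑ (λ y → M x y * v y)
            ≈⟨ ∑-cong (λ y → solve 4 (λ a t d v → (a :- t :* d) :* v := a :* v :+ (:- t) :* (d :* v)) refl (A F G x y) θ (δ x y) (v y)) ⟩
          ∑ (λ y → A F G x y * v y + (- θ) * (δ x y * v y)) ≈⟨ ∑-+ _ _ ⟩
          ∑ (λ y → A F G x y * v y) + ∑ (λ y → (- θ) * (δ x y * v y)) ≈⟨ +-cong (sym (foldr-∑ _)) (sym (*-∑ _ _)) ⟩
          ΣF F (λ y → A F G x y * v y) + (- θ) * ∑ (λ y → δ x y * v y) ≈⟨ +-congˡ (*-congˡ (∑-δ x v)) ⟩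
          ΣF F (λ y → A F G x y * v y) + (- θ) * v x ≈⟨ solve 3 (λ s t v → s :+ (:- t) :* v := s :- t :* v) refl _ θ (v x) ⟩
          ΣF F (λ y → A F G x y * v y) - θ * v x ∎

        toSolution : ∀ {v} → IsEigenvector F G θ v → Solution M v
        toSolution {v} ev x = trans (expand v x) (trans (+-congʳ (ev x)) (-‿inverseʳ _))

        fromSolution : ∀ {v} → Solution M v → IsEigenvector F G θ v
        fromSolution {v} sol x = begin
          s ≈⟨ solve 2 (λ s t → s := (s :- t) :+ t) refl s (θ * v x) ⟩
          (s - θ * v x) + θ * v x ≈⟨ +-congʳ (trans (sym (expand v x)) (sol x)) ⟩
          0# + θ * v x ≈⟨ +-identityˡ _ ⟩
          θ * v x ∎
          where s = ΣF F (λ y → A F G x y * v y)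

      -- An empty basis would make the three given eigenvectors zero, against their independence.
      -- Four basis vectors would be independent, because evaluation at the positions returns the
      -- coefficients. The lower bound will keep a trace from vanishing, the upper one bounds the
      -- rank.
      eigenbasis : ¬ ¬ (Σ (EchelonBasis (IsEigenvector F G θ)) λ B → 1 ≤ EchelonBasis.d B × EchelonBasis.d B ≤ 3)
      eigenbasis k = kernel M λ S → let open EchelonBasis S in k
        (record { d = d ; p = p ; b = b ; b∈V = λ i → fromSolution (b∈V i) ; dual = dual
                ; spans = λ v ev → spans v (toSolution ev) } , lower d p b spans , upper S)
        where
        vs = proj₁ (proj₁ mult)
        lower : ∀ d (p : Fin d → Fin n) b → (∀ v → Solution M v → ∀ x → v x ≈ ∑ (λ i → v (p i) * b i x)) → 1 ≤ d
        lower zero p b spans = ⊥-elim (1≉0 (proj₂ (proj₂ (proj₁ mult)) (λ _ → 1#)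
          (λ x → trans (foldr-∑ _) (∑-zero λ i → trans (*-congˡ (trans (spans (vs i) (toSolution (proj₁ (proj₂ (proj₁ mult)) i)) x) (∑-empty _))) (zeroʳ 1#))) zero))
        lower (suc d) _ _ _ = s≤s z≤n
        upper : (S : EchelonBasis (Solution M)) → EchelonBasis.d S ≤ 3
        upper S with EchelonBasis.d S ℕ.≤? 3
        ... | yes d≤3 = d≤3
        ... | no d≰3 = ⊥-elim (proj₂ mult (λ i → b (q i)) (λ i → fromSolution (b∈V (q i))) λ coef rel i →
            begin
              coef i ≈⟨ ∑-δ i coef ⟨
              ∑ (λ j → δ i j * coef j) ≈⟨ ∑-cong (λ j → trans (*-comm _ _) (*-congˡ (reflexive (≡.trans (δ-sym i j) (≡.sym (δ-injective q (Finₚ.inject≤-injective _ _ _ _) j i)))))) ⟩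
              ∑ (λ j → coef j * δ (q j) (q i)) ≈⟨ ∑-cong (λ j → *-congˡ (dual (q j) (q i))) ⟨
              ∑ (λ j → coef j * b (q j) (p (q i))) ≈⟨ foldr-∑ _ ⟨
              ΣF F (λ j → coef j * b (q j) (p (q i))) ≈⟨ rel (p (q i)) ⟩
              0# ∎)
          where
          open EchelonBasis S
          q : Fin 4 → Fin d
          q i = Fin.inject≤ i (ℕₚ.≰⇒> d≰3)

-- Equality in F need not be decidable or stable. Only ⊥ is ever concluded from it, so it may be replaced by its double negation.
module Stable {c ℓ : Level} (F : Field c ℓ) where
  open Field F

  _≋_ : Carrier → Carrier → Set ℓ
  x ≋ y = ¬ ¬ (x ≈ y)

  private
    ret : ∀ {x y} → x ≈ y → x ≋ y
    ret eq k = k eq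

  stableRing : CommutativeRing c ℓ
  stableRing = record
    { Carrier = Carrier ; _≈_ = _≋_ ; _+_ = _+_ ; _*_ = _*_ ; -_ = -_ ; 0# = 0# ; 1# = 1#
    ; isCommutativeRing = record
      { isRing = record
        { +-isAbelianGroup = record
          { isGroup = record
            { isMonoid = record
              { isSemigroup = record
                { isMagma = record
                  { isEquivalence = record
                    { refl = ret refl
                    ; sym = λ p k → p λ p → k (sym p)
                    ; trans = λ p q k → p λ p → q λ q → k (trans p q) }
                  ; ∙-cong = λ p q k → p λ p → q λ q → k (+-cong p q) }
                ; assoc = λ x y z → ret (+-assoc x y z) }
              ; identity = (λ x → ret (+-identityˡ x)) , λ x → ret (+-identityʳ x) }
            ; inverse = (λ x → ret (-‿inverseˡ x)) , λ x → ret (-‿inverseʳ x)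
            ; ⁻¹-cong = λ p k → p λ p → k (-‿cong p) }
          ; comm = λ x y → ret (+-comm x y) }
        ; *-cong = λ p q k → p λ p → q λ q → k (*-cong p q)
        ; *-assoc = λ x y z → ret (*-assoc x y z)
        ; *-identity = (λ x → ret (*-identityˡ x)) , λ x → ret (*-identityʳ x)
        ; distrib = (λ x y z → ret (distribˡ x y z)) , λ x y z → ret (distribʳ x y z) }
      ; *-comm = λ x y → ret (*-comm x y) } }

  stableField : Field c ℓ
  stableField = record
    { commutativeRing = stableRing
    ; 1≉0 = λ p → p 1≉0
    ; inverse = λ x x≉0 → let (y , eq) = inverse x (λ eq → x≉0 (ret eq)) in y , ret eq }

  private module K = Field stableField

  ×-agree : ∀ m x → m K.×ᵣ x ≡ m ×ᵣ x
  ×-agree zero x = ≡.refl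
  ×-agree (suc m) x = ≡.cong (x +_) (×-agree m x)

  stable-charZero : CharZero F → CharZero stableField
  stable-charZero ch m eq = eq λ eq → ch m (≡.subst (_≈ 0#) (×-agree (suc m) 1#) eq)

  stable-eq : ∀ {x y} → ¬ ¬ (x K.≈ y) → x K.≈ y
  stable-eq p k = p λ q → q k

  private
    module SF = Sums commutativeRing
    module SK = Sums stableRing

    δ-agree : ∀ {n} (i j : Fin n) → SF.δ i j ≡ SK.δ i j
    δ-agree zero zero = ≡.refl
    δ-agree zero (suc j) = ≡.refl
    δ-agree (suc i) zero = ≡.refl
    δ-agree (suc i) (suc j) = δ-agree i j

    ∑-agree : ∀ {n} (f : Fin n → Carrier) → SF.∑ f K.≈ SK.∑ f
    ∑-agree f = K.trans (ret (sym (SF.foldr-∑ f))) (SK.foldr-∑ f)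

  -- Over the stable field an eigenvector satisfies each of its equations only up to double
  -- negation; the finitely many of them are collected under a single one before `spans` is applied.
  stable-basis : ∀ G θ (B : Kernel.EchelonBasis F (IsEigenvector F G θ)) →
    Σ (Kernel.EchelonBasis stableField (IsEigenvector stableField G θ)) λ B′ →
      Kernel.EchelonBasis.d B′ ≡ Kernel.EchelonBasis.d B
  stable-basis G θ B = record
    { d = d ; p = p ; b = b ; b∈V = λ i x → ret (b∈V i x)
    ; dual = λ i j → K.trans (ret (dual i j)) (K.reflexive (δ-agree i j))
    ; spans = λ v ev x → K.trans (λ k → ¬¬-finite ev λ ev → k (spans v ev x)) (∑-agree _) } , ≡.refl
    where open Kernel.EchelonBasis B

-- Polynomials are coefficient lists; they are evaluated at scalars and at linear operators.
-- Polynomials in the adjacency operator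

module Operators {c ℓ : Level} (K : Field c ℓ) (n : ℕ) where
  open Field K hiding (zero)
  open Sums commutativeRing
  open Initial commutativeRing using (ι; ι-+; ι-*)
  open Initial.Solver commutativeRing
  open import Algebra.Properties.Ring (CommutativeRing.ring commutativeRing) using (-0#≈0#)
  open import Relation.Binary.Reasoning.Setoid setoid

  Vector : Set c
  Vector = Fin n → Carrier

  infix 4 _≈ᵥ_
  _≈ᵥ_ : Vector → Vector → Set ℓ
  v ≈ᵥ w = ∀ x → v x ≈ w x

  𝟎 : Vector
  𝟎 _ = 0#

  infixl 6 _⊕_
  _⊕_ : Vector → Vector → Vector
  (v ⊕ w) x = v x + w x

  infixr 7 _⊙_
  _⊙_ : Carrier → Vector → Vector
  (a ⊙ v) x = a * v x

  ⟨_,_⟩ : Vector → Vector → Carrier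
  ⟨ v , w ⟩ = ∑ (λ x → v x * w x)

  record Linear (T : Vector → Vector) : Set (c ⊔ ℓ) where
    field
      cong : ∀ {v w} → v ≈ᵥ w → T v ≈ᵥ T w
      add : ∀ v w → T (v ⊕ w) ≈ᵥ T v ⊕ T w
      scale : ∀ a v → T (a ⊙ v) ≈ᵥ a ⊙ T v

    null : ∀ {v} → v ≈ᵥ 𝟎 → T v ≈ᵥ 𝟎
    null {v} eq x = begin
      T v x ≈⟨ cong (λ y → trans (eq y) (sym (zeroˡ _))) x ⟩
      T (0# ⊙ v) x ≈⟨ scale 0# v x ⟩
      0# * T v x ≈⟨ zeroˡ _ ⟩
      0# ∎

  SelfAdjoint : (Vector → Vector) → Set (c ⊔ ℓ)
  SelfAdjoint T = ∀ v w → ⟨ T v , w ⟩ ≈ ⟨ v , T w ⟩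

  Commute : (Vector → Vector) → (Vector → Vector) → Set (c ⊔ ℓ)
  Commute S T = ∀ v → S (T v) ≈ᵥ T (S v)

  IntegerValued : Vector → Set ℓ
  IntegerValued v = ∀ x → ∃ λ z → v x ≈ ι z

  Integral : (Vector → Vector) → Set (c ⊔ ℓ)
  Integral T = ∀ v → IntegerValued v → IntegerValued (T v)

  ⟨⟩-cong : ∀ {v v′ w w′} → v ≈ᵥ v′ → w ≈ᵥ w′ → ⟨ v , w ⟩ ≈ ⟨ v′ , w′ ⟩
  ⟨⟩-cong p q = ∑-cong λ x → *-cong (p x) (q x)

  ⟨⟩-comm : ∀ v w → ⟨ v , w ⟩ ≈ ⟨ w , v ⟩
  ⟨⟩-comm v w = ∑-cong λ x → *-comm _ _

  ⟨⟩-linear : ∀ a v u w → ⟨ a ⊙ v ⊕ u , w ⟩ ≈ a * ⟨ v , w ⟩ + ⟨ u , w ⟩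
  ⟨⟩-linear a v u w = begin
    ∑ (λ x → (a * v x + u x) * w x) ≈⟨ ∑-cong (λ x → trans (distribʳ _ _ _) (+-congʳ (*-assoc _ _ _))) ⟩
    ∑ (λ x → a * (v x * w x) + u x * w x) ≈⟨ ∑-+ _ _ ⟩
    ∑ (λ x → a * (v x * w x)) + ⟨ u , w ⟩ ≈⟨ +-congʳ (*-∑ _ _) ⟨
    a * ⟨ v , w ⟩ + ⟨ u , w ⟩ ∎

  act : (Vector → Vector) → List Carrier → Vector → Vector
  act T [] v = 𝟎
  act T (a ∷ as) v = a ⊙ v ⊕ T (act T as v)

  iter : (Vector → Vector) → ℕ → Vector → Vector
  iter T zero v = v
  iter T (suc j) v = T (iter T j v)

  ev : List Carrier → Carrier → Carrier
  ev [] t = 0#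
  ev (a ∷ as) t = a + t * ev as t

  module _ {T : Vector → Vector} (lin : Linear T) where
    open Linear lin

    act-linear : ∀ p → Linear (act T p)
    act-linear [] = record
      { cong = λ _ _ → refl ; add = λ _ _ _ → sym (+-identityˡ _) ; scale = λ _ _ _ → sym (zeroʳ _) }
    act-linear (a ∷ as) = record
      { cong = λ eq x → +-cong (*-congˡ (eq x)) (cong (L.cong eq) x)
      ; add = λ v w x → begin
          a * (v x + w x) + T (act T as (v ⊕ w)) x
            ≈⟨ +-congˡ (trans (cong (L.add v w) x) (add _ _ x)) ⟩
          a * (v x + w x) + (T (act T as v) x + T (act T as w) x)
            ≈⟨ solve 5 (λ a v w s t → a :* (v :+ w) :+ (s :+ t) := (a :* v :+ s) :+ (a :* w :+ t)) refl a (v x) (w x) _ _ ⟩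
          (a * v x + T (act T as v) x) + (a * w x + T (act T as w) x) ∎
      ; scale = λ e v x → begin
          a * (e * v x) + T (act T as (e ⊙ v)) x ≈⟨ +-congˡ (trans (cong (L.scale e v) x) (scale _ _ x)) ⟩
          a * (e * v x) + e * T (act T as v) x
            ≈⟨ solve 4 (λ a e v s → a :* (e :* v) :+ e :* s := e :* (a :* v :+ s)) refl a e (v x) _ ⟩
          e * (a * v x + T (act T as v) x) ∎ }
      where module L = Linear (act-linear as)

    iter-linear : ∀ j → Linear (iter T j)
    iter-linear zero = record { cong = λ eq → eq ; add = λ _ _ _ → refl ; scale = λ _ _ _ → refl }
    iter-linear (suc j) = record
      { cong = λ eq → cong (L.cong eq)
      ; add = λ v w x → trans (cong (L.add v w) x) (add _ _ x)
      ; scale = λ a v x → trans (cong (L.scale a v) x) (scale _ _ x) }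
      where module L = Linear (iter-linear j)

    iter-shift : ∀ j v → iter T j (T v) ≈ᵥ iter T (suc j) v
    iter-shift zero v x = refl
    iter-shift (suc j) v = cong (iter-shift j v)

    act-commute : ∀ {S} → Linear S → Commute S T → ∀ p → Commute S (act T p)
    act-commute linS com [] v = Linear.null linS (λ _ → refl)
    act-commute {S} linS com (a ∷ as) v x = begin
      S (a ⊙ v ⊕ T (act T as v)) x ≈⟨ Linear.add linS _ _ x ⟩
      S (a ⊙ v) x + S (T (act T as v)) x ≈⟨ +-cong (Linear.scale linS a v x) (com _ x) ⟩
      a * S v x + T (S (act T as v)) x ≈⟨ +-congˡ (cong (act-commute linS com as v) x) ⟩
      a * S v x + T (act T as (S v)) x ∎

    act-selfAdjoint : SelfAdjoint T → ∀ p → SelfAdjoint (act T p)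
    act-selfAdjoint sa [] v w = ∑-cong λ x → trans (zeroˡ _) (sym (zeroʳ _))
    act-selfAdjoint sa (a ∷ as) v w = begin
      ⟨ a ⊙ v ⊕ T (act T as v) , w ⟩ ≈⟨ ⟨⟩-linear a v _ w ⟩
      a * ⟨ v , w ⟩ + ⟨ T (act T as v) , w ⟩ ≈⟨ +-cong (*-congˡ (⟨⟩-comm v w)) (sa _ _) ⟩
      a * ⟨ w , v ⟩ + ⟨ act T as v , T w ⟩ ≈⟨ +-congˡ (act-selfAdjoint sa as v (T w)) ⟩
      a * ⟨ w , v ⟩ + ⟨ v , act T as (T w) ⟩ ≈⟨ +-congˡ (⟨⟩-cong {v} (λ _ → refl) (λ x → sym (act-commute lin (λ _ _ → refl) as w x))) ⟩
      a * ⟨ w , v ⟩ + ⟨ v , T (act T as w) ⟩ ≈⟨ +-congˡ (⟨⟩-comm v _) ⟩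
      a * ⟨ w , v ⟩ + ⟨ T (act T as w) , v ⟩ ≈⟨ ⟨⟩-linear a w _ v ⟨
      ⟨ a ⊙ w ⊕ T (act T as w) , v ⟩ ≈⟨ ⟨⟩-comm _ v ⟩
      ⟨ v , a ⊙ w ⊕ T (act T as w) ⟩ ∎

    act-integral : Integral T → ∀ zs → Integral (act T (map ι zs))
    act-integral int [] v iv x = pos 0 , refl
    act-integral int (z ∷ zs) v iv x =
      let (y , eq) = iv x ; (u , eq′) = int _ (act-integral int zs v iv) x
      in z ℤ.* y ℤ.+ u , trans (+-cong (trans (*-congˡ eq) (sym (ι-* z y))) eq′) (sym (ι-+ (z ℤ.* y) u))

    iter-integral : Integral T → ∀ j → Integral (iter T j)
    iter-integral int zero v iv = iv
    iter-integral int (suc j) v iv = int _ (iter-integral int j v iv)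

    act-eigen : ∀ {t v} → T v ≈ᵥ t ⊙ v → ∀ p → act T p v ≈ᵥ ev p t ⊙ v
    act-eigen eig [] x = sym (zeroˡ _)
    act-eigen {t} {v} eig (a ∷ as) x = begin
      a * v x + T (act T as v) x ≈⟨ +-congˡ (cong (act-eigen eig as) x) ⟩
      a * v x + T (ev as t ⊙ v) x ≈⟨ +-congˡ (scale _ v x) ⟩
      a * v x + ev as t * T v x ≈⟨ +-congˡ (*-congˡ (eig x)) ⟩
      a * v x + ev as t * (t * v x) ≈⟨ solve 4 (λ a v e t → a :* v :+ e :* (t :* v) := (a :+ t :* e) :* v) refl a (v x) (ev as t) t ⟩
      (a + t * ev as t) * v x ∎

    act-sum : ∀ {r} (z : Fin r → ℤ) v → act T (map ι (tabulate z)) v ≈ᵥ λ x → ∑ (λ j → ι (z j) * iter T (Fin.toℕ j) v x)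
    act-sum {zero} z v x = sym (∑-empty _)
    act-sum {suc r} z v x = begin
      ι (z zero) * v x + T (act T as v) x ≈⟨ +-congˡ (act-commute lin (λ _ _ → refl) as v x) ⟩
      ι (z zero) * v x + act T as (T v) x ≈⟨ +-congˡ (act-sum (λ j → z (suc j)) (T v) x) ⟩
      ι (z zero) * v x + ∑ (λ j → ι (z (suc j)) * iter T (Fin.toℕ j) (T v) x)
        ≈⟨ +-congˡ (∑-cong λ j → *-congˡ (iter-shift (Fin.toℕ j) v x)) ⟩
      ι (z zero) * v x + ∑ (λ j → ι (z (suc j)) * iter T (suc (Fin.toℕ j)) v x) ≈⟨ ∑-suc _ ⟨
      ∑ (λ j → ι (z j) * iter T (Fin.toℕ j) v x) ∎
      where as = map ι (tabulate (λ j → z (suc j)))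

  Nonzero : List ℤ → Set
  Nonzero = Any (_≢ pos 0)

  private module Z = Sums ℤₚ.+-*-commutativeRing

  ι-∑ : ∀ {m} (f : Fin m → ℤ) → ι (Z.∑ f) ≈ ∑ (λ i → ι (f i))
  ι-∑ {zero} f = trans (reflexive (≡.cong ι (Z.∑-empty f))) (sym (∑-empty _))
  ι-∑ {suc m} f = begin
    ι (Z.∑ f) ≡⟨ ≡.cong ι (Z.∑-suc f) ⟩
    ι (f zero ℤ.+ Z.∑ (λ i → f (suc i))) ≈⟨ ι-+ (f zero) _ ⟩
    ι (f zero) + ι (Z.∑ (λ i → f (suc i))) ≈⟨ +-congˡ (ι-∑ _) ⟩
    ι (f zero) + ∑ (λ i → ι (f (suc i))) ≈⟨ ∑-suc _ ⟨
    ∑ (λ i → ι (f i)) ∎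

  δ-integer : ∀ y → IntegerValued (δ y)
  δ-integer y x with y Fin.≟ x
  ... | yes ≡.refl = pos 1 , trans (reflexive (δ-refl y)) (sym (+-identityʳ 1#))
  ... | no ne = pos 0 , reflexive (δ-≢ ne)

  -- The first `n * n + 1` powers of an integer matrix are dependent over ℤ, since a matrix has
  -- `n * n` entries. Integer coefficients keep the operators built from the polynomial integral, as
  -- `definite` requires.
  annihilator : ∀ {T} → Linear T → Integral T →
    ¬ ¬ (∃ λ zs → Nonzero zs × ∀ y → act T (map ι zs) (δ y) ≈ᵥ 𝟎)
  annihilator {T} lin int k = dependent ℕₚ.≤-refl M λ { (z , (i , zi≢0) , rel) →
    k (tabulate z , Anyₚ.tabulate⁺ {f = z} i zi≢0 , λ y x → begin
      act T (map ι (tabulate z)) (δ y) x ≈⟨ act-sum lin z (δ y) x ⟩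
      ∑ (λ j → ι (z j) * iter T (Fin.toℕ j) (δ y) x) ≈⟨ ∑-cong (λ j → *-congˡ (proj₂ (entry j y x))) ⟩
      ∑ (λ j → ι (z j) * ι (proj₁ (entry j y x))) ≈⟨ ∑-cong (λ j → ι-* (z j) _) ⟨
      ∑ (λ j → ι (z j ℤ.* proj₁ (entry j y x)))
        ≡⟨ ≡.cong (λ yx → ∑ (λ j → ι (z j ℤ.* proj₁ (entry j (proj₁ yx) (proj₂ yx))))) (Finₚ.remQuot-combine {n} {n} y x) ⟨
      ∑ (λ j → ι (z j ℤ.* M j (Fin.combine y x))) ≈⟨ ι-∑ _ ⟨
      ι (Z.∑ (λ j → z j ℤ.* M j (Fin.combine y x))) ≡⟨ ≡.cong ι (rel (Fin.combine y x)) ⟩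
      0# ∎) }
    where
    open Dependence ℤₚ.+-*-commutativeRing (λ ()) (λ x y x≢0 y≢0 xy≡0 →
      Data.Sum.[ x≢0 , y≢0 ] (ℤₚ.i*j≡0⇒i≡0∨j≡0 x xy≡0)) using (dependent)
    entry : ∀ (j : Fin (suc (n ℕ.* n))) y x → ∃ λ z → iter T (Fin.toℕ j) (δ y) x ≈ ι z
    entry j y = iter-integral lin int (Fin.toℕ j) (δ y) (δ-integer y)
    M : Fin (suc (n ℕ.* n)) → Fin (n ℕ.* n) → ℤ
    M j i = proj₁ (entry j (proj₁ (Fin.remQuot {n} n i)) (proj₂ (Fin.remQuot {n} n i)))

  module _ (char0 : CharZero K) where

    ι-injective₀ : ∀ z → ι z ≈ 0# → z ≡ pos 0
    ι-injective₀ (pos zero) eq = ≡.refl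
    ι-injective₀ (pos (suc m)) eq = ⊥-elim (char0 m eq)
    ι-injective₀ -[1+ m ] eq = ⊥-elim (char0 m (begin
      ι (pos (suc m)) ≈⟨ solve 1 (λ x → x := :- (:- x)) refl _ ⟩
      - ι -[1+ m ] ≈⟨ -‿cong eq ⟩
      - 0# ≈⟨ -0#≈0# ⟩
      0# ∎))

    private
      total : ∀ {m} → (Fin m → ℕ) → ℕ
      total {zero} f = 0
      total {suc m} f = f zero ℕ.+ total (λ i → f (suc i))

      ∑-total : ∀ {m} (f : Fin m → ℕ) → ∑ (λ i → ι (pos (f i))) ≈ ι (pos (total f))
      ∑-total {zero} f = ∑-empty _
      ∑-total {suc m} f = trans (∑-suc _) (trans (+-congˡ (∑-total _)) (sym (ι-+ (pos (f zero)) (pos (total (λ i → f (suc i)))))))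

      total≡0 : ∀ {m} (f : Fin m → ℕ) → total f ≡ 0 → ∀ i → f i ≡ 0
      total≡0 f eq zero = ℕₚ.m+n≡0⇒m≡0 (f zero) eq
      total≡0 f eq (suc i) = total≡0 (λ i → f (suc i)) (ℕₚ.m+n≡0⇒n≡0 (f zero) eq) i

    -- This stands in for positive definiteness in a field without order: the sum is the image of a
    -- sum of squares in ℕ, which characteristic zero forces to vanish there.
    definite : ∀ v → IntegerValued v → ⟨ v , v ⟩ ≈ 0# → v ≈ᵥ 𝟎
    definite v iv eq x = trans (proj₂ (iv x)) (reflexive (≡.cong ι zx≡0))
      where
      z : Fin n → ℤ
      z x = proj₁ (iv x)
      square : ∀ i → i ℤ.* i ≡ pos (ℤ.∣ i ∣ ℕ.* ℤ.∣ i ∣)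
      square (pos m) = ≡.sym (ℤₚ.pos-* m m)
      square -[1+ m ] = ≡.refl
      norm : ∑ (λ x → ι (pos (ℤ.∣ z x ∣ ℕ.* ℤ.∣ z x ∣))) ≈ 0#
      norm = begin
        ∑ (λ x → ι (pos (ℤ.∣ z x ∣ ℕ.* ℤ.∣ z x ∣))) ≈⟨ ∑-cong (λ x → reflexive (≡.cong ι (square (z x)))) ⟨
        ∑ (λ x → ι (z x ℤ.* z x)) ≈⟨ ∑-cong (λ x → ι-* (z x) (z x)) ⟩
        ∑ (λ x → ι (z x) * ι (z x)) ≈⟨ ∑-cong (λ x → *-cong (proj₂ (iv x)) (proj₂ (iv x))) ⟨
        ⟨ v , v ⟩ ≈⟨ eq ⟩
        0# ∎
      zx≡0 : z x ≡ pos 0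
      zx≡0 = ℤₚ.∣i∣≡0⇒i≡0 (Data.Sum.reduce (ℕₚ.m*n≡0⇒m≡0∨n≡0 ℤ.∣ z x ∣
        (total≡0 (λ x → ℤ.∣ z x ∣ ℕ.* ℤ.∣ z x ∣) (ℤₚ.+-injective (ι-injective₀ _ (trans (sym (∑-total _)) norm))) x)))

    -- Integer self-adjoint operators are semisimple at the eigenvalue 0.
    module _ {T : Vector → Vector} (lin : Linear T) (sa : SelfAdjoint T) (int : Integral T) where
      private
        -- By self-adjointness the norm of `Tᵃ⁺¹ u` is `⟨ Tᵃ u , Tᵃ⁺² u ⟩ = 0`, so `definite` lowers
        -- the exponent by one, until `T u` itself vanishes.
        descend : ∀ u a → IntegerValued u → iter T a u ≈ᵥ 𝟎 → T u ≈ᵥ 𝟎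
        descend u zero iu eq = Linear.null lin eq
        descend u (suc zero) iu eq = eq
        descend u (suc (suc a)) iu eq = descend u (suc a) iu
          (definite _ (iter-integral lin int (suc a) u iu) (begin
            ⟨ T (iter T a u) , iter T (suc a) u ⟩ ≈⟨ sa _ _ ⟩
            ⟨ iter T a u , iter T (suc (suc a)) u ⟩ ≈⟨ ∑-zero (λ x → trans (*-congˡ (eq x)) (zeroʳ _)) ⟩
            0# ∎))

        -- A zero constant term is a factor `t`, which is traded for one more application of `T`.
        -- Some coefficient is nonzero, so this ends with a nonzero constant term.
        strip : ∀ zs a → Nonzero zs → (∀ y → iter T a (act T (map ι zs) (δ y)) ≈ᵥ 𝟎) →
          ∃ λ d → ∃ λ ds → d ≢ pos 0 × ∃ λ a → ∀ y → iter T a (act T (map ι (d ∷ ds)) (δ y)) ≈ᵥ 𝟎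
        strip (z ∷ zs) a nz eq with z ℤ.≟ pos 0
        ... | no z≢0 = z , zs , z≢0 , a , eq
        ... | yes ≡.refl = strip zs (suc a) (later nz) λ y x → begin
          iter T (suc a) (act T (map ι zs) (δ y)) x ≈⟨ iter-shift lin a _ x ⟨
          iter T a (T (act T (map ι zs) (δ y))) x ≈⟨ Linear.cong (iter-linear lin a) (λ x → trans (+-congʳ (zeroˡ _)) (+-identityˡ _)) x ⟨
          iter T a (act T (map ι (z ∷ zs)) (δ y)) x ≈⟨ eq y x ⟩
          0# ∎
          where
          later : ∀ {zs} → Nonzero (pos 0 ∷ zs) → Nonzero zs
          later (here ne) = ⊥-elim (ne ≡.refl)
          later (there nz) = nz

      -- The operator found maps into the kernel of `T` and acts there as the scalar `d`, all its
      -- other terms containing a factor `T`. It is thus a nonzero multiple of the projection onto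
      -- the kernel.
      nullProjection : ¬ ¬ (∃ λ d → ∃ λ ds → d ≢ pos 0 × ∀ y → T (act T (map ι (d ∷ ds)) (δ y)) ≈ᵥ 𝟎)
      nullProjection k = annihilator lin int λ { (zs , nz , eq) →
        let (d , ds , d≢0 , a , eq′) = strip zs 0 nz eq
        in k (d , ds , d≢0 , λ y → descend _ a (act-integral lin int (d ∷ ds) (δ y) (δ-integer y)) (eq′ y)) }

    module _ (θ : Carrier) where
      -- the quotient of a polynomial by t − θ
      quot : List Carrier → List Carrier
      quot [] = []
      quot (a ∷ as) = ev as θ ∷ quot as

      act-quot : ∀ {T} → Linear T → ∀ g v x →
        act T g v x ≈ T (act T (quot g) v) x - θ * act T (quot g) v x + ev g θ * v x
      act-quot {T} lin [] v x = sym (begin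
        T 𝟎 x - θ * 0# + 0# * v x ≈⟨ +-congʳ (+-congʳ (Linear.null lin (λ _ → refl) x)) ⟩
        0# - θ * 0# + 0# * v x ≈⟨ solve 2 (λ t v → :0 :- t :* :0 :+ :0 :* v := :0) refl θ (v x) ⟩
        0# ∎)
      act-quot {T} lin (a ∷ as) v x = begin
        a * v x + T (act T as v) x
          ≈⟨ +-congˡ (cong (λ y → trans (act-quot lin as v y)
               (solve 5 (λ s t u e v → s :- t :* u :+ e :* v := (s :+ (:- t) :* u) :+ e :* v) refl _ θ _ e (v y))) x) ⟩
        a * v x + T ((T s ⊕ (- θ) ⊙ s) ⊕ e ⊙ v) x
          ≈⟨ +-congˡ (trans (add _ _ x) (+-cong (trans (add _ _ x) (+-congˡ (scale _ _ x))) (scale _ _ x))) ⟩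
        a * v x + (T (T s) x + (- θ) * T s x + e * T v x)
          ≈⟨ solve 7 (λ a v tts t ts e tv → a :* v :+ (tts :+ (:- t) :* ts :+ e :* tv)
               := (e :* tv :+ tts) :- t :* (e :* v :+ ts) :+ (a :+ t :* e) :* v) refl a (v x) (T (T s) x) θ (T s x) e (T v x) ⟩
        (e * T v x + T (T s) x) - θ * (e * v x + T s x) + (a + θ * e) * v x
          ≈⟨ +-congʳ (+-congʳ (trans (add _ _ x) (+-congʳ (scale _ _ x)))) ⟨
        T (e ⊙ v ⊕ T s) x - θ * (e * v x + T s x) + (a + θ * e) * v x ∎
        where
        open Linear lin
        s = act T (quot as) v
        e = ev as θ

      private
        -- `weighted m zs` has the coefficients `(m + i) zᵢ`, so `weighted 1 zs` is the derivative
        -- of `z ∷ zs`.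
        weighted : ℕ → List ℤ → List ℤ
        weighted m [] = []
        weighted m (z ∷ zs) = pos m ℤ.* z ∷ weighted (suc m) zs

        weighted-length : ∀ m zs → length (weighted m zs) ≡ length zs
        weighted-length m [] = ≡.refl
        weighted-length m (z ∷ zs) = ≡.cong suc (weighted-length (suc m) zs)

        weighted-nonzero : ∀ m {zs} → Nonzero zs → Nonzero (weighted (suc m) zs)
        weighted-nonzero m {z ∷ zs} (here ne) = here λ eq →
          Data.Sum.[ (λ ()) , ne ] (ℤₚ.i*j≡0⇒i≡0∨j≡0 (pos (suc m)) eq)
        weighted-nonzero m (there nz) = there (weighted-nonzero (suc m) nz)

        -- For `m = 1` the right-hand side is the value at `θ` of the quotient of `z ∷ zs` by
        -- `t − θ`: at `θ` this quotient and the derivative agree.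
        ev-weighted : ∀ m zs → ev (map ι (weighted m zs)) θ
          ≈ ι (pos m) * ev (map ι zs) θ + θ * ev (quot (map ι zs)) θ
        ev-weighted m [] = solve 2 (λ m t → :0 := m :* :0 :+ t :* :0) refl _ θ
        ev-weighted m (z ∷ zs) = begin
          ι (pos m ℤ.* z) + θ * ev (map ι (weighted (suc m) zs)) θ
            ≈⟨ +-cong (ι-* (pos m) z) (*-congˡ (ev-weighted (suc m) zs)) ⟩
          M * ι z + θ * ((1# + M) * e + θ * q)
            ≈⟨ +-congˡ (*-congˡ (+-congʳ (trans (distribʳ _ _ _) (+-congʳ (*-identityˡ _))))) ⟩
          M * ι z + θ * ((e + M * e) + θ * q)
            ≈⟨ solve 5 (λ m z t e q → m :* z :+ t :* ((e :+ m :* e) :+ t :* q) := m :* (z :+ t :* e) :+ t :* (e :+ t :* q)) refl M (ι z) θ e q ⟩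
          M * (ι z + θ * e) + θ * (e + θ * q) ∎
          where
          M = ι (pos m)
          e = ev (map ι zs) θ
          q = ev (quot (map ι zs)) θ

        vanishing : ∀ zs → ¬ Nonzero zs → ev (map ι zs) θ ≈ 0#
        vanishing [] _ = refl
        vanishing (z ∷ zs) ¬nz with z ℤ.≟ pos 0
        ... | no ne = ⊥-elim (¬nz (here ne))
        ... | yes ≡.refl = trans (+-cong refl (trans (*-congˡ (vanishing zs λ nz → ¬nz (there nz))) (zeroʳ _))) (+-identityˡ _)

      -- A nonzero polynomial has a derivative of some order with θ as a simple root.
      simpleRoot : ∀ zs → Nonzero zs → ev (map ι zs) θ ≈ 0# →
        ¬ ¬ (∃ λ g → ev (map ι g) θ ≈ 0# × ¬ ev (quot (map ι g)) θ ≈ 0#)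
      simpleRoot zs = go (length zs) zs ℕₚ.≤-refl
        where
        go : ∀ N zs → length zs ≤ N → Nonzero zs → ev (map ι zs) θ ≈ 0# →
          ¬ ¬ (∃ λ g → ev (map ι g) θ ≈ 0# × ¬ ev (quot (map ι g)) θ ≈ 0#)
        go (suc N) (z ∷ zs) (s≤s len) nz root k =
          -- If `θ` is not a simple root, it is also a root of the derivative. That polynomial is
          -- shorter, and it is nonzero unless only the constant term was; but a nonzero constant
          -- has no root.
          em {P = ev (quot (map ι (z ∷ zs))) θ ≈ 0#} λ
            { (inj₂ simple) → k (z ∷ zs , root , simple)
            ; (inj₁ multiple) → em {P = Nonzero zs} λ
              { (inj₁ nz′) → go N (weighted 1 zs) (≡.subst (_≤ N) (≡.sym (weighted-length 1 zs)) len)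
                  (weighted-nonzero 0 nz′) (begin
                    ev (map ι (weighted 1 zs)) θ ≈⟨ ev-weighted 1 zs ⟩
                    (1# + 0#) * ev (map ι zs) θ + θ * ev (quot (map ι zs)) θ ≈⟨ +-congʳ (trans (*-congʳ (+-identityʳ 1#)) (*-identityˡ _)) ⟩
                    ev (map ι zs) θ + θ * ev (quot (map ι zs)) θ ≈⟨ multiple ⟩
                    0# ∎) k
              ; (inj₂ ¬nz) → constant nz ¬nz } }
          where
          constant : Nonzero (z ∷ zs) → ¬ Nonzero zs → ⊥
          constant (here ne) ¬nz = ne (ι-injective₀ z (begin
            ι z ≈⟨ +-identityʳ _ ⟨
            ι z + 0# ≈⟨ +-congˡ (trans (*-congˡ (vanishing zs ¬nz)) (zeroʳ _)) ⟨
            ι z + θ * ev (map ι zs) θ ≈⟨ root ⟩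
            0# ∎))
          constant (there nz) ¬nz = ¬nz nz

-- Representation of the vertices in the eigenspace

module Representations {c ℓ : Level} (K : Field c ℓ) (G : Graph) where
  open Field K hiding (zero)
  open Graph G
  open Sums commutativeRing
  open Initial commutativeRing using (ι)
  open Initial.Solver commutativeRing
  open Operators K n
  open Kernel K using (EchelonBasis)
  open import Relation.Binary.Reasoning.Setoid setoid

  WalkEquivalent : Fin n → Fin n → Fin n → Fin n → Set
  WalkEquivalent x y x′ y′ = ∀ l → walks G l x y ≡ walks G l x′ y′

  -- U x y is the inner product of the unit vectors representing x and y in the eigenspace.
  record Representation (θ : Carrier) : Set (c ⊔ ℓ) where
    field
      U : Fin n → Fin n → Carrier
      symmetric : ∀ x y → U x y ≈ U y x
      unit : ∀ x → U x x ≈ 1#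
      eigen : ∀ x y → ∑ (λ z → A K G y z * U x z) ≈ θ * U x y
      walk : ∀ {x y x′ y′} → WalkEquivalent x y x′ y′ → U x y ≈ U x′ y′
      rank≤3 : ∀ (z : Fin 4 → Fin n) → ¬ ¬ (Σ (Fin 4 → Carrier) λ a → (∃ λ i → ¬ a i ≈ 0#) ×
                    ∀ w → ∑ (λ i → a i * U (z i) w) ≈ 0#)

  𝐀 : Vector → Vector
  𝐀 v x = ∑ (λ y → A K G x y * v y)

  𝐀-linear : Linear 𝐀
  𝐀-linear = record
    { cong = λ eq x → ∑-cong λ y → *-congˡ (eq y)
    ; add = λ v w x → trans (∑-cong λ y → distribˡ _ _ _) (∑-+ _ _)
    ; scale = λ a v x → trans (∑-cong λ y → solve 3 (λ m a v → m :* (a :* v) := a :* (m :* v)) refl _ a (v y)) (sym (*-∑ a _)) }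

  A-sym : ∀ x y → A K G x y ≈ A K G y x
  A-sym x y = reflexive (≡.cong (λ b → if b then 1# else 0#) (adj-sym x y))

  𝐀-selfAdjoint : SelfAdjoint 𝐀
  𝐀-selfAdjoint v w = begin
    ∑ (λ x → ∑ (λ y → A K G x y * v y) * w x) ≈⟨ ∑-cong (λ x → ∑-* _ _) ⟩
    ∑ (λ x → ∑ (λ y → A K G x y * v y * w x)) ≈⟨ ∑-comm _ ⟩
    ∑ (λ y → ∑ (λ x → A K G x y * v y * w x))
      ≈⟨ ∑-cong (λ y → ∑-cong λ x → trans (*-congʳ (*-congʳ (A-sym x y))) (solve 3 (λ a v w → a :* v :* w := v :* (a :* w)) refl _ (v y) (w x))) ⟩
    ∑ (λ y → ∑ (λ x → v y * (A K G y x * w x))) ≈⟨ ∑-cong (λ y → *-∑ _ _) ⟨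
    ∑ (λ y → v y * ∑ (λ x → A K G y x * w x)) ∎

  𝐀-integral : Integral 𝐀
  𝐀-integral v iv x = Sums.∑ ℤₚ.+-*-commutativeRing (λ y → proj₁ (term y)) , trans (∑-cong (λ y → proj₂ (term y))) (sym (ι-∑ (λ y → proj₁ (term y))))
    where
    term : ∀ y → ∃ λ z → A K G x y * v y ≈ ι z
    term y with adj x y
    ... | true = proj₁ (iv y) , trans (*-identityˡ _) (proj₂ (iv y))
    ... | false = pos 0 , zeroˡ _

  Family : Set c
  Family = Fin n → Vector

  -- Asking for invariance after every power of `A` makes the property survive an application of
  -- `A`, hence of any polynomial in it.
  WalkInvariant : Family → Set ℓ
  WalkInvariant E = ∀ j {x y x′ y′} → WalkEquivalent x y x′ y′ → iter 𝐀 j (E y) x ≈ iter 𝐀 j (E y′) x′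

  Preserving : (Vector → Vector) → Set (c ⊔ ℓ)
  Preserving T = ∀ E → WalkInvariant E → WalkInvariant (λ y → T (E y))

  iter-δ : ∀ j x y → iter 𝐀 j (δ y) x ≈ ι (pos (walks G j x y))
  iter-δ zero x y with x Fin.≟ y
  ... | yes ≡.refl = trans (reflexive (δ-refl x)) (sym (+-identityʳ 1#))
  ... | no ne = reflexive (δ-≢ (λ eq → ne (≡.sym eq)))
  iter-δ (suc j) x y = begin
    ∑ (λ z → A K G x z * iter 𝐀 j (δ y) z) ≈⟨ ∑-cong (λ z → *-congˡ (iter-δ j z y)) ⟩
    ∑ (λ z → A K G x z * ι (pos (walks G j z y))) ≈⟨ ∑-cong term ⟩
    ∑ (λ z → ι (pos ([ adj x z ] ℕ.* walks G j z y))) ≈⟨ ι-∑ _ ⟨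
    ι (Z.∑ (λ z → pos ([ adj x z ] ℕ.* walks G j z y))) ≡⟨ ≡.cong ι (Z.foldr-∑ (λ z → pos ([ adj x z ] ℕ.* walks G j z y))) ⟨
    ι (foldr ℤ._+_ (pos 0) (map (λ z → pos ([ adj x z ] ℕ.* walks G j z y)) (allFin n)))
                                                            ≡⟨ ≡.cong ι (pos-sum (allFin n)) ⟨
    ι (pos (walks G (suc j) x y)) ∎
    where
    module Z = Sums ℤₚ.+-*-commutativeRing
    term : ∀ z → A K G x z * ι (pos (walks G j z y)) ≈ ι (pos ([ adj x z ] ℕ.* walks G j z y))
    term z with adj x z
    ... | true = trans (*-identityˡ _) (reflexive (≡.cong (λ m → ι (pos m)) (≡.sym (ℕₚ.*-identityˡ (walks G j z y)))))
    ... | false = zeroˡ _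
    pos-sum : ∀ {f : Fin n → ℕ} zs → pos (foldr ℕ._+_ 0 (map f zs)) ≡ foldr ℤ._+_ (pos 0) (map (λ z → pos (f z)) zs)
    pos-sum [] = ≡.refl
    pos-sum {f} (z ∷ zs) = ≡.trans (ℤₚ.pos-+ (f z) _) (≡.cong (λ t → pos (f z) ℤ.+ t) (pos-sum zs))

  δ-invariant : WalkInvariant δ
  δ-invariant j {x} {y} {x′} {y′} eq = trans (iter-δ j x y) (trans (reflexive (≡.cong (λ m → ι (pos m)) (eq j))) (sym (iter-δ j x′ y′)))

  𝐀-preserving : Preserving 𝐀
  𝐀-preserving E inv j eq = trans (iter-shift 𝐀-linear j _ _) (trans (inv (suc j) eq) (sym (iter-shift 𝐀-linear j _ _)))

  act-preserving : ∀ {T} → Preserving T → ∀ p → Preserving (act T p)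
  act-preserving pres [] E inv j eq = trans (Linear.null (iter-linear 𝐀-linear j) (λ _ → refl) _)
    (sym (Linear.null (iter-linear 𝐀-linear j) (λ _ → refl) _))
  act-preserving {T} pres (a ∷ as) E inv j {x} {y} {x′} {y′} eq =
    trans (expand y x) (trans (+-cong (*-congˡ (inv j eq)) (pres _ (act-preserving pres as E inv) j eq)) (sym (expand y′ x′)))
    where
    open Linear (iter-linear 𝐀-linear j)
    expand : ∀ y x → iter 𝐀 j (act T (a ∷ as) (E y)) x ≈ a * iter 𝐀 j (E y) x + iter 𝐀 j (T (act T as (E y))) x
    expand y x = trans (add _ _ x) (+-congʳ (scale _ _ x))

  ⟨δ,⟩ : ∀ x v → ⟨ δ x , v ⟩ ≈ v x
  ⟨δ,⟩ = ∑-δ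

  -- For a simple root θ of an integer polynomial g and N = g(A), choose d with N d(N) = 0 and d(0) ≠ 0.
  -- With g = (t − θ) g₁, the operator Q = g₁(A) d(N) is a nonzero multiple of the projection onto the eigenspace.
  module _ (char0 : CharZero K) (θ : Carrier) (B : EchelonBasis (IsEigenvector K G θ))
           (1≤d : 1 ≤ EchelonBasis.d B) (d≤3 : EchelonBasis.d B ≤ 3)
           (x₀ : Fin n) (walkRegular : ∀ x y → WalkEquivalent x x y y) where
    private
      module B = EchelonBasis B

      eigenvector : ∀ i → 𝐀 (B.b i) ≈ᵥ θ ⊙ B.b i
      eigenvector i x = trans (sym (foldr-∑ _)) (B.b∈V i x)

      nonzero-product : ∀ a b → ¬ a ≈ 0# → ¬ b ≈ 0# → ¬ a * b ≈ 0#
      nonzero-product a b a≉0 b≉0 ab≈0 = let (r , ar) = inverse a a≉0 in b≉0 (begin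
        b ≈⟨ *-identityˡ b ⟨
        1# * b ≈⟨ *-congʳ ar ⟨
        a * r * b ≈⟨ solve 3 (λ a r b → a :* r :* b := r :* (a :* b)) refl a r b ⟩
        r * (a * b) ≈⟨ trans (*-congˡ ab≈0) (zeroʳ r) ⟩
        0# ∎)

      -- Pair the zero vector obtained from `δ x` with a basis eigenvector and move the polynomial
      -- across: what remains is its value at `θ` times a coordinate equal to 1.
      θ-root : ∀ zs → (∀ y → act 𝐀 (map ι zs) (δ y) ≈ᵥ 𝟎) → ev (map ι zs) θ ≈ 0#
      θ-root zs null = begin
        ev p θ ≈⟨ trans (sym (*-identityʳ _)) (*-congˡ (sym (trans (B.dual i i) (reflexive (δ-refl i))))) ⟩
        ev p θ * B.b i x ≈⟨ act-eigen 𝐀-linear (eigenvector i) p x ⟨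
        act 𝐀 p (B.b i) x ≈⟨ ⟨δ,⟩ x _ ⟨
        ⟨ δ x , act 𝐀 p (B.b i) ⟩ ≈⟨ act-selfAdjoint 𝐀-linear 𝐀-selfAdjoint p (δ x) (B.b i) ⟨
        ⟨ act 𝐀 p (δ x) , B.b i ⟩ ≈⟨ ∑-zero (λ y → trans (*-congʳ (null x y)) (zeroˡ _)) ⟩
        0# ∎
        where
        p = map ι zs
        i = Fin.fromℕ< 1≤d
        x = B.p i

      module Projection (g : List ℤ) (root : ev (map ι g) θ ≈ 0#)
          (d₀ : ℤ) (ds : List ℤ)
          (null : ∀ y → act 𝐀 (map ι g) (act (act 𝐀 (map ι g)) (map ι (d₀ ∷ ds)) (δ y)) ≈ᵥ 𝟎) where
        N W Q : Vector → Vector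
        N = act 𝐀 (map ι g)
        W = act N (map ι (d₀ ∷ ds))
        g₁ : List Carrier
        g₁ = quot char0 θ (map ι g)
        Q v = act 𝐀 g₁ (W v)
        q : Carrier
        q = ev g₁ θ * ι d₀
        N-linear = act-linear 𝐀-linear (map ι g)
        W-linear = act-linear N-linear (map ι (d₀ ∷ ds))

        W-𝐀 : Commute W 𝐀
        W-𝐀 v x = sym (act-commute N-linear 𝐀-linear (act-commute 𝐀-linear 𝐀-linear (λ _ _ → refl) (map ι g)) (map ι (d₀ ∷ ds)) v x)

        -- `(A − θ) g₁(A)` equals `g(A)` because `g(θ) = 0`, and `N W` kills every `δ y`.
        Q-eigen : ∀ y → 𝐀 (Q (δ y)) ≈ᵥ θ ⊙ Q (δ y)
        Q-eigen y x = begin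
          𝐀 u x ≈⟨ solve 3 (λ s t e → s := s :- t :+ e :* :0 :+ t) refl _ _ (ev (map ι g) θ) ⟩
          𝐀 u x - θ * u x + ev (map ι g) θ * 0# + θ * u x ≈⟨ +-congʳ (+-congˡ (trans (zeroʳ _) (sym (trans (*-congʳ root) (zeroˡ _))))) ⟩
          𝐀 u x - θ * u x + ev (map ι g) θ * W (δ y) x + θ * u x ≈⟨ +-congʳ (act-quot char0 θ 𝐀-linear (map ι g) (W (δ y)) x) ⟨
          N (W (δ y)) x + θ * u x ≈⟨ trans (+-congʳ (null y x)) (+-identityˡ _) ⟩
          θ * u x ∎
          where u = Q (δ y)

        Q-selfAdjoint : SelfAdjoint Q
        Q-selfAdjoint v w = begin
          ⟨ act 𝐀 g₁ (W v) , w ⟩ ≈⟨ act-selfAdjoint 𝐀-linear 𝐀-selfAdjoint g₁ _ w ⟩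
          ⟨ W v , act 𝐀 g₁ w ⟩ ≈⟨ act-selfAdjoint N-linear (act-selfAdjoint 𝐀-linear 𝐀-selfAdjoint (map ι g)) (map ι (d₀ ∷ ds)) v _ ⟩
          ⟨ v , W (act 𝐀 g₁ w) ⟩ ≈⟨ ⟨⟩-cong {v} (λ _ → refl) (act-commute 𝐀-linear W-linear W-𝐀 g₁ w) ⟩
          ⟨ v , act 𝐀 g₁ (W w) ⟩ ∎

        Q-symmetric : ∀ x y → Q (δ y) x ≈ Q (δ x) y
        Q-symmetric x y = begin
          Q (δ y) x ≈⟨ ⟨δ,⟩ x _ ⟨
          ⟨ δ x , Q (δ y) ⟩ ≈⟨ Q-selfAdjoint (δ x) (δ y) ⟨
          ⟨ Q (δ x) , δ y ⟩ ≈⟨ ⟨⟩-comm _ (δ y) ⟩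
          ⟨ δ y , Q (δ x) ⟩ ≈⟨ ⟨δ,⟩ y _ ⟩
          Q (δ x) y ∎

        Q-invariant : ∀ {x y x′ y′} → WalkEquivalent x y x′ y′ → Q (δ y) x ≈ Q (δ y′) x′
        Q-invariant = act-preserving {𝐀} 𝐀-preserving g₁ _
          (act-preserving {N} (act-preserving {𝐀} 𝐀-preserving (map ι g)) (map ι (d₀ ∷ ds)) δ δ-invariant) 0

        Q-on-eigenspace : ∀ i → Q (B.b i) ≈ᵥ q ⊙ B.b i
        Q-on-eigenspace i x = begin
          act 𝐀 g₁ (W (B.b i)) x ≈⟨ Linear.cong (act-linear 𝐀-linear g₁) Wb x ⟩
          act 𝐀 g₁ (ι d₀ ⊙ B.b i) x ≈⟨ Linear.scale (act-linear 𝐀-linear g₁) (ι d₀) _ x ⟩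
          ι d₀ * act 𝐀 g₁ (B.b i) x ≈⟨ *-congˡ (act-eigen 𝐀-linear (eigenvector i) g₁ x) ⟩
          ι d₀ * (ev g₁ θ * B.b i x) ≈⟨ solve 3 (λ d e b → d :* (e :* b) := e :* d :* b) refl _ _ _ ⟩
          q * B.b i x ∎
          where
          Wb : W (B.b i) ≈ᵥ ι d₀ ⊙ B.b i
          Wb x = trans (act-eigen N-linear (act-eigen 𝐀-linear (eigenvector i) (map ι g)) (map ι (d₀ ∷ ds)) x)
            (*-congʳ (trans (+-congˡ (trans (*-congʳ root) (zeroˡ _))) (+-identityʳ _)))

        Q-spans : ∀ w z → Q (δ w) z ≈ ∑ (λ i → Q (δ w) (B.p i) * B.b i z)
        Q-spans w z = B.spans (Q (δ w)) (λ x → trans (foldr-∑ _) (Q-eigen w x)) z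

        -- Expand `Q (δ x)` in the echelon basis and move `Q` over to the basis vectors, on which it
        -- is the scalar `q`; each of them contributes `q` at its own position.
        trace : ∑ (λ x → Q (δ x) x) ≈ ∑ (λ (i : Fin B.d) → q)
        trace = begin
          ∑ (λ x → Q (δ x) x) ≈⟨ ∑-cong (λ x → Q-spans x x) ⟩
          ∑ (λ x → ∑ (λ i → Q (δ x) (B.p i) * B.b i x)) ≈⟨ ∑-comm _ ⟩
          ∑ (λ i → ∑ (λ x → Q (δ x) (B.p i) * B.b i x)) ≈⟨ ∑-cong (λ i → ∑-cong λ x → *-congʳ (Q-symmetric (B.p i) x)) ⟩
          ∑ (λ i → ⟨ Q (δ (B.p i)) , B.b i ⟩) ≈⟨ ∑-cong (λ i → Q-selfAdjoint _ _) ⟩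
          ∑ (λ i → ⟨ δ (B.p i) , Q (B.b i) ⟩) ≈⟨ ∑-cong (λ i → ⟨δ,⟩ (B.p i) _) ⟩
          ∑ (λ i → Q (B.b i) (B.p i)) ≈⟨ ∑-cong (λ i → Q-on-eigenspace i (B.p i)) ⟩
          ∑ (λ i → q * B.b i (B.p i)) ≈⟨ ∑-cong (λ i → trans (*-congˡ (trans (B.dual i i) (reflexive (δ-refl i)))) (*-identityʳ q)) ⟩
          ∑ (λ (i : Fin B.d) → q) ∎

        multiple : ∀ m → ∑ {m} (λ _ → q) ≈ ι (pos m) * q
        multiple zero = trans (∑-empty _) (sym (zeroˡ q))
        multiple (suc m) = trans (∑-suc _) (trans (+-cong (sym (*-identityˡ q)) (multiple m)) (sym (distribʳ _ _ _)))

        -- All diagonal entries of `Q` agree by walk-regularity. Were they zero, the trace would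
        -- vanish, while it is the dimension times `q`.
        diagonal : ¬ q ≈ 0# → ¬ Q (δ x₀) x₀ ≈ 0#
        diagonal q≉0 eq = nonzero-product (ι (pos B.d)) q (positive 1≤d) q≉0 (begin
          ι (pos B.d) * q ≈⟨ multiple B.d ⟨
          ∑ (λ (i : Fin B.d) → q) ≈⟨ trace ⟨
          ∑ (λ x → Q (δ x) x) ≈⟨ ∑-zero (λ x → trans (Q-invariant (walkRegular x x₀)) eq) ⟩
          0# ∎)
          where
          positive : ∀ {m} → 1 ≤ m → ¬ ι (pos m) ≈ 0#
          positive (s≤s {n = m} _) = char0 m

        representation : ¬ q ≈ 0# → Representation θ
        representation q≉0 = record
          { U = λ x y → r * Q (δ x) y
          ; symmetric = λ x y → *-congˡ (Q-symmetric y x)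
          ; unit = λ x → trans (*-congˡ (Q-invariant (walkRegular x x₀))) (trans (*-comm _ _) qr)
          ; eigen = λ x y → trans (Linear.scale 𝐀-linear r (Q (δ x)) y)
              (trans (*-congˡ (Q-eigen x y)) (solve 3 (λ r t s → r :* (t :* s) := t :* (r :* s)) refl r θ _))
          ; walk = λ {x} {y} {x′} {y′} eq → *-congˡ (trans (Q-symmetric y x) (trans (Q-invariant eq) (Q-symmetric x′ y′)))
          -- Every `Q (δ w)` lies in the eigenspace, so its values at the four vertices are combined
          -- from the values of the `d` basis vectors there; four vectors of length `d ≤ 3` satisfy
          -- a relation.
          ; rank≤3 = λ z k → dependent d≤3 (λ i j → B.b j (z i)) λ { (a , a≉0 , rel) → k (a , a≉0 , λ w → begin
              ∑ (λ i → a i * (r * Q (δ (z i)) w))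
                ≈⟨ ∑-cong (λ i → *-congˡ (*-congˡ (trans (Q-symmetric w (z i)) (Q-spans w (z i))))) ⟩
              ∑ (λ i → a i * (r * ∑ (λ j → Q (δ w) (B.p j) * B.b j (z i))))
                ≈⟨ ∑-cong (λ i → trans (sym (*-assoc _ _ _)) (*-∑ _ _)) ⟩
              ∑ (λ i → ∑ (λ j → a i * r * (Q (δ w) (B.p j) * B.b j (z i)))) ≈⟨ ∑-comm _ ⟩
              ∑ (λ j → ∑ (λ i → a i * r * (Q (δ w) (B.p j) * B.b j (z i))))
                ≈⟨ ∑-cong (λ j → ∑-cong λ i → solve 4 (λ a r q b → a :* r :* (q :* b) := r :* q :* (a :* b)) refl _ r _ _) ⟩
              ∑ (λ j → ∑ (λ i → r * Q (δ w) (B.p j) * (a i * B.b j (z i)))) ≈⟨ ∑-cong (λ j → *-∑ _ _) ⟨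
              ∑ (λ j → r * Q (δ w) (B.p j) * ∑ (λ i → a i * B.b j (z i)))
                ≈⟨ ∑-zero (λ j → trans (*-congˡ (rel j)) (zeroʳ _)) ⟩
              0# ∎) } }
          where
          open Dependence commutativeRing 1≉0 nonzero-product
          r : Carrier
          r = proj₁ (inverse _ (diagonal q≉0))
          qr : Q (δ x₀) x₀ * r ≈ 1#
          qr = proj₂ (inverse _ (diagonal q≉0))

    represent : ¬ ¬ Representation θ
    represent k = annihilator 𝐀-linear 𝐀-integral λ { (zs , nz , null) →
      simpleRoot char0 θ zs nz (θ-root zs null) λ { (g , root , simple) →
      nullProjection char0 (act-linear 𝐀-linear (map ι g)) (act-selfAdjoint 𝐀-linear 𝐀-selfAdjoint (map ι g))
        (act-integral 𝐀-linear 𝐀-integral g) λ { (d₀ , ds , d₀≢0 , null′) →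
      k (Projection.representation g root d₀ ds null′
          (nonzero-product _ _ simple (λ eq → d₀≢0 (ι-injective₀ char0 d₀ eq)))) } } }

-- Counting and walks

module _ where
  open ≡ using (refl; sym; trans; cong; cong₂; subst)

  Σᴺ-suc : ∀ {n} (f : Fin (suc n) → ℕ) → Σᴺ f ≡ f zero ℕ.+ Σᴺ (λ i → f (suc i))
  Σᴺ-suc f = cong (λ l → f zero ℕ.+ foldr ℕ._+_ 0 l)
    (trans (Listₚ.map-tabulate suc f) (sym (Listₚ.map-tabulate (λ i → i) (λ i → f (suc i)))))

  Σᴺ-cong : ∀ {n} {f g : Fin n → ℕ} → (∀ i → f i ≡ g i) → Σᴺ f ≡ Σᴺ g
  Σᴺ-cong {n} eq = cong (foldr ℕ._+_ 0) (Listₚ.map-cong eq (allFin n))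

  Σᴺ≡0 : ∀ {n} {f : Fin n → ℕ} → (∀ i → f i ≡ 0) → Σᴺ f ≡ 0
  Σᴺ≡0 {zero} eq = refl
  Σᴺ≡0 {suc n} {f} eq = trans (Σᴺ-suc f) (cong₂ ℕ._+_ (eq zero) (Σᴺ≡0 (λ i → eq (suc i))))

  Σᴺ≡0⁻ : ∀ {n} {f : Fin n → ℕ} → Σᴺ f ≡ 0 → ∀ i → f i ≡ 0
  Σᴺ≡0⁻ {suc n} {f} eq zero = ℕₚ.m+n≡0⇒m≡0 (f zero) (trans (sym (Σᴺ-suc f)) eq)
  Σᴺ≡0⁻ {suc n} {f} eq (suc i) = Σᴺ≡0⁻ (ℕₚ.m+n≡0⇒n≡0 (f zero) (trans (sym (Σᴺ-suc f)) eq)) i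

  Σᴺ≢0⁻ : ∀ {n} {f : Fin n → ℕ} → Σᴺ f ≢ 0 → ∃ λ i → f i ≢ 0
  Σᴺ≢0⁻ {f = f} ne with Finₚ.any? (λ i → ¬? (f i ℕ.≟ 0))
  ... | yes r = r
  ... | no none = ⊥-elim (ne (Σᴺ≡0 λ i → Decidable-stable (f i) λ fi → none (i , fi)))
    where
    Decidable-stable : ∀ m → ¬ ¬ m ≡ 0 → m ≡ 0
    Decidable-stable zero _ = refl
    Decidable-stable (suc m) nn = ⊥-elim (nn λ ())

  -- A count becomes usable as a list without repetition. Its size is a parameter, so that an
  -- equality between counts can be transported to the list.
  record Enum {n : ℕ} (k : ℕ) (p : Fin n → Bool) : Set where
    field
      at : Fin k → Fin n
      injective : ∀ {i j} → at i ≡ at j → i ≡ j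
      sound : ∀ i → p (at i) ≡ true
      complete : ∀ z → p z ≡ true → ∃ λ i → at i ≡ z

  abstract
    enumerate : ∀ {n} (p : Fin n → Bool) → Enum (Σᴺ (λ z → [ p z ])) p
    enumerate {zero} p = record { at = λ () ; injective = λ {} ; sound = λ () ; complete = λ () }
    enumerate {suc n} p = subst (λ k → Enum k p) (sym (Σᴺ-suc (λ z → [ p z ]))) (go (p zero) refl)
      where
      module E = Enum (enumerate (λ i → p (suc i)))
      go : ∀ b → p zero ≡ b → Enum ([ b ] ℕ.+ Σᴺ (λ i → [ p (suc i) ])) p
      go true eq = record
        { at = λ { zero → zero ; (suc i) → suc (E.at i) }
        ; injective = λ { {zero} {zero} _ → refl ; {suc i} {suc j} e → cong suc (E.injective (Finₚ.suc-injective e)) }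
        ; sound = λ { zero → eq ; (suc i) → E.sound i }
        ; complete = λ { zero _ → zero , refl ; (suc z) pz → let (i , e) = E.complete z pz in suc i , cong suc e } }
      go false eq = record
        { at = λ i → suc (E.at i)
        ; injective = λ e → E.injective (Finₚ.suc-injective e)
        ; sound = E.sound
        ; complete = λ { zero p0 → ⊥-elim (Boolₚ.not-¬ refl (trans (sym eq) p0)) ; (suc z) pz → let (i , e) = E.complete z pz in i , cong suc e } }

  0≢1 : ∀ {n} → _≢_ {A = Fin (suc (suc n))} zero (suc zero)
  0≢1 ()

  lookup-injective : ∀ {A : Set} {xs : List A} → Unique xs → ∀ i j → lookup xs i ≡ lookup xs j → i ≡ j
  lookup-injective (x∉ ∷ u) zero zero eq = refl
  lookup-injective {xs = x ∷ xs} (x∉ ∷ u) zero (suc j) eq = ⊥-elim (All.lookup x∉ (∈-lookup {xs = xs} j) eq)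
  lookup-injective {xs = x ∷ xs} (x∉ ∷ u) (suc i) zero eq = ⊥-elim (All.lookup x∉ (∈-lookup {xs = xs} i) (sym eq))
  lookup-injective (x∉ ∷ u) (suc i) (suc j) eq = cong suc (lookup-injective u i j eq)

  unique₂ : ∀ {A : Set} {a b : A} → a ≢ b → Unique (a ∷ b ∷ [])
  unique₂ ab = (ab ∷ []) ∷ [] ∷ []

  unique₃ : ∀ {A : Set} {a b c : A} → a ≢ b → a ≢ c → b ≢ c → Unique (a ∷ b ∷ c ∷ [])
  unique₃ ab ac bc = (ab ∷ ac ∷ []) ∷ unique₂ bc

  unique₄ : ∀ {A : Set} {a b c d : A} → a ≢ b → a ≢ c → a ≢ d → b ≢ c → b ≢ d → c ≢ d → Unique (a ∷ b ∷ c ∷ d ∷ [])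
  unique₄ ab ac ad bc bd cd = (ab ∷ ac ∷ ad ∷ []) ∷ unique₃ bc bd cd

  fresh : ∀ {A : Set} {c : A} {xs} → c ∉ xs → All (c ≢_) xs
  fresh c∉ = All.tabulate λ x∈ eq → c∉ (subst (_∈ _) (sym eq) x∈)

module Cardinality {n k : ℕ} {p : Fin n → Bool} (E : Enum k p) where
  open ≡ using (sym; trans; cong)
  open Enum E
  open DecMem {A = Fin n} Fin._≟_ using (_∈?_)

  abstract
    length≤ : ∀ {ds} → Unique ds → All (λ z → p z ≡ true) ds → length ds ≤ k
    length≤ {ds} u ps = Finₚ.injective⇒≤ {f = f} λ {i} {j} eq → lookup-injective u i j
      (trans (sym (proj₂ (f′ i))) (trans (cong at eq) (proj₂ (f′ j))))
      where
      f′ : ∀ i → ∃ λ j → at j ≡ lookup ds i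
      f′ i = complete (lookup ds i) (All.lookup ps (∈-lookup {xs = ds} i))
      f : Fin (length ds) → Fin k
      f i = proj₁ (f′ i)

    -- If all `k` elements were in `ds`, their positions would inject `Fin k` into a smaller set.
    extend : ∀ ds → length ds < k → ∃ λ c → p c ≡ true × c ∉ ds
    extend ds len with Finₚ.any? (λ i → ¬? (at i ∈? ds))
    ... | yes (i , i∉) = at i , sound i , i∉
    ... | no none = ⊥-elim (ℕₚ.<⇒≱ len (Finₚ.injective⇒≤ {f = λ i → index (mem i)} λ {i} {j} eq →
        injective (trans (Anyₚ.lookup-index (mem i)) (trans (cong (lookup ds) eq) (sym (Anyₚ.lookup-index (mem j)))))))
      where
      mem : ∀ i → at i ∈ ds
      mem i with at i ∈? ds
      ... | yes m = m
      ... | no m = ⊥-elim (none (i , m))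

    full : ∀ {ds} → Unique ds → All (λ z → p z ≡ true) ds → k ≤ length ds → ∀ z → p z ≡ true → z ∈ ds
    full {ds} u ps len z pz with z ∈? ds
    ... | yes m = m
    ... | no z∉ = ⊥-elim (ℕₚ.<⇒≱ (length≤ (fresh z∉ ∷ u) (pz ∷ ps)) len)

-- Adjacency, walks and distance

module GraphBasics (G : Graph) where
  open ≡ using (refl; sym; trans; cong; cong₂; subst)
  open Graph G

  V : Set
  V = Fin n

  infix 4 _~_ _≁_
  _~_ _≁_ : V → V → Set
  x ~ y = adj x y ≡ true
  x ≁ y = ¬ x ~ y

  ~-sym : ∀ {x y} → x ~ y → y ~ x
  ~-sym {x} {y} e = trans (adj-sym y x) e

  ~⇒≢ : ∀ {x y} → x ~ y → x ≢ y
  ~⇒≢ {x} e refl = Boolₚ.not-¬ refl (trans (sym (adj-irrefl x)) e)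

  _~?_ : ∀ x y → Dec (x ~ y)
  x ~? y = adj x y Boolₚ.≟ true

  -- Distance two expressed by adjacency with a witness, which is how it gets used; `dist₂⁺` and
  -- `dist₂⁻` relate it to the search that defines `dist`.
  record Dist2 (x y : V) : Set where
    constructor mk
    field
      distinct : x ≢ y
      nonadj : x ≁ y
      {mid} : V
      left : x ~ mid
      right : mid ~ y

  Dist2-sym : ∀ {x y} → Dist2 x y → Dist2 y x
  Dist2-sym (mk ne na l r) = mk (λ e → ne (sym e)) (λ e → na (~-sym e)) (~-sym r) (~-sym l)

  walks₀ : ∀ {x y} → walks G 0 x y ≢ 0 → x ≡ y
  walks₀ {x} {y} ne with x Fin.≟ y
  ... | yes e = e
  ... | no _ = ⊥-elim (ne refl)

  walks₀-refl : ∀ x → walks G 0 x x ≡ 1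
  walks₀-refl x with x Fin.≟ x
  ... | yes _ = refl
  ... | no ne = ⊥-elim (ne refl)

  walks-step : ∀ l y {x z} → x ~ z → walks G l z y ≢ 0 → walks G (suc l) x y ≢ 0
  walks-step l y {x} {z} xz ne eq = ne (trans (sym (ℕₚ.*-identityˡ _))
    (trans (cong (λ b → [ b ] ℕ.* walks G l z y) (sym xz)) (Σᴺ≡0⁻ eq z)))

  walks-unstep : ∀ l x y → walks G (suc l) x y ≢ 0 → ∃ λ z → x ~ z × walks G l z y ≢ 0
  walks-unstep l x y ne = let (z , ne′) = Σᴺ≢0⁻ ne in z , aux z (adj x z) refl ne′
    where
    aux : ∀ z b → adj x z ≡ b → [ adj x z ] ℕ.* walks G l z y ≢ 0 → x ~ z × walks G l z y ≢ 0
    aux z true e ne′ = e , λ w → ne′ (trans (cong ([ adj x z ] ℕ.*_) w) (ℕₚ.*-zeroʳ [ adj x z ]))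
    aux z false e ne′ = ⊥-elim (ne′ (cong (λ b → [ b ] ℕ.* walks G l z y) e))

  Σᴺ-at : ∀ {m} (f : Fin m → ℕ) y → Σᴺ (λ w → f w ℕ.* [ ⌊ w Fin.≟ y ⌋ ]) ≡ f y
  Σᴺ-at {suc m} f zero = trans (Σᴺ-suc (λ w → f w ℕ.* [ ⌊ w Fin.≟ zero ⌋ ])) (trans (cong₂ ℕ._+_ (ℕₚ.*-identityʳ (f zero))
    (Σᴺ≡0 λ i → ℕₚ.*-zeroʳ (f (suc i)))) (ℕₚ.+-identityʳ _))
  Σᴺ-at {suc m} f (suc y) = trans (Σᴺ-suc (λ w → f w ℕ.* [ ⌊ w Fin.≟ suc y ⌋ ])) (trans (cong₂ ℕ._+_ (ℕₚ.*-zeroʳ (f zero))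
    (trans (Σᴺ-cong λ i → cong (λ b → f (suc i) ℕ.* [ b ]) (suc-≟ i y)) (Σᴺ-at (λ i → f (suc i)) y))) refl)
    where
    suc-≟ : ∀ {m} (i y : Fin m) → ⌊ suc i Fin.≟ suc y ⌋ ≡ ⌊ i Fin.≟ y ⌋
    suc-≟ i y with i Fin.≟ y
    ... | yes _ = refl
    ... | no _ = refl

  walks₁ : ∀ x y → walks G 1 x y ≡ [ adj x y ]
  walks₁ x y = Σᴺ-at (λ z → [ adj x z ]) y

  common : V → V → V → Bool
  common x y z = adj x z ∧ adj z y

  walks₂ : ∀ x y → walks G 2 x y ≡ Σᴺ (λ z → [ common x y z ])
  walks₂ x y = Σᴺ-cong λ z → trans (cong ([ adj x z ] ℕ.*_) (walks₁ z y)) (prod (adj x z) (adj z y))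
    where
    prod : ∀ a b → [ a ] ℕ.* [ b ] ≡ [ a ∧ b ]
    prod true true = refl
    prod true false = refl
    prod false b = refl

  common⁺ : ∀ {x y z} → x ~ z → z ~ y → common x y z ≡ true
  common⁺ p q = cong₂ _∧_ p q

  common⁻ : ∀ {x y z} → common x y z ≡ true → x ~ z × z ~ y
  common⁻ {x} {y} {z} e with adj x z
  ... | true = refl , e

  search-value : ∀ {x y} e → walks G e x y ≢ 0 → (∀ j → j < e → walks G j x y ≡ 0) →
    ∀ f d → d ≤ e → e ≤ d ℕ.+ f → search G f d x y ≡ e
  search-value e we below zero d d≤e e≤d = ℕₚ.≤-antisym d≤e (subst (e ≤_) (ℕₚ.+-identityʳ d) e≤d)
  search-value {x} {y} e we below (suc f) d d≤e e≤d with ℕₚ.m≤n⇒m<n∨m≡n d≤e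
  ... | inj₁ d<e = trans (cong (λ m → if m ℕ.≡ᵇ 0 then search G f (suc d) x y else d) (below d d<e))
    (search-value e we below f (suc d) d<e (subst (e ≤_) (ℕₚ.+-suc d f) e≤d))
  ... | inj₂ refl with walks G d x y
  ... | zero = ⊥-elim (we refl)
  ... | suc _ = refl

  -- A search that runs out of steps also returns a number, namely `d + f`. Only a smaller result
  -- guarantees that a walk was found, hence the strict bound.
  search-invert : ∀ {x y} e f d → search G f d x y ≡ e → e < d ℕ.+ f →
    walks G e x y ≢ 0 × (∀ j → d ≤ j → j < e → walks G j x y ≡ 0)
  search-invert e zero d refl lt = ⊥-elim (ℕₚ.<-irrefl refl (subst (e <_) (ℕₚ.+-identityʳ d) lt))
  search-invert {x} {y} e (suc f) d eq lt with walks G d x y in w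
  ... | suc _ = (λ z → 1+n≢0 (trans (sym w) (subst (λ j → walks G j x y ≡ 0) (sym eq) z)))
        , λ j d≤j j<e → ⊥-elim (ℕₚ.<⇒≱ j<e (subst (_≤ j) eq d≤j))
    where
    1+n≢0 : ∀ {m} → suc m ≢ 0
    1+n≢0 ()
  ... | zero = let (we , below) = search-invert e f (suc d) eq (subst (e <_) (ℕₚ.+-suc d f) lt) in
        we , λ j d≤j j<e → Data.Sum.[ (λ d<j → below j d<j j<e) , (λ { refl → w }) ] (ℕₚ.m≤n⇒m<n∨m≡n d≤j)

  dist-value : ∀ {x y} e → walks G e x y ≢ 0 → (∀ j → j < e → walks G j x y ≡ 0) → e ≤ n → dist G x y ≡ e
  dist-value e we below e≤n = search-value e we below n 0 z≤n e≤n

  dist-invert : ∀ {x y} e → dist G x y ≡ e → e < n → walks G e x y ≢ 0 × (∀ j → j < e → walks G j x y ≡ 0)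
  dist-invert e eq lt = let (we , below) = search-invert e n 0 eq lt in we , λ j → below j z≤n

  private
    1≢0 : 1 ≢ 0
    1≢0 ()

    vanish : ∀ {x y} e → (∀ j → j < e → ¬ walks G j x y ≢ 0) → ∀ j → j < e → walks G j x y ≡ 0
    vanish {x} {y} e f j lt with walks G j x y ℕ.≟ 0
    ... | yes z = z
    ... | no nz = ⊥-elim (f j lt nz)

  walks₁⁺ : ∀ {x y} → x ~ y → walks G 1 x y ≢ 0
  walks₁⁺ {x} {y} e = walks-step 0 y e λ z → 1≢0 (trans (sym (walks₀-refl y)) z)

  walks₁⁻ : ∀ {x y} → walks G 1 x y ≢ 0 → x ~ y
  walks₁⁻ {x} {y} ne = let (z , xz , w) = walks-unstep 0 x y ne in subst (x ~_) (walks₀ w) xz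

  walks₂⁻ : ∀ {x y} → walks G 2 x y ≢ 0 → ∃ λ z → x ~ z × z ~ y
  walks₂⁻ {x} {y} ne = let (z , xz , w) = walks-unstep 1 x y ne in z , xz , walks₁⁻ w

  dist-refl : ∀ x → dist G x x ≡ 0
  dist-refl x = dist-value 0 (λ z → 1≢0 (trans (sym (walks₀-refl x)) z)) (λ _ ()) z≤n

  module _ (n≥3 : 3 ≤ n) where
    dist₁⁺ : ∀ {x y} → x ~ y → dist G x y ≡ 1
    dist₁⁺ e = dist-value 1 (walks₁⁺ e) (vanish 1 λ { zero _ w → ~⇒≢ e (walks₀ w) ; (suc j) (s≤s ()) })
      (ℕₚ.≤-trans (s≤s z≤n) n≥3)

    dist₁⁻ : ∀ {x y} → dist G x y ≡ 1 → x ~ y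
    dist₁⁻ eq = walks₁⁻ (proj₁ (dist-invert 1 eq (ℕₚ.≤-trans (s≤s (s≤s z≤n)) n≥3)))

    dist₂⁺ : ∀ {x y} → Dist2 x y → dist G x y ≡ 2
    dist₂⁺ {x} {y} (mk ne na l r) = dist-value 2 (walks-step 1 y l (walks₁⁺ r)) (vanish 2 λ
      { zero _ w → ne (walks₀ w) ; (suc zero) _ w → na (walks₁⁻ w) ; (suc (suc j)) (s≤s (s≤s ())) })
      (ℕₚ.≤-trans (s≤s (s≤s z≤n)) n≥3)

    dist₂⁻ : ∀ {x y} → dist G x y ≡ 2 → Dist2 x y
    dist₂⁻ {x} {y} eq =
      let (w , below) = dist-invert 2 eq n≥3 ; (z , xz , zy) = walks₂⁻ w in
      mk (λ { refl → 1≢0 (trans (sym (walks₀-refl x)) (below 0 (s≤s z≤n))) })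
         (λ e → walks₁⁺ e (below 1 (s≤s (s≤s z≤n)))) xz zy

    dist₃⁺ : ∀ {x y} → x ≢ y → x ≁ y → ¬ Dist2 x y → ∀ {a b} → x ~ a → a ~ b → b ~ y → dist G x y ≡ 3
    dist₃⁺ {x} {y} ne na nd p q r = dist-value 3 (walks-step 2 y p (walks-step 1 y q (walks₁⁺ r))) (vanish 3 λ
      { zero _ w → ne (walks₀ w) ; (suc zero) _ w → na (walks₁⁻ w)
      ; (suc (suc zero)) _ w → let (z , xz , zy) = walks₂⁻ w in nd (mk ne na xz zy)
      ; (suc (suc (suc j))) (s≤s (s≤s (s≤s ()))) }) n≥3

  reach : Connected G → (P : V → Set) → ∀ {x} → P x → (∀ {y z} → y ~ z → P y → P z) → ∀ y → P y
  reach con P {x} px step y = let (l , w) = con x y in go l x px w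
    where
    go : ∀ l x → P x → walks G l x y ≢ 0 → P y
    go zero x px w = subst P (walks₀ w) px
    go (suc l) x px w = let (z , xz , w′) = walks-unstep l x y w in go l z (step xz px) w′

  -- A step from a vertex at distance two from `x` ends at a neighbour of `x`, because both have the
  -- same neighbours; so the three cases are closed under steps.
  close : Connected G → (∀ {x z} → Dist2 x z → ∀ {w} → x ~ w → z ~ w) → ∀ x z → x ≡ z ⊎ x ~ z ⊎ Dist2 x z
  close con twins x = reach con (λ z → x ≡ z ⊎ x ~ z ⊎ Dist2 x z) (inj₁ refl) step
    where
    step : ∀ {y z} → y ~ z → x ≡ y ⊎ x ~ y ⊎ Dist2 x y → x ≡ z ⊎ x ~ z ⊎ Dist2 x z
    step yz (inj₁ refl) = inj₂ (inj₁ yz)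
    step yz (inj₂ (inj₂ d)) = inj₂ (inj₁ (twins (Dist2-sym d) yz))
    step {y} {z} yz (inj₂ (inj₁ xy)) with x Fin.≟ z | x ~? z
    ... | yes e | _ = inj₁ e
    ... | no _ | yes xz = inj₂ (inj₁ xz)
    ... | no ne | no na = inj₂ (inj₂ (mk ne na xy yz))

  private
    -- The position of the first `false`, with the last value of `Fin (suc m)` reserved for there
    -- being none. No vertex is adjacent to itself, so this value never arises for `adj x`.
    least : ∀ {m} → (Fin m → Bool) → Fin (suc m)
    least {zero} p = zero
    least {suc m} p = if p zero then suc (least (λ i → p (suc i))) else zero

    least-cong : ∀ {m} {p q : Fin m → Bool} → (∀ i → p i ≡ q i) → least p ≡ least q
    least-cong {zero} eq = refl
    least-cong {suc m} eq = cong₂ (λ b r → if b then suc r else zero) (eq zero) (least-cong λ i → eq (suc i))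

    least-false : ∀ {m} (p : Fin m → Bool) i → p i ≡ false → ∃ λ j → p j ≡ false × least p ≡ Fin.inject₁ j
    least-false {suc m} p i pi with p zero in p0
    ... | false = zero , p0 , refl
    least-false {suc m} p zero pi | true with () ← trans (sym p0) pi
    least-false {suc m} p (suc i) pi | true =
      let (j , pj , e) = least-false (λ i → p (suc i)) i pi in suc j , pj , cong suc e

  -- A vertex is classified by its first non-neighbour.
  completeMultipartite : Connected G → (∀ {x z} → Dist2 x z → ∀ {w} → x ~ w → z ~ w) → CompleteMultipartite G
  completeMultipartite con twins = suc n , part , λ x y → record
    { to = λ xy eq → separates x y eq xy
    ; from = λ ne → Data.Sum.[ (λ xy → xy) , (λ xy → ⊥-elim (ne (least-cong (same xy)))) ] (dec x y)
    ; to-cong = λ { refl → refl } ; from-cong = λ { refl → refl } }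
    where
    part : V → Fin (suc n)
    part x = least (adj x)
    dec : ∀ x y → x ~ y ⊎ x ≁ y
    dec x y with x ~? y
    ... | yes e = inj₁ e
    ... | no ne = inj₂ ne
    nonadj-twins : ∀ {x z w} → x ≁ z → x ~ w → z ~ w
    nonadj-twins {x} {z} na xw with close con twins x z
    ... | inj₁ refl = xw
    ... | inj₂ (inj₁ xz) = ⊥-elim (na xz)
    ... | inj₂ (inj₂ d) = twins d xw
    same : ∀ {x z} → x ≁ z → ∀ w → adj x w ≡ adj z w
    same {x} {z} na w with adj x w in xw | adj z w in zw
    ... | true | true = refl
    ... | false | false = refl
    ... | true | false = trans (sym (nonadj-twins na xw)) zw
    ... | false | true = trans (sym xw) (nonadj-twins (λ e → na (~-sym e)) zw)
    -- The common first non-neighbour has the same neighbours as `x`. If `x` and `y` were adjacent,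
    -- it would therefore be adjacent to `y`.
    separates : ∀ x y → part x ≡ part y → x ≁ y
    separates x y eq xy with least-false (adj x) x (adj-irrefl x) | least-false (adj y) y (adj-irrefl y)
    ... | j , xj , ej | j′ , yj′ , ej′ with Finₚ.inject₁-injective (trans (sym ej) (trans eq ej′))
    ... | refl with () ← trans (sym (~-sym (nonadj-twins (λ e → Boolₚ.not-¬ refl (trans (sym e) xj)) xy))) yj′

-- Geometry of the representation

module Geometry {c ℓ : Level} (K : Field c ℓ)
  (stable : ∀ {x y} → ¬ ¬ Field._≈_ K x y → Field._≈_ K x y) (char0 : CharZero K)
  (G : Graph) (k : ℕ) (reg : Regular G k) (x₀ : Fin (Graph.n G)) (k≥3 : 3 ≤ k)
  (θ : Field.Carrier K)
  (θ≉k : ¬ Field._≈_ K θ (Field._×ᵣ_ K k (Field.1# K)))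
  (θ≉-k : ¬ Field._≈_ K θ (Field.-_ K (Field._×ᵣ_ K k (Field.1# K))))
  (rep : Representations.Representation K G θ)
  (u₁ u₂ : Field.Carrier K)
  (U-adj : ∀ {x y} → GraphBasics._~_ G x y → Field._≈_ K (Representations.Representation.U rep x y) u₁)
  (U-dist2 : ∀ {x y} → GraphBasics.Dist2 G x y → Field._≈_ K (Representations.Representation.U rep x y) u₂)
  where
  open Field K hiding (zero)
  open Graph G
  open GraphBasics G
  open Sums commutativeRing
  open Initial commutativeRing using (ι; ι-+)
  open Initial.Solver commutativeRing
  open Representations.Representation rep
  open import Algebra.Properties.Group +-group using () renaming (x≈y⇒x∙y⁻¹≈ε to x≈y⇒x-y≈0; x∙y⁻¹≈ε⇒x≈y to x-y≈0⇒x≈y)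
  open import Relation.Binary.Reasoning.Setoid setoid

  -- The ring solver evaluates its constant 1 to this element.
  𝟏 : Carrier
  𝟏 = ι (pos 1)

  1≈𝟏 : 1# ≈ 𝟏
  1≈𝟏 = sym (+-identityʳ 1#)

  cancel : ∀ {a b} → ¬ a ≈ 0# → a * b ≈ 0# → b ≈ 0#
  cancel {a} {b} a≉0 ab≈0 = let (r , ar) = inverse a a≉0 in begin
    b ≈⟨ *-identityˡ b ⟨
    1# * b ≈⟨ *-congʳ ar ⟨
    a * r * b ≈⟨ solve 3 (λ a r b → a :* r :* b := r :* (a :* b)) refl a r b ⟩
    r * (a * b) ≈⟨ trans (*-congˡ ab≈0) (zeroʳ r) ⟩
    0# ∎

  square-zero : ∀ {a} → a * a ≈ 0# → a ≈ 0#
  square-zero {a} aa = stable λ a≉0 → a≉0 (cancel a≉0 aa)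

  2a≈0 : ∀ {a} → ι (pos 2) * a ≈ 0# → a ≈ 0#
  2a≈0 = cancel (char0 1)

  neighbour-sum : ∀ {y z} a → (∀ {w} → y ~ w → U z w ≈ a) → ι (pos k) * a ≈ θ * U z y
  neighbour-sum {y} {z} a eq = begin
    ι (pos k) * a ≡⟨ ≡.cong (λ m → ι (pos m) * a) (reg y) ⟨
    ι (pos (degree G y)) * a ≈⟨ *-congʳ (count (adj y)) ⟩
    ∑ (λ w → A K G y w) * a ≈⟨ ∑-* _ _ ⟩
    ∑ (λ w → A K G y w * a) ≈⟨ ∑-cong term ⟩
    ∑ (λ w → A K G y w * U z w) ≈⟨ eigen z y ⟩
    θ * U z y ∎
    where
    count : ∀ {m} (p : Fin m → Bool) → ι (pos (Σᴺ (λ w → [ p w ]))) ≈ ∑ (λ w → if p w then 1# else 0#)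
    count {zero} p = sym (∑-empty _)
    count {suc m} p = begin
      ι (pos (Σᴺ (λ w → [ p w ]))) ≡⟨ ≡.cong (λ t → ι (pos t)) (Σᴺ-suc (λ w → [ p w ])) ⟩
      ι (pos ([ p zero ] ℕ.+ Σᴺ (λ w → [ p (suc w) ]))) ≈⟨ ι-+ (pos [ p zero ]) (pos (Σᴺ (λ w → [ p (suc w) ]))) ⟩
      ι (pos [ p zero ]) + ι (pos (Σᴺ (λ w → [ p (suc w) ]))) ≈⟨ +-cong (head (p zero)) (count (λ w → p (suc w))) ⟩
      (if p zero then 1# else 0#) + ∑ (λ w → if p (suc w) then 1# else 0#) ≈⟨ ∑-suc _ ⟨
      ∑ (λ w → if p w then 1# else 0#) ∎
      where
      head : ∀ b → ι (pos [ b ]) ≈ (if b then 1# else 0#)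
      head true = +-identityʳ 1#
      head false = refl
    term : ∀ w → A K G y w * a ≈ A K G y w * U z w
    term w with adj y w in yw
    ... | true = *-congˡ (sym (eq yw))
    ... | false = trans (zeroˡ _) (sym (zeroˡ _))

  ku₁≈θ : ι (pos k) * u₁ ≈ θ
  ku₁≈θ = trans (neighbour-sum {x₀} {x₀} u₁ U-adj) (trans (*-congˡ (unit x₀)) (*-identityʳ θ))

  u₁≉𝟏 : ¬ u₁ ≈ 𝟏
  u₁≉𝟏 eq = θ≉k (trans (sym ku₁≈θ) (trans (*-congˡ (trans eq (sym 1≈𝟏))) (*-identityʳ _)))

  𝟏-u₁≉0 : ¬ 𝟏 - u₁ ≈ 0#
  𝟏-u₁≉0 eq = u₁≉𝟏 (sym (x-y≈0⇒x≈y _ _ eq))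

  -- The Gram determinant of two adjacent unit vectors, nonzero because `u₁ = ±1` would give
  -- `θ = ±k`.
  D : Carrier
  D = 𝟏 - u₁ * u₁

  D≉0 : ¬ D ≈ 0#
  D≉0 eq = θ≉-k (begin
    θ ≈⟨ ku₁≈θ ⟨
    ι (pos k) * u₁ ≈⟨ solve 2 (λ k u → k :* u := :- k :+ k :* (:1 :+ u)) refl (ι (pos k)) u₁ ⟩
    - ι (pos k) + ι (pos k) * (𝟏 + u₁) ≈⟨ +-congˡ (trans (*-congˡ (cancel 𝟏-u₁≉0 (trans
         (solve 1 (λ u → (:1 :- u) :* (:1 :+ u) := :1 :- u :* u) refl u₁) eq))) (zeroʳ _)) ⟩
    - ι (pos k) + 0# ≈⟨ +-identityʳ _ ⟩
    - ι (pos k) ∎)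

  -- D times the inner product of the projections of z and w to the complement of the edge x y,
  -- which is at most one-dimensional.
  R : (x y z w : V) → Carrier
  R x y z w = D * U z w - (U z x * U w x - u₁ * (U z x * U w y + U z y * U w x) + U z y * U w y)

  R-sym : ∀ x y z w → R x y z w ≈ R x y w z
  R-sym x y z w = trans (+-congʳ (*-congˡ (symmetric z w)))
    (solve 7 (λ d g u a b e f → d :* g :- (a :* e :- u :* (a :* f :+ b :* e) :+ b :* f) := d :* g :- (e :* a :- u :* (e :* b :+ f :* a) :+ f :* b)) refl
      D (U w z) u₁ (U z x) (U z y) (U w x) (U w y))

  R-value : ∀ {x y z w g s t s′ t′} → U z w ≈ g → U z x ≈ s → U z y ≈ t → U w x ≈ s′ → U w y ≈ t′ →
    R x y z w ≈ D * g - (s * s′ - u₁ * (s * t′ + t * s′) + t * t′)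
  R-value eg es et es′ et′ = +-cong (*-congˡ eg) (-‿cong (+-cong (+-cong (*-cong es es′)
    (-‿cong (*-congˡ (+-cong (*-cong es et′) (*-cong et es′))))) (*-cong et et′)))

  -- Take a relation between the vectors of `x`, `y`, `z`, `z′`. Removing the components along `x`
  -- and `y` leaves a relation between the rows of `z` and `z′` in `R`, so the minor vanishes unless
  -- both of their coefficients do. In that case `x` and `y` would be dependent, against `D ≉ 0`.
  rank1 : ∀ {x y} → x ~ y → ∀ z w z′ w′ → R x y z w * R x y z′ w′ ≈ R x y z w′ * R x y z′ w
  rank1 {x} {y} xy z w z′ w′ = stable λ ≉ → rank≤3 vs λ { (a , (i , ai≉0) , rel) → ≉ (conclude a i ai≉0 rel) }
    where
    vs : Fin 4 → V
    vs zero = x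
    vs 1F = y
    vs 2F = z
    vs 3F = z′
    module _ (a : Fin 4 → Carrier) (rel : ∀ w → ∑ (λ i → a i * U (vs i) w) ≈ 0#) where
      a₀ a₁ a₂ a₃ : Carrier
      a₀ = a zero
      a₁ = a 1F
      a₂ = a 2F
      a₃ = a 3F
      E : ∀ w {p q r s} → U x w ≈ p → U y w ≈ q → U z w ≈ r → U z′ w ≈ s → a₀ * p + (a₁ * q + (a₂ * r + a₃ * s)) ≈ 0#
      E w ep eq er es = trans (sym (+-cong (*-congˡ ep) (+-cong (*-congˡ eq) (+-cong (*-congˡ er) (*-congˡ es)))))
        (trans (sym (trans (∑-suc _) (+-congˡ (trans (∑-suc _) (+-congˡ (trans (∑-suc _) (+-congˡ
          (trans (∑-suc _) (trans (+-congˡ (∑-empty _)) (+-identityʳ _)))))))))) (rel w))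
      Ex : a₀ * 𝟏 + (a₁ * u₁ + (a₂ * U z x + a₃ * U z′ x)) ≈ 0#
      Ex = E x (trans (unit x) 1≈𝟏) (U-adj (~-sym xy)) refl refl
      Ey : a₀ * u₁ + (a₁ * 𝟏 + (a₂ * U z y + a₃ * U z′ y)) ≈ 0#
      Ey = E y (U-adj xy) (trans (unit y) 1≈𝟏) refl refl
      -- As in Cramer's rule, the pairings of the relation with `x` and `y` are subtracted from its
      -- pairing with `w` in the proportions that cancel `a₀` and `a₁`.
      key : ∀ w → a₂ * R x y z w + a₃ * R x y z′ w ≈ 0#
      key w = begin
        a₂ * R x y z w + a₃ * R x y z′ w
          ≈⟨ solve 13 (λ a₀ a₁ a₂ a₃ u g g′ s t s′ t′ p q →
               a₂ :* ((:1 :- u :* u) :* g :- (s :* p :- u :* (s :* q :+ t :* p) :+ t :* q)) :+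
               a₃ :* ((:1 :- u :* u) :* g′ :- (s′ :* p :- u :* (s′ :* q :+ t′ :* p) :+ t′ :* q))
               := (:1 :- u :* u) :* (a₀ :* p :+ (a₁ :* q :+ (a₂ :* g :+ a₃ :* g′)))
                  :- (p :- u :* q) :* (a₀ :* :1 :+ (a₁ :* u :+ (a₂ :* s :+ a₃ :* s′)))
                  :- (q :- u :* p) :* (a₀ :* u :+ (a₁ :* :1 :+ (a₂ :* t :+ a₃ :* t′)))) refl
               a₀ a₁ a₂ a₃ u₁ (U z w) (U z′ w) (U z x) (U z y) (U z′ x) (U z′ y) (U w x) (U w y) ⟩
        D * _ - (U w x - u₁ * U w y) * _ - (U w y - u₁ * U w x) * _
          ≈⟨ +-cong (+-cong (*-congˡ (E w (symmetric x w) (symmetric y w) refl refl)) (-‿cong (*-congˡ Ex))) (-‿cong (*-congˡ Ey)) ⟩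
        D * 0# - (U w x - u₁ * U w y) * 0# - (U w y - u₁ * U w x) * 0#
          ≈⟨ solve 3 (λ a b c → a :* :0 :- b :* :0 :- c :* :0 := :0) refl _ _ _ ⟩
        0# ∎
      minor : Carrier
      minor = R x y z w * R x y z′ w′ - R x y z w′ * R x y z′ w
      a₂-minor : a₂ * minor ≈ 0#
      a₂-minor = trans (solve 6 (λ a b p q p′ q′ → a :* (p :* q′ :- p′ :* q) := (a :* p :+ b :* q) :* q′ :- (a :* p′ :+ b :* q′) :* q) refl
          a₂ a₃ (R x y z w) (R x y z′ w) (R x y z w′) (R x y z′ w′))
        (trans (+-cong (*-congʳ (key w)) (-‿cong (*-congʳ (key w′)))) (solve 2 (λ a b → :0 :* a :- :0 :* b := :0) refl _ _))
      a₃-minor : a₃ * minor ≈ 0#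
      a₃-minor = trans (solve 6 (λ a b p q p′ q′ → b :* (p :* q′ :- p′ :* q) := (a :* p′ :+ b :* q′) :* p :- (a :* p :+ b :* q) :* p′) refl
          a₂ a₃ (R x y z w) (R x y z′ w) (R x y z w′) (R x y z′ w′))
        (trans (+-cong (*-congʳ (key w′)) (-‿cong (*-congʳ (key w)))) (solve 2 (λ a b → :0 :* a :- :0 :* b := :0) refl _ _))
      rest : a₂ ≈ 0# → a₃ ≈ 0# → ∀ i → a i ≈ 0#
      rest z₂ z₃ = λ { zero → cancel D≉0 (trans (solve 3 (λ a b u → (:1 :- u :* u) :* a := (a :* :1 :+ b :* u) :- u :* (a :* u :+ b :* :1)) refl a₀ a₁ u₁) (zeros (ex Ex) (ex Ey)))
                     ; 1F → cancel D≉0 (trans (solve 3 (λ a b u → (:1 :- u :* u) :* b := (a :* u :+ b :* :1) :- u :* (a :* :1 :+ b :* u)) refl a₀ a₁ u₁) (zeros (ex Ey) (ex Ex)))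
                     ; 2F → z₂ ; 3F → z₃ }
        where
        zeros : ∀ {p q} → p ≈ 0# → q ≈ 0# → p - u₁ * q ≈ 0#
        zeros ep eq = trans (+-cong ep (-‿cong (*-congˡ eq))) (solve 1 (λ u → :0 :- u :* :0 := :0) refl u₁)
        ex : ∀ {p q r s} → p + (q + (a₂ * r + a₃ * s)) ≈ 0# → p + q ≈ 0#
        ex {p} {q} {r} {s} e = trans (solve 4 (λ p q r s → p :+ q := p :+ (q :+ (:0 :* r :+ :0 :* s))) refl p q r s)
          (trans (+-congˡ (+-congˡ (+-cong (*-congʳ (sym z₂)) (*-congʳ (sym z₃))))) e)
    conclude : ∀ a (i : Fin 4) → ¬ a i ≈ 0# → (∀ w → ∑ (λ i → a i * U (vs i) w) ≈ 0#) → R x y z w * R x y z′ w′ ≈ R x y z w′ * R x y z′ w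
    conclude a i ai≉0 rel = x-y≈0⇒x≈y _ _ (stable λ m≉0 → ai≉0 (rest a rel
      (stable λ a₂≉0 → m≉0 (cancel a₂≉0 (a₂-minor a rel))) (stable λ a₃≉0 → m≉0 (cancel a₃≉0 (a₃-minor a rel))) i))

  -- The value of `R x y z z` for a neighbour `z` of `x` with `U z y = d`, that is, the Gram
  -- determinant of three unit vectors with inner products `u₁`, `u₁` and `d`.
  ρ : Carrier → Carrier
  ρ d = D * 𝟏 - (u₁ * u₁ - u₁ * (u₁ * d + d * u₁) + d * d)

  module _ {x y : V} (xy : x ~ y) where
    R-norm : ∀ {z d} → x ~ z → U z y ≈ d → R x y z z ≈ ρ d
    R-norm {z} xz zy = R-value (trans (unit z) 1≈𝟏) zx zy zx zy
      where zx = U-adj (~-sym xz)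

    -- On the line, `z` and `z′` have the same norm `ρ d`, so they are equal or opposite. Equality
    -- there, together with equal inner products with `x` and `y`, would force `U z z′ = 1`. In
    -- formulas: `ρ² = (ρ − D Δ)²` with `D Δ` nonzero.
    opposite : ∀ {z z′ d} → x ~ z → x ~ z′ → U z y ≈ d → U z′ y ≈ d → ¬ U z z′ ≈ 𝟏 →
      R x y z z′ ≈ - ρ d × ¬ ρ d ≈ 0#
    opposite {z} {z′} {d} xz xz′ zy z′y g≉1 = value , λ ρ≈0 → DΔ≉0 (trans DΔ≈2ρ (trans (*-congˡ ρ≈0) (zeroʳ _)))
      where
      g = U z z′
      Δ = 𝟏 - g
      off : R x y z z′ ≈ ρ d - D * Δ
      off = trans (R-value refl (U-adj (~-sym xz)) zy (U-adj (~-sym xz′)) z′y)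
        (solve 4 (λ D g u d → D :* g :- (u :* u :- u :* (u :* d :+ d :* u) :+ d :* d)
           := D :* :1 :- (u :* u :- u :* (u :* d :+ d :* u) :+ d :* d) :- D :* (:1 :- g)) refl D g u₁ d)
      DΔ≉0 : ¬ D * Δ ≈ 0#
      DΔ≉0 e = g≉1 (sym (x-y≈0⇒x≈y _ _ (cancel D≉0 e)))
      eqn : ρ d * ρ d ≈ (ρ d - D * Δ) * (ρ d - D * Δ)
      eqn = trans (sym (*-cong (R-norm xz zy) (R-norm xz′ z′y)))
        (trans (rank1 xy z z z′ z′) (*-cong off (trans (R-sym x y z′ z) off)))
      DΔ≈2ρ : D * Δ ≈ ι (pos 2) * ρ d
      DΔ≈2ρ = sym (x-y≈0⇒x≈y _ _ (cancel DΔ≉0 (trans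
        (solve 2 (λ p e → e :* (:2 :* p :- e) := p :* p :- (p :- e) :* (p :- e)) refl (ρ d) (D * Δ))
        (x≈y⇒x-y≈0 eqn))))
      value : R x y z z′ ≈ - ρ d
      value = trans off (trans (+-congˡ (-‿cong DΔ≈2ρ)) (solve 1 (λ p → p :- :2 :* p := :- p) refl (ρ d)))

    -- Three nonzero vectors on a line cannot be pairwise opposite: the minor with rows `z₁`, `z₃`
    -- and columns `z₂`, `z₃` would give `(−ρ) ρ = (−ρ) (−ρ)`.
    no-three : ∀ {z₁ z₂ z₃ d} → x ~ z₁ → x ~ z₂ → x ~ z₃ → U z₁ y ≈ d → U z₂ y ≈ d → U z₃ y ≈ d →
      ¬ U z₁ z₂ ≈ 𝟏 → ¬ U z₁ z₃ ≈ 𝟏 → ¬ U z₃ z₂ ≈ 𝟏 → ⊥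
    no-three {z₁} {z₂} {z₃} {d} x₁ x₂ x₃ e₁ e₂ e₃ g₁₂ g₁₃ g₃₂ =
      proj₂ o₁₂ (square-zero (2a≈0 (trans
        (solve 1 (λ p → :2 :* (p :* p) := (:- p) :* (:- p) :- (:- p) :* p) refl (ρ d))
        (x≈y⇒x-y≈0 (sym (trans (sym (*-cong (proj₁ o₁₂) (R-norm x₃ e₃)))
           (trans (rank1 xy z₁ z₂ z₃ z₃) (*-cong (proj₁ (opposite x₁ x₃ e₁ e₃ g₁₃)) (proj₁ (opposite x₃ x₂ e₃ e₂ g₃₂))))))))))
      where o₁₂ = opposite x₁ x₂ e₁ e₂ g₁₂

    -- `opposite` compares the two projections only with each other. As `ρ d` is nonzero they span
    -- the line, and the relation extends to every `w`.
    antipodal : ∀ {z z′ d} → x ~ z → x ~ z′ → U z y ≈ d → U z′ y ≈ d → ¬ U z z′ ≈ 𝟏 →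
      ∀ w → R x y z′ w ≈ - R x y z w
    antipodal {z} {z′} {d} xz xz′ zy z′y g≉1 w = x-y≈0⇒x≈y _ _ (cancel (proj₂ o) (trans
      (solve 3 (λ p a b → p :* (b :- (:- a)) := a :* p :- (:- p) :* b) refl (ρ d) (R x y z w) (R x y z′ w))
      (x≈y⇒x-y≈0 (trans (*-congˡ (sym (R-norm xz′ z′y))) (trans (rank1 xy z w z′ z′) (*-congʳ (proj₁ o)))))))
      where o = opposite xz xz′ zy z′y g≉1

    -- Equality in Cauchy-Schwarz: on a line the square of `R x y z w` is the product of the two
    -- norms.
    null : ∀ {z} → R x y z z ≈ 0# → ∀ w → R x y z w ≈ 0#
    null {z} zz w = square-zero (begin
      R x y z w * R x y z w ≈⟨ *-congˡ (R-sym x y z w) ⟩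
      R x y z w * R x y w z ≈⟨ rank1 xy z w w z ⟩
      R x y z z * R x y w w ≈⟨ trans (*-congʳ zz) (zeroˡ _) ⟩
      0# ∎)

  module _ (u₂≈𝟏 : u₂ ≈ 𝟏) where
    -- Without positivity an inner product 1 does not by itself identify two unit vectors. The
    -- common neighbour `x` helps: `z` has the same inner products with `x` and `y` as `y` has, and
    -- `ρ 1 = 0` makes its projection to the complement of the edge null.
    coincide : ∀ {y z} → Dist2 y z → ∀ w → U z w ≈ U y w
    coincide {y} {z} d@(mk ne na {x} yx xz) w = trans (x-y≈0⇒x≈y _ _ (cancel D≉0 (begin
      D * (U z w - U w y)
        ≈⟨ solve 4 (λ u g p q → (:1 :- u :* u) :* (g :- q) := (:1 :- u :* u) :* g :- (u :* p :- u :* (u :* q :+ :1 :* p) :+ :1 :* q)) refl u₁ (U z w) (U w x) (U w y) ⟩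
      D * U z w - (u₁ * U w x - u₁ * (u₁ * U w y + 𝟏 * U w x) + 𝟏 * U w y)
        ≈⟨ R-value refl (U-adj (~-sym xz)) zy refl refl ⟨
      R x y z w ≈⟨ null xy (trans (R-norm xy xz zy)
          (solve 1 (λ u → (:1 :- u :* u) :* :1 :- (u :* u :- u :* (u :* :1 :+ :1 :* u) :+ :1 :* :1) := :0) refl u₁)) w ⟩
      0# ∎))) (symmetric w y)
      where
      xy = ~-sym yx
      zy : U z y ≈ 𝟏
      zy = trans (U-dist2 (Dist2-sym d)) u₂≈𝟏

    loop : ∀ {a b v} → a ~ v → (∀ w → U a w ≈ U b w) → U b v ≈ 1# → ⊥
    loop av eq bv = u₁≉𝟏 (trans (sym (U-adj av)) (trans (eq _) (trans bv 1≈𝟏)))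

    -- Each neighbour of `y` is `p` or at distance two from it, hence has inner product 1 with `p`.
    -- The eigenvalue equation becomes `k = θ u₁ = k u₁²`, contradicting `D ≉ 0`.
    no-triangles : (∀ {x y} → x ~ y → ∀ {z} → x ~ z → z ≁ y) → ∀ {x y} → ¬ x ~ y
    no-triangles tf {p} {y} py = D≉0 (cancel k≉0 (begin
      ι (pos k) * D ≈⟨ solve 2 (λ k u → k :* (:1 :- u :* u) := k :* :1 :- k :* u :* u) refl (ι (pos k)) u₁ ⟩
      ι (pos k) * 𝟏 - ι (pos k) * u₁ * u₁ ≈⟨ +-cong (neighbour-sum {y} {p} 𝟏 values) (-‿cong (*-congʳ ku₁≈θ)) ⟩
      θ * U p y - θ * u₁ ≈⟨ x≈y⇒x-y≈0 (*-congˡ (U-adj py)) ⟩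
      0# ∎))
      where
      k≉0 : ¬ ι (pos k) ≈ 0#
      k≉0 = positive k≥3
        where
        positive : ∀ {m} → 3 ≤ m → ¬ ι (pos m) ≈ 0#
        positive (s≤s {n = m} _) = char0 m
      values : ∀ {w} → y ~ w → U p w ≈ 𝟏
      values {w} yw with p Fin.≟ w
      ... | yes ≡.refl = trans (unit p) 1≈𝟏
      ... | no ne = trans (U-dist2 (mk ne (λ pw → tf py pw (~-sym yw)) py yw)) u₂≈𝟏

    -- If `w` is a neighbour of `x` but not of `z`, it has no common neighbour with `z`: otherwise
    -- `U z w` would be both 1 and `U x w = u₁`. The middle vertex `p` and `w` are at distance two
    -- and share a vector. A triangle `x w r` then puts `r` next to a vertex with the same vector.
    twins : (∀ {x y} → x ~ y → ∃ λ z → x ~ z × z ~ y) → ∀ {x z} → Dist2 x z → ∀ {w} → x ~ w → z ~ w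
    twins tri {x} {z} d@(mk x≢z x≁z {p} xp pz) {w} xw with z ~? w
    ... | yes zw = zw
    ... | no z≁w = ⊥-elim contra
      where
      z≢w : z ≢ w
      z≢w ≡.refl = x≁z xw
      none : ∀ {m} → z ~ m → m ~ w → ⊥
      none zm mw = loop xw (λ v → sym (coincide d v)) (trans (U-dist2 (mk z≢w z≁w zm mw)) (trans u₂≈𝟏 (sym 1≈𝟏)))
      pw : Dist2 p w
      pw = mk (λ { ≡.refl → z≁w (~-sym pz) }) (λ e → none (~-sym pz) e) (~-sym xp) xw
      contra : ⊥
      contra with tri xw
      ... | r , xr , rw with r ~? p
      -- `r`, `p` and `w` would share a vector, though `r` and `w` are adjacent.
      ... | no r≁p = loop rw (λ v → sym (coincide (mk (λ { ≡.refl → Dist2.nonadj pw rw }) r≁p (~-sym xr) xp) v))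
                         (trans (sym (coincide pw w)) (unit w))
      -- `r` is at distance two from `z`, so `r`, `z` and `x` would share a vector, though `r` and
      -- `x` are adjacent.
      ... | yes rp = loop (~-sym xr) (λ v → sym (coincide (mk (λ { ≡.refl → z≁w rw }) (λ rz → none (~-sym rz) rw) rp pz) v))
                         (trans (coincide d x) (unit x))

    multipartite : Connected G → (∀ {x y} → x ~ y → ∃ λ z → x ~ z × z ~ y) ⊎ (∀ {x y} → x ~ y → ∀ {z} → x ~ z → z ≁ y) →
      CompleteMultipartite G
    multipartite conn (inj₁ tri) = completeMultipartite conn (twins tri)
    multipartite conn (inj₂ tf) = completeMultipartite conn λ d → ⊥-elim (no-triangles tf (Dist2.left d))

  module _ (u₂≉𝟏 : ¬ u₂ ≈ 𝟏) where
    separate : ∀ {x z z′} → x ~ z → x ~ z′ → z ≢ z′ → ¬ U z z′ ≈ 𝟏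
    separate {x} {z} {z′} xz xz′ ne with z ~? z′
    ... | yes e = λ g → u₁≉𝟏 (trans (sym (U-adj e)) g)
    ... | no na = λ g → u₂≉𝟏 (trans (sym (U-dist2 (mk ne na (~-sym xz) xz′))) g)

    three-common : ∀ {x y z₁ z₂ z₃} → x ~ y → x ~ z₁ → x ~ z₂ → x ~ z₃ → z₁ ~ y → z₂ ~ y → z₃ ~ y →
      z₁ ≢ z₂ → z₁ ≢ z₃ → z₂ ≢ z₃ → ⊥
    three-common xy x₁ x₂ x₃ y₁ y₂ y₃ n₁₂ n₁₃ n₂₃ =
      no-three xy x₁ x₂ x₃ (U-adj y₁) (U-adj y₂) (U-adj y₃) (separate x₁ x₂ n₁₂) (separate x₁ x₃ n₁₃) (separate x₃ x₂ (λ e → n₂₃ (≡.sym e)))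

    beyond : ∀ {x y z} → x ~ y → x ~ z → z ≢ y → z ≁ y → U z y ≈ u₂
    beyond xy xz ne na = U-dist2 (mk ne na (~-sym xz) xy)

    three-beyond : ∀ {x y z₁ z₂ z₃} → x ~ y → x ~ z₁ → x ~ z₂ → x ~ z₃ → z₁ ≢ y → z₂ ≢ y → z₃ ≢ y → z₁ ≁ y → z₂ ≁ y → z₃ ≁ y →
      z₁ ≢ z₂ → z₁ ≢ z₃ → z₂ ≢ z₃ → ⊥
    three-beyond xy x₁ x₂ x₃ m₁ m₂ m₃ y₁ y₂ y₃ n₁₂ n₁₃ n₂₃ =
      no-three xy x₁ x₂ x₃ (beyond xy x₁ m₁ y₁) (beyond xy x₂ m₂ y₂) (beyond xy x₃ m₃ y₃)
        (separate x₁ x₂ n₁₂) (separate x₁ x₃ n₁₃) (separate x₃ x₂ (λ e → n₂₃ (≡.sym e)))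

    -- For a path e − a − b − c the two choices of e are mirror images in the plane of the edge a b.
    cis-trans : ∀ {a b c e e′} → a ~ b → b ~ c → c ≢ a → c ≁ a → a ~ e → a ~ e′ → e ≢ b → e′ ≢ b → e ≁ b → e′ ≁ b → e ≢ e′ →
      ¬ U e c ≈ U e′ c
    cis-trans {a} {b} {c} {e} {e′} ab bc c≢a c≁a ae ae′ e≢b e′≢b e≁b e′≁b e≢e′ same =
      -- Equal inner products would make `c` orthogonal to the opposite vectors `e` and `e′` on the
      -- line. But `c` is not null there: exchanging the roles of `a` and `b` gives it the norm
      -- `ρ u₂`.
      proj₂ o (square-zero (begin
        ρ u₂ * ρ u₂ ≈⟨ *-cong (R-norm ab ae eb) norm-c ⟨
        R a b e e * R a b c c ≈⟨ rank1 ab e e c c ⟩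
        R a b e c * R a b c e ≈⟨ trans (*-congʳ ec≈0) (zeroˡ _) ⟩
        0# ∎))
      where
      eb = beyond ab ae e≢b e≁b
      e′b = beyond ab ae′ e′≢b e′≁b
      o = opposite ab ae ae′ eb e′b (separate ae ae′ e≢e′)
      ca = beyond (~-sym ab) bc c≢a c≁a
      norm-c : R a b c c ≈ ρ u₂
      norm-c = trans (R-value (trans (unit c) 1≈𝟏) ca (U-adj (~-sym bc)) ca (U-adj (~-sym bc)))
        (solve 3 (λ D u d → D :* :1 :- (d :* d :- u :* (d :* u :+ u :* d) :+ u :* u) := D :* :1 :- (u :* u :- u :* (u :* d :+ d :* u) :+ d :* d)) refl D u₁ u₂)
      equal : R a b e′ c ≈ R a b e c
      equal = trans (R-value (sym same) (U-adj (~-sym ae′)) e′b refl refl) (sym (R-value refl (U-adj (~-sym ae)) eb refl refl))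
      ec≈0 : R a b e c ≈ 0#
      ec≈0 = 2a≈0 (trans (solve 1 (λ p → :2 :* p := p :- :- p) refl _)
        (x≈y⇒x-y≈0 (trans (sym equal) (antipodal ab ae ae′ eb e′b (separate ae ae′ e≢e′) c))))

    -- The locally 2K₂ graphs of valency 4: the neighbours of x form a square in the plane orthogonal to x.
    square : ∀ {x y₁ y₂ y₃ y₄} → x ~ y₁ → x ~ y₂ → x ~ y₃ → x ~ y₄ → y₂ ~ y₁ → y₃ ≢ y₁ → y₄ ≢ y₁ → y₃ ≢ y₂ → y₄ ≢ y₂ → y₃ ≢ y₄ →
      y₃ ≁ y₁ → y₄ ≁ y₁ → y₃ ≁ y₂ → y₄ ≁ y₂ → (𝟏 + ι (pos 2) * u₁ ≈ 0#) × (u₂ ≈ u₁ * u₁)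
    square {x} {y₁} {y₂} {y₃} {y₄} x₁ x₂ x₃ x₄ y₂₁ n₃₁ n₄₁ n₃₂ n₄₂ n₃₄ a₃₁ a₄₁ a₃₂ a₄₂ = half , quarter
      where
      e₃ = beyond x₁ x₃ n₃₁ a₃₁
      e₄ = beyond x₁ x₄ n₄₁ a₄₁
      o = opposite x₁ x₃ x₄ e₃ e₄ (separate x₃ x₄ n₃₄)
      value : ∀ {z} → x ~ z → U z y₁ ≈ u₂ → U z y₂ ≈ u₂ → R x y₁ z y₂ ≈ D * u₂ - (u₁ * u₁ - u₁ * (u₁ * u₁ + u₂ * u₁) + u₂ * u₁)
      value xz zy₁ zy₂ = R-value zy₂ (U-adj (~-sym xz)) zy₁ (U-adj (~-sym x₂)) (U-adj y₂₁)
      v₃ = value x₃ e₃ (beyond x₂ x₃ n₃₂ a₃₂)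
      v₄ = value x₄ e₄ (beyond x₂ x₄ n₄₂ a₄₂)
      -- On the complement of the edge `x y₁` the vectors of `y₃` and `y₄` are opposite, yet they
      -- have the same inner product with `y₂`; so `y₂` is orthogonal to both there, and hence null.
      r₃₂≈0 : R x y₁ y₃ y₂ ≈ 0#
      r₃₂≈0 = 2a≈0 (trans (solve 1 (λ p → :2 :* p := p :- :- p) refl _)
        (x≈y⇒x-y≈0 (trans (trans v₃ (sym v₄)) (antipodal x₁ x₃ x₄ e₃ e₄ (separate x₃ x₄ n₃₄) y₂))))
      ρu₁≈0 : ρ u₁ ≈ 0#
      ρu₁≈0 = cancel (proj₂ o) (begin
        ρ u₂ * ρ u₁ ≈⟨ *-cong (R-norm x₁ x₃ e₃) (R-norm x₁ x₂ (U-adj y₂₁)) ⟨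
        R x y₁ y₃ y₃ * R x y₁ y₂ y₂ ≈⟨ rank1 x₁ y₃ y₃ y₂ y₂ ⟩
        R x y₁ y₃ y₂ * R x y₁ y₂ y₃ ≈⟨ trans (*-congʳ r₃₂≈0) (zeroˡ _) ⟩
        0# ∎)
      -- `ρ u₁` is the Gram determinant of a triangle, `(1 − u₁)² (1 + 2 u₁)`, so `u₁ = −1/2`.
      half : 𝟏 + ι (pos 2) * u₁ ≈ 0#
      half = cancel 𝟏-u₁≉0 (cancel 𝟏-u₁≉0 (trans (solve 1 (λ u → (:1 :- u) :* ((:1 :- u) :* (:1 :+ :2 :* u))
        := (:1 :- u :* u) :* :1 :- (u :* u :- u :* (u :* u :+ u :* u) :+ u :* u)) refl u₁) ρu₁≈0))
      quarter : u₂ ≈ u₁ * u₁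
      quarter = x-y≈0⇒x≈y _ _ (cancel 𝟏-u₁≉0 (trans (solve 2 (λ u d → (:1 :- u) :* (d :- u :* u)
        := (:1 :- u :* u) :* d :- (u :* u :- u :* (u :* u :+ d :* u) :+ d :* u)) refl u₁ u₂) (trans (sym v₃) r₃₂≈0)))

    module _ (half : 𝟏 + ι (pos 2) * u₁ ≈ 0#) (quarter : u₂ ≈ u₁ * u₁) where
      -- In vectors, `2 x₃ = 2 x₀ + x₁ − x₂`: with `u₁ = −1/2` and `u₂ = 1/4`, the vectors of `x₃`
      -- and `x₀` agree in the complement of the edge `x₁ x₂`.
      Continues : V → V → V → V → Set ℓ
      Continues x₀ x₁ x₂ x₃ = ∀ w → ι (pos 2) * U w x₃ ≈ ι (pos 2) * U w x₀ + U w x₁ - U w x₂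

      -- In the complement of the edge `x₁ x₂` the vector of `x₀` has norm `ρ u₂`, and so have those
      -- of `a` and `b`, which are opposite. So it agrees there with one of them; which one is a
      -- question about equality in the field and stays under the double negation.
      continue : ∀ {x₀ x₁ x₂ a b} → x₀ ~ x₁ → x₁ ~ x₂ → x₀ ≢ x₂ → x₀ ≁ x₂ →
        x₂ ~ a → x₂ ~ b → a ≢ x₁ → b ≢ x₁ → a ≁ x₁ → b ≁ x₁ → a ≢ b →
        ¬ ¬ (Continues x₀ x₁ x₂ a ⊎ Continues x₀ x₁ x₂ b)
      continue {x₀} {x₁} {x₂} {a} {b} e₀₁ e₁₂ n₀₂ a₀₂ e₂a e₂b na nb aa ab n κ =
        κ (inj₁ (step e₂a na aa a≈ρ))
        where
        e₂₁ = ~-sym e₁₂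
        ta = beyond e₂₁ e₂a na aa
        tb = beyond e₂₁ e₂b nb ab
        o = opposite e₂₁ e₂a e₂b ta tb (separate e₂a e₂b n)
        s₀ = beyond e₁₂ (~-sym e₀₁) n₀₂ a₀₂
        norm₀ : R x₂ x₁ x₀ x₀ ≈ ρ u₂
        norm₀ = trans (R-value (trans (unit x₀) 1≈𝟏) s₀ (U-adj e₀₁) s₀ (U-adj e₀₁))
          (solve 3 (λ D u d → D :* :1 :- (d :* d :- u :* (d :* u :+ u :* d) :+ u :* u) := D :* :1 :- (u :* u :- u :* (u :* d :+ d :* u) :+ d :* d)) refl D u₁ u₂)
        step : ∀ {z} → x₂ ~ z → z ≢ x₁ → z ≁ x₁ → R x₂ x₁ z x₀ ≈ ρ u₂ → Continues x₀ x₁ x₂ z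
        step {z} e₂z nz az zρ w = begin
          ι (pos 2) * U w z ≈⟨ *-congˡ (symmetric w z) ⟩
          ι (pos 2) * U z w ≈⟨ *-congˡ shift ⟩
          ι (pos 2) * (U x₀ w + u₁ * (U w x₂ - U w x₁))
            ≈⟨ solve 4 (λ g u s t → :2 :* (g :+ u :* (s :- t)) := :2 :* g :+ t :- s :+ (:1 :+ :2 :* u) :* (s :- t)) refl (U x₀ w) u₁ (U w x₂) (U w x₁) ⟩
          ι (pos 2) * U x₀ w + U w x₁ - U w x₂ + (𝟏 + ι (pos 2) * u₁) * (U w x₂ - U w x₁)
            ≈⟨ trans (+-congˡ (trans (*-congʳ half) (zeroˡ _))) (+-identityʳ _) ⟩
          ι (pos 2) * U x₀ w + U w x₁ - U w x₂ ≈⟨ +-congʳ (+-congʳ (*-congˡ (symmetric x₀ w))) ⟩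
          ι (pos 2) * U w x₀ + U w x₁ - U w x₂ ∎
          where
          equal : R x₂ x₁ z w ≈ R x₂ x₁ x₀ w
          equal = x-y≈0⇒x≈y _ _ (cancel (proj₂ o) (trans
            (solve 3 (λ p q r → p :* (q :- r) := q :* p :- p :* r) refl (ρ u₂) _ _)
            (x≈y⇒x-y≈0 (trans (*-congˡ (sym norm₀)) (trans (rank1 e₂₁ z w x₀ x₀) (*-congʳ zρ))))))
          shift : U z w ≈ U x₀ w + u₁ * (U w x₂ - U w x₁)
          shift = x-y≈0⇒x≈y _ _ (cancel D≉0 (begin
            D * (U z w - (U x₀ w + u₁ * (U w x₂ - U w x₁)))
              ≈⟨ solve 5 (λ g h u s t → (:1 :- u :* u) :* (g :- (h :+ u :* (s :- t))) :=
                   ((:1 :- u :* u) :* g :- (u :* s :- u :* (u :* t :+ (u :* u) :* s) :+ (u :* u) :* t)) :-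
                   ((:1 :- u :* u) :* h :- ((u :* u) :* s :- u :* ((u :* u) :* t :+ u :* s) :+ u :* t))) refl
                   (U z w) (U x₀ w) u₁ (U w x₂) (U w x₁) ⟩
            _ ≈⟨ +-cong (R-value refl (U-adj (~-sym e₂z)) (trans (beyond e₂₁ e₂z nz az) quarter) refl refl)
                   (-‿cong (R-value refl (trans s₀ quarter) (U-adj e₀₁) refl refl)) ⟨
            R x₂ x₁ z w - R x₂ x₁ x₀ w ≈⟨ x≈y⇒x-y≈0 equal ⟩
            0# ∎))
        a≈ρ : R x₂ x₁ a x₀ ≈ ρ u₂
        a≈ρ = x-y≈0⇒x≈y _ _ (stable λ ≉ρ → κ (inj₂ (step e₂b nb ab (begin
          R x₂ x₁ b x₀ ≈⟨ antipodal e₂₁ e₂a e₂b ta tb (separate e₂a e₂b n) x₀ ⟩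
          - R x₂ x₁ a x₀ ≈⟨ solve 2 (λ r p → :- r := p :- (r :+ p)) refl _ (ρ u₂) ⟩
          ρ u₂ - (R x₂ x₁ a x₀ + ρ u₂) ≈⟨ +-congˡ (-‿cong (cancel ≉ρ (begin
            (R x₂ x₁ a x₀ - ρ u₂) * (R x₂ x₁ a x₀ + ρ u₂) ≈⟨ solve 2 (λ r p → (r :- p) :* (r :+ p) := r :* r :- p :* p) refl _ _ ⟩
            R x₂ x₁ a x₀ * R x₂ x₁ a x₀ - ρ u₂ * ρ u₂ ≈⟨ +-cong (*-congˡ (R-sym x₂ x₁ a x₀)) (-‿cong (*-cong (sym (R-norm e₂₁ e₂a ta)) (sym norm₀))) ⟩
            R x₂ x₁ a x₀ * R x₂ x₁ x₀ a - R x₂ x₁ a a * R x₂ x₁ x₀ x₀ ≈⟨ x≈y⇒x-y≈0 (rank1 e₂₁ a x₀ x₀ a) ⟩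
            0# ∎))) ⟩
          ρ u₂ - 0# ≈⟨ solve 1 (λ p → p :- :0 := p) refl _ ⟩
          ρ u₂ ∎))))

-- x has valency 4 and its neighbours induce 2K₂, with y in the first edge.
record Square (G : Graph) (x y : Fin (Graph.n G)) : Set where
  open GraphBasics G
  field
    y₂ y₃ y₄ : V
    x₂ : x ~ y₂
    x₃ : x ~ y₃
    x₄ : x ~ y₄
    adj₂₁ : y₂ ~ y
    ≢₃₁ : y₃ ≢ y
    ≢₄₁ : y₄ ≢ y
    ≢₃₂ : y₃ ≢ y₂
    ≢₄₂ : y₄ ≢ y₂
    ≢₃₄ : y₃ ≢ y₄
    ≁₃₁ : y₃ ≁ y
    ≁₄₁ : y₄ ≁ y
    ≁₃₂ : y₃ ≁ y₂
    ≁₄₂ : y₄ ≁ y₂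

-- Along a path v₀, x₁, x₂, … built with `continue` the numbers 2ʲ ⟨v₀, xⱼ⟩ are odd integers, so all xⱼ differ.
module SquareExclusion {c ℓ : Level} (K : Field c ℓ) (char0 : CharZero K) (G : Graph)
  (U : Fin (Graph.n G) → Fin (Graph.n G) → Field.Carrier K) where
  open Field K hiding (zero)
  open Graph G
  open GraphBasics G
  open Initial commutativeRing using (ι; ι-+; ι-*; ι-neg)
  open Initial.Solver commutativeRing
  open import Algebra.Properties.Group +-group using () renaming (x≈y⇒x∙y⁻¹≈ε to x≈y⇒x-y≈0)
  open import Relation.Binary.Reasoning.Setoid setoid

  private
    𝟏 : Carrier
    𝟏 = ι (pos 1)

  pow : ℕ → Carrier
  pow zero = 𝟏
  pow (suc j) = ι (pos 2) * pow j

  Continues : V → V → V → V → Set ℓ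
  Continues x₀ x₁ x₂ x₃ = ∀ w → ι (pos 2) * U w x₃ ≈ ι (pos 2) * U w x₀ + U w x₁ - U w x₂

  record Path (x₀ x₁ x₂ : V) : Set where
    constructor path
    field
      e₀₁ : x₀ ~ x₁
      e₁₂ : x₁ ~ x₂
      ≢₀₂ : x₀ ≢ x₂
      ≁₀₂ : x₀ ≁ x₂

  module _ (continue : ∀ {x₀ x₁ x₂} → Path x₀ x₁ x₂ → ¬ ¬ (∃ λ x₃ → Path x₁ x₂ x₃ × Continues x₀ x₁ x₂ x₃))
    (v₀ : V) {x₁ x₂ : V} (start : Path v₀ x₁ x₂)
    (initial₀ : U v₀ v₀ ≈ 𝟏) (initial₁ : ι (pos 2) * U v₀ x₁ ≈ ι (ℤ.- pos 1)) (initial₂ : ι (pos 2) * (ι (pos 2) * U v₀ x₂) ≈ 𝟏) where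

    private
      -- Scaled inner products with `v₀` at three consecutive vertices. Only the last has to be odd:
      -- it is followed by `8 p + 2 q − r`, where `r` is the last value, so parity is inherited.
      record State (j : ℕ) : Set (c ⊔ ℓ) where
        constructor state
        field
          {a b d} : V
          route : Path a b d
          p q m : ℤ
          eqa : pow j * U v₀ a ≈ ι p
          eqb : pow (suc j) * U v₀ b ≈ ι q
          eqd : pow (suc (suc j)) * U v₀ d ≈ ι (pos 2 ℤ.* m ℤ.+ pos 1)

      states : ∀ j → ¬ ¬ State j
      states zero κ = κ (state start (pos 1) (ℤ.- pos 1) (pos 0)
        (trans (*-congˡ initial₀) (solve 0 (:1 :* :1 := :1) refl))
        (trans (solve 1 (λ u → :2 :* :1 :* u := :2 :* u) refl _) initial₁)
        (trans (solve 1 (λ u → :2 :* (:2 :* :1) :* u := :2 :* (:2 :* u)) refl _) initial₂))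
      states (suc j) κ = states j λ { (state {a} {b} {d} route p q m eqa eqb eqd) →
        continue route λ { (x₃ , route′ , cont) →
          κ (state route′ q (pos 2 ℤ.* m ℤ.+ pos 1) (pos 4 ℤ.* p ℤ.+ q ℤ.- m ℤ.- pos 1) eqb eqd (begin
            pow (suc (suc (suc j))) * U v₀ x₃
              ≈⟨ solve 2 (λ t u → :2 :* (:2 :* (:2 :* t)) :* u := con (pos 4) :* t :* (:2 :* u)) refl (pow j) _ ⟩
            ι (pos 4) * pow j * (ι (pos 2) * U v₀ x₃) ≈⟨ *-congˡ (cont v₀) ⟩
            ι (pos 4) * pow j * (ι (pos 2) * U v₀ a + U v₀ b - U v₀ d)
              ≈⟨ solve 4 (λ t x y z → con (pos 4) :* t :* (:2 :* x :+ y :- z)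
                   := con (pos 8) :* (t :* x) :+ :2 :* (:2 :* t :* y) :- :2 :* (:2 :* t) :* z) refl (pow j) _ _ _ ⟩
            ι (pos 8) * (pow j * U v₀ a) + ι (pos 2) * (pow (suc j) * U v₀ b) - pow (suc (suc j)) * U v₀ d
              ≈⟨ +-cong (+-cong (*-congˡ eqa) (*-congˡ eqb)) (-‿cong eqd) ⟩
            ι (pos 8) * ι p + ι (pos 2) * ι q - ι (pos 2 ℤ.* m ℤ.+ pos 1)
              ≈⟨ +-congˡ (-‿cong (trans (ι-+ (pos 2 ℤ.* m) (pos 1)) (+-congʳ (ι-* (pos 2) m)))) ⟩
            ι (pos 8) * ι p + ι (pos 2) * ι q - (ι (pos 2) * ι m + 𝟏)
              ≈⟨ solve 3 (λ p q m → con (pos 8) :* p :+ :2 :* q :- (:2 :* m :+ :1)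
                   := :2 :* (con (pos 4) :* p :+ q :- m :- :1) :+ :1) refl (ι p) (ι q) (ι m) ⟩
            ι (pos 2) * (ι (pos 4) * ι p + ι q - ι m - 𝟏) + 𝟏 ≈⟨ +-congʳ (*-congˡ (fold p q m)) ⟨
            ι (pos 2) * ι (pos 4 ℤ.* p ℤ.+ q ℤ.- m ℤ.- pos 1) + 𝟏
              ≈⟨ trans (ι-+ (pos 2 ℤ.* (pos 4 ℤ.* p ℤ.+ q ℤ.- m ℤ.- pos 1)) (pos 1)) (+-congʳ (ι-* (pos 2) (pos 4 ℤ.* p ℤ.+ q ℤ.- m ℤ.- pos 1))) ⟨
            ι (pos 2 ℤ.* (pos 4 ℤ.* p ℤ.+ q ℤ.- m ℤ.- pos 1) ℤ.+ pos 1) ∎)) } }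
        where
        fold : ∀ p q m → ι (pos 4 ℤ.* p ℤ.+ q ℤ.- m ℤ.- pos 1) ≈ ι (pos 4) * ι p + ι q - ι m - 𝟏
        fold p q m = trans (ι-+ (pos 4 ℤ.* p ℤ.+ q ℤ.- m) (ℤ.- pos 1)) (+-cong
          (trans (ι-+ (pos 4 ℤ.* p ℤ.+ q) (ℤ.- m)) (+-cong (trans (ι-+ (pos 4 ℤ.* p) q) (+-congʳ (ι-* (pos 4) p))) (ι-neg m))) (ι-neg (pos 1)))

      pow-+ : ∀ i j → pow (i ℕ.+ j) ≈ pow i * pow j
      pow-+ zero j = solve 1 (λ t → t := :1 :* t) refl _
      pow-+ (suc i) j = trans (*-congˡ (pow-+ i j)) (sym (*-assoc _ _ _))

      pow-ι : ∀ i → ∃ λ z → pow i ≈ ι z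
      pow-ι zero = pos 1 , refl
      pow-ι (suc i) = let (z , e) = pow-ι i in pos 2 ℤ.* z , trans (*-congˡ e) (sym (ι-* (pos 2) z))

      parity : ∀ z → pos 2 ℤ.* z ≢ pos 1
      parity z e = double ℤ.∣ z ∣ (≡.trans (≡.sym (ℤₚ.abs-* (pos 2) z)) (≡.cong ℤ.∣_∣ e))
        where
        double : ∀ m → 2 ℕ.* m ≢ 1
        double (suc m) e with () ← ≡.trans (≡.sym (ℕₚ.+-suc m (m ℕ.+ 0))) (ℕₚ.suc-injective e)

      -- If the vertices agreed, an odd integer times `2ᵉ⁺¹` would equal an odd integer.
      distinct : ∀ {i e} (s : State i) (t : State (suc i ℕ.+ e)) → State.d s ≢ State.d t
      distinct {i} {e} s t eq = parity (proj₁ (pow-ι e) ℤ.* (pos 2 ℤ.* m ℤ.+ pos 1) ℤ.- m′) (ℤₚ.i-j≡0⇒i≡j _ _ (ι-injective₀ (begin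
        ι (pos 2 ℤ.* Z ℤ.- pos 1) ≈⟨ trans (ι-+ (pos 2 ℤ.* Z) (ℤ.- pos 1)) (+-cong (ι-* (pos 2) Z) (ι-neg (pos 1))) ⟩
        ι (pos 2) * ι Z - 𝟏 ≈⟨ +-congʳ (*-congˡ (trans (ι-+ (P ℤ.* O) (ℤ.- m′)) (+-cong (ι-* P O) (ι-neg m′)))) ⟩
        ι (pos 2) * (ι P * ι O - ι m′) - 𝟏 ≈⟨ solve 3 (λ p o m → :2 :* (p :* o :- m) :- :1 := :2 :* p :* o :- (:2 :* m :+ :1)) refl (ι P) (ι O) (ι m′) ⟩
        ι (pos 2) * ι P * ι O - (ι (pos 2) * ι m′ + 𝟏) ≈⟨ +-cong (*-cong (*-congˡ (sym (proj₂ (pow-ι e)))) (sym (State.eqd s))) (-‿cong (trans (+-congʳ (sym (ι-* (pos 2) m′))) (sym (ι-+ (pos 2 ℤ.* m′) (pos 1))))) ⟩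
        ι (pos 2) * pow e * (pow (suc (suc i)) * U v₀ d) - ι (pos 2 ℤ.* m′ ℤ.+ pos 1)
          ≈⟨ +-cong (trans (solve 3 (λ s t u → :2 :* s :* (:2 :* (:2 :* t) :* u) := :2 :* (:2 :* (:2 :* (t :* s))) :* u) refl (pow e) (pow i) (U v₀ d))
                        (*-cong (*-congˡ (*-congˡ (*-congˡ (sym (pow-+ i e))))) (reflexive (≡.cong (U v₀) eq)))) (-‿cong (sym (State.eqd t))) ⟩
        pow (suc (suc (suc i ℕ.+ e))) * U v₀ (State.d t) - pow (suc (suc (suc i ℕ.+ e))) * U v₀ (State.d t) ≈⟨ -‿inverseʳ _ ⟩
        0# ∎)))
        where
        open State s using (m; d)
        open State t using () renaming (m to m′)
        P O Z : ℤ
        P = proj₁ (pow-ι e)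
        O = pos 2 ℤ.* m ℤ.+ pos 1
        Z = P ℤ.* O ℤ.- m′
        ι-injective₀ : ∀ {z} → ι z ≈ 0# → z ≡ pos 0
        ι-injective₀ {z} = Operators.ι-injective₀ K n char0 z

    impossible : ⊥
    impossible = ¬¬-finite (λ (i : Fin (suc n)) → states (Fin.toℕ i)) λ S →
      let (i , j , i<j , eq) = Finₚ.pigeonhole (ℕₚ.n<1+n n) (λ i → State.d (S i))
          (e , i+e) = ℕₚ.m≤n⇒∃[o]m+o≡n i<j
      in repeat (S i) (S j) i+e eq
      where
      repeat : ∀ {i j e} (s : State i) (t : State j) → suc i ℕ.+ e ≡ j → State.d s ≢ State.d t
      repeat s t ≡.refl = distinct s t

-- Walk counts in distance-regular graphs

module DistanceRegularity (G : Graph) where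
  open Graph G
  open GraphBasics G
  open ≡ using (refl; sym; trans; cong; cong₂; subst)

  walks-snoc : ∀ l x {y z} → walks G l x y ≢ 0 → y ~ z → walks G (suc l) x z ≢ 0
  walks-snoc zero x {y} {z} w yz with walks₀ {x} {y} w
  ... | refl = walks₁⁺ yz
  walks-snoc (suc l) x {y} {z} w yz = let (u , xu , w′) = walks-unstep l x y w in
    walks-step (suc l) z xu (walks-snoc l u w′ yz)

  private
    search-bound : ∀ {x y} e f d → walks G e x y ≢ 0 → d ≤ e → search G f d x y ≤ e
    search-bound e zero d w d≤e = d≤e
    search-bound {x} {y} e (suc f) d w d≤e with walks G d x y in eq
    ... | suc _ = d≤e
    ... | zero with ℕₚ.m≤n⇒m<n∨m≡n d≤e
    ... | inj₁ d<e = search-bound e f (suc d) w d<e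
    ... | inj₂ refl = ⊥-elim (w eq)

    search-limit : ∀ f d x y → search G f d x y ≤ d ℕ.+ f
    search-limit zero d x y = ℕₚ.≤-reflexive (sym (ℕₚ.+-identityʳ d))
    search-limit (suc f) d x y with walks G d x y
    ... | zero = subst (search G f (suc d) x y ≤_) (sym (ℕₚ.+-suc d f)) (search-limit f (suc d) x y)
    ... | suc _ = ℕₚ.m≤m+n d (suc f)

  dist-step : ∀ x {y z} → y ~ z → dist G x z ≤ suc (dist G x y)
  dist-step x {y} {z} yz with dist G x y ℕ.<? n
  ... | yes lt = search-bound (suc (dist G x y)) n 0 (walks-snoc (dist G x y) x (proj₁ (dist-invert (dist G x y) refl lt)) yz) z≤n
  -- A distance not below `n` comes from an exhausted search; then the bound `n` on all search
  -- results is enough.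
  ... | no ge = ℕₚ.≤-trans (search-limit n 0 x z) (ℕₚ.≤-trans (ℕₚ.≮⇒≥ ge) (ℕₚ.n≤1+n _))

  private
    -- The recursion for walks evaluates earlier counts at `d − 1`, `d` and `d + 1`, so constancy on
    -- pairs is turned into a function of the number. Distances that no pair attains get the value
    -- 0.
    profile : (h : V → V → ℕ) → (∀ x y x′ y′ → dist G x y ≡ dist G x′ y′ → h x y ≡ h x′ y′) →
      ∃ λ g → ∀ x y → h x y ≡ g (dist G x y)
    profile h const = g , λ x y → sym (value x y)
      where
      find : ∀ i → Dec (∃ λ x → ∃ λ y → dist G x y ≡ i)
      find i = Finₚ.any? λ x → Finₚ.any? λ y → dist G x y ℕ.≟ i
      g : ℕ → ℕ
      g i with find i
      ... | yes (x , y , _) = h x y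
      ... | no _ = 0
      value : ∀ x y → g (dist G x y) ≡ h x y
      value x y with find (dist G x y)
      ... | yes (x′ , y′ , e) = const x′ y′ x y e
      ... | no none = ⊥-elim (none (x , y , refl))

    Σᴺ-+ : ∀ {m} (f g : Fin m → ℕ) → Σᴺ (λ i → f i ℕ.+ g i) ≡ Σᴺ f ℕ.+ Σᴺ g
    Σᴺ-+ {zero} f g = refl
    Σᴺ-+ {suc m} f g = trans (Σᴺ-suc (λ i → f i ℕ.+ g i)) (trans (cong (f zero ℕ.+ g zero ℕ.+_) (Σᴺ-+ (λ i → f (suc i)) (λ i → g (suc i))))
      (trans (interchange (f zero) (g zero) _ _) (sym (cong₂ ℕ._+_ (Σᴺ-suc f) (Σᴺ-suc g)))))
      where open import Algebra.Properties.CommutativeSemigroup ℕₚ.+-commutativeSemigroup using (interchange)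

    Σᴺ-* : ∀ {m} (f : Fin m → ℕ) e → Σᴺ (λ i → f i ℕ.* e) ≡ Σᴺ f ℕ.* e
    Σᴺ-* {zero} f e = refl
    Σᴺ-* {suc m} f e = trans (Σᴺ-suc (λ i → f i ℕ.* e)) (trans (cong (f zero ℕ.* e ℕ.+_) (Σᴺ-* (λ i → f (suc i)) e))
      (trans (sym (ℕₚ.*-distribʳ-+ e (f zero) _)) (cong (ℕ._* e) (sym (Σᴺ-suc f)))))

    ≡ᵇ-true : ∀ m → (m ℕ.≡ᵇ m) ≡ true
    ≡ᵇ-true zero = refl
    ≡ᵇ-true (suc m) = ≡ᵇ-true m

    ≡ᵇ-false : ∀ {m o} → m ≢ o → (m ℕ.≡ᵇ o) ≡ false
    ≡ᵇ-false {m} {o} ne with m ℕ.≡ᵇ o in e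
    ... | false = refl
    ... | true = ⊥-elim (ne (ℕₚ.≡ᵇ⇒≡ m o (subst Data.Bool.T (sym e) tt)))

    -- Exactly one bracket is 1, as `e` is `d − 1`, `d` or `d + 1`. For `d = 0` the truncated
    -- `pred d` is harmless, its bracket being 0.
    three-way : ∀ (g : ℕ → ℕ) e d → e ≤ suc d → d ≤ suc e →
      g e ≡ [ suc e ℕ.≡ᵇ d ] ℕ.* g (ℕ.pred d) ℕ.+ ([ e ℕ.≡ᵇ d ] ℕ.* g d ℕ.+ [ e ℕ.≡ᵇ suc d ] ℕ.* g (suc d))
    three-way g e d e≤ d≤ with ℕₚ.<-cmp e d
    ... | tri< e<d _ _ with refl ← ℕₚ.≤-antisym e<d d≤
      rewrite ≡ᵇ-true e | ≡ᵇ-false {e} {suc e} (λ ()) | ≡ᵇ-false {e} {suc (suc e)} (λ ()) =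
      sym (trans (ℕₚ.+-identityʳ _) (ℕₚ.+-identityʳ _))
    three-way g e d e≤ d≤ | tri≈ _ refl _
      rewrite ≡ᵇ-true e | ≡ᵇ-false {suc e} {e} (λ ()) | ≡ᵇ-false {e} {suc e} (λ ()) =
      sym (trans (ℕₚ.+-identityʳ _) (ℕₚ.+-identityʳ _))
    three-way g e d e≤ d≤ | tri> _ _ d<e with refl ← ℕₚ.≤-antisym d<e e≤
      rewrite ≡ᵇ-true d | ≡ᵇ-false {suc (suc d)} {d} (λ ()) | ≡ᵇ-false {suc d} {d} (λ ()) =
      sym (ℕₚ.+-identityʳ _)

  module _ (dr : DistanceRegular G) where
    -- Induction on the length: the distances from `x` of the neighbours of `y` are distributed as
    -- the three intersection numbers prescribe.
    walks-profile : ∀ l → ∃ λ g → ∀ x y → walks G l y x ≡ g (dist G x y)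
    walks-profile zero = profile (λ x y → walks G 0 y x) const
      where
      nonempty : ∀ {m} → Fin m → 0 < m
      nonempty {suc m} _ = s≤s z≤n
      const : ∀ x y x′ y′ → dist G x y ≡ dist G x′ y′ → walks G 0 y x ≡ walks G 0 y′ x′
      const x y x′ y′ eq with y Fin.≟ x | y′ Fin.≟ x′
      ... | yes _ | yes _ = refl
      ... | no _ | no _ = refl
      ... | yes refl | no ne = ⊥-elim (ne (sym (walks₀ (proj₁ (dist-invert 0 (trans (sym eq) (dist-refl x)) (nonempty x))))))
      ... | no ne | yes refl = ⊥-elim (ne (sym (walks₀ (proj₁ (dist-invert 0 (trans eq (dist-refl x′)) (nonempty x))))))
    walks-profile (suc l) = profile (λ x y → walks G (suc l) y x) λ x y x′ y′ eq →
      let (cs , as , bs) = dr x y x′ y′ eq in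
      trans (formula x y) (trans
        (cong₂ ℕ._+_ (cong₂ (λ s d → s ℕ.* g (ℕ.pred d)) cs eq)
          (cong₂ ℕ._+_ (cong₂ (λ s d → s ℕ.* g d) as eq) (cong₂ (λ s d → s ℕ.* g (suc d)) bs eq)))
        (sym (formula x′ y′)))
      where
      g : ℕ → ℕ
      g = proj₁ (walks-profile l)
      formula : ∀ x y → walks G (suc l) y x ≡ cCount G x y ℕ.* g (ℕ.pred (dist G x y)) ℕ.+
        (aCount G x y ℕ.* g (dist G x y) ℕ.+ bCount G x y ℕ.* g (suc (dist G x y)))
      formula x y = trans (Σᴺ-cong term) (trans (Σᴺ-+ C′ (λ z → A′ z ℕ.+ B′ z)) (cong₂ ℕ._+_
          (Σᴺ-* (λ z → [ adj y z ∧ (suc (dist G x z) ℕ.≡ᵇ d) ]) _)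
          (trans (Σᴺ-+ A′ B′) (cong₂ ℕ._+_
            (Σᴺ-* (λ z → [ adj y z ∧ (dist G x z ℕ.≡ᵇ d) ]) _)
            (Σᴺ-* (λ z → [ adj y z ∧ (dist G x z ℕ.≡ᵇ suc d) ]) _)))))
        where
        d : ℕ
        d = dist G x y
        C′ A′ B′ : V → ℕ
        C′ z = [ adj y z ∧ (suc (dist G x z) ℕ.≡ᵇ d) ] ℕ.* g (ℕ.pred d)
        A′ z = [ adj y z ∧ (dist G x z ℕ.≡ᵇ d) ] ℕ.* g d
        B′ z = [ adj y z ∧ (dist G x z ℕ.≡ᵇ suc d) ] ℕ.* g (suc d)
        term : ∀ z → [ adj y z ] ℕ.* walks G l z x ≡ C′ z ℕ.+ (A′ z ℕ.+ B′ z)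
        term z with adj y z in yz
        ... | false = refl
        ... | true = trans (ℕₚ.*-identityˡ _) (trans (proj₂ (walks-profile l) x z)
            (three-way g (dist G x z) d (dist-step x yz) (dist-step x (~-sym yz))))

    dist⇒walkEquivalent : ∀ {x y x′ y′} → dist G x y ≡ dist G x′ y′ → ∀ l → walks G l y x ≡ walks G l y′ x′
    dist⇒walkEquivalent {x} {y} {x′} {y′} eq l = let (g , e) = walks-profile l in
      trans (e x y) (trans (cong g eq) (sym (e x′ y′)))

-- Every field ends in `⊥`, so a doubly negated record already yields the record, and the
-- coefficient field can be left behind from here on.
record GeometricFacts (G : Graph) : Set where
  open GraphBasics G
  field
    three-common : ∀ {x y z₁ z₂ z₃} → x ~ y → x ~ z₁ → x ~ z₂ → x ~ z₃ → z₁ ~ y → z₂ ~ y → z₃ ~ y →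
      z₁ ≢ z₂ → z₁ ≢ z₃ → z₂ ≢ z₃ → ⊥
    three-beyond : ∀ {x y z₁ z₂ z₃} → x ~ y → x ~ z₁ → x ~ z₂ → x ~ z₃ → z₁ ≢ y → z₂ ≢ y → z₃ ≢ y → z₁ ≁ y → z₂ ≁ y → z₃ ≁ y →
      z₁ ≢ z₂ → z₁ ≢ z₃ → z₂ ≢ z₃ → ⊥
    cis-trans : ∀ {a b c e e′} → a ~ b → b ~ c → c ≢ a → c ≁ a → a ~ e → a ~ e′ → e ≢ b → e′ ≢ b → e ≁ b → e′ ≁ b → e ≢ e′ →
      (∀ l → walks G l e c ≡ walks G l e′ c) → ⊥
    no-squares : (∀ {x y} → x ~ y → Square G x y) → ⊥

module GeometricConsequences {c ℓ : Level} (F : Field c ℓ) (char0 : CharZero F)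
  (G : Graph) (k : ℕ) (conn : Connected G) (twr : TwoWalkRegular G)
  (¬cm : ¬ CompleteMultipartite G) (reg : Regular G k) (k≥3 : 3 ≤ k)
  (θ : Field.Carrier F)
  (θ≉k : ¬ Field._≈_ F θ (Field._×ᵣ_ F k (Field.1# F)))
  (θ≉-k : ¬ Field._≈_ F θ (Field.-_ F (Field._×ᵣ_ F k (Field.1# F))))
  (mult : EigenvalueOfMultiplicity F G θ 3) where
  open Graph G
  open GraphBasics G

  x₀ : V
  x₀ = proj₁ (proj₁ twr)

  degree-enum : ∀ x → Enum k (adj x)
  degree-enum x = ≡.subst (λ d → Enum d (adj x)) (reg x) (enumerate (adj x))

  n≥3 : 3 ≤ n
  n≥3 = ℕₚ.≤-trans k≥3 (Finₚ.injective⇒≤ {f = Enum.at (degree-enum x₀)} (Enum.injective (degree-enum x₀)))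

  equivalent-refl : ∀ x y l → walks G l x x ≡ walks G l y y
  equivalent-refl x y l = proj₂ twr l x x y y (≡.trans (dist-refl x) (≡.sym (dist-refl y))) (ℕₚ.≤-trans (ℕₚ.≤-reflexive (dist-refl x)) z≤n)

  equivalent-adj : ∀ {x y x′ y′} → x ~ y → x′ ~ y′ → ∀ l → walks G l x y ≡ walks G l x′ y′
  equivalent-adj e e′ l = proj₂ twr l _ _ _ _ (≡.trans (dist₁⁺ n≥3 e) (≡.sym (dist₁⁺ n≥3 e′)))
    (ℕₚ.≤-trans (ℕₚ.≤-reflexive (dist₁⁺ n≥3 e)) (s≤s z≤n))

  equivalent-dist2 : ∀ {x y x′ y′} → Dist2 x y → Dist2 x′ y′ → ∀ l → walks G l x y ≡ walks G l x′ y′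
  equivalent-dist2 e e′ l = proj₂ twr l _ _ _ _ (≡.trans (dist₂⁺ n≥3 e) (≡.sym (dist₂⁺ n≥3 e′)))
    (ℕₚ.≤-reflexive (dist₂⁺ n≥3 e))

  y₀ : V
  y₀ = proj₁ (Cardinality.extend (degree-enum x₀) [] (ℕₚ.≤-trans (s≤s z≤n) k≥3))

  x₀~y₀ : x₀ ~ y₀
  x₀~y₀ = proj₁ (proj₂ (Cardinality.extend (degree-enum x₀) [] (ℕₚ.≤-trans (s≤s z≤n) k≥3)))

  triangles : (∀ {x y} → x ~ y → ∃ λ z → x ~ z × z ~ y) ⊎ (∀ {x y} → x ~ y → ∀ {z} → x ~ z → z ≁ y)
  triangles with walks G 2 x₀ y₀ ℕ.≟ 0
  ... | no ne = inj₁ λ e → walks₂⁻ (≡.subst (_≢ 0) (equivalent-adj x₀~y₀ e 2) ne)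
  ... | yes z = inj₂ λ {x} {y} e xz zy → walks-step 1 y xz (walks₁⁺ zy) (≡.trans (equivalent-adj e x₀~y₀ 2) z)

  private
    module S = Stable F
    K : Field c ℓ
    K = S.stableField
    module K = Field K
    char0′ : CharZero K
    char0′ = S.stable-charZero char0

    agree : ∀ {x} → K._≈_ x (K._×ᵣ_ k K.1#) → ¬ ¬ Field._≈_ F x (Field._×ᵣ_ F k (Field.1# F))
    agree {x} = ≡.subst (K._≈_ x) (S.×-agree k _)

    facts : Representations.Representation K G θ → ¬ ¬ GeometricFacts G
    facts rep κ = em {P = K._≈_ u₂ (Geo.𝟏)} λ
      { (inj₁ u₂≈𝟏) → ¬cm (Geo.multipartite u₂≈𝟏 conn triangles)
      ; (inj₂ u₂≉𝟏) → κ record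
        { three-common = Geo.three-common u₂≉𝟏
        ; three-beyond = Geo.three-beyond u₂≉𝟏
        ; cis-trans = λ ab bc ca c≁a ae ae′ n₁ n₂ n₃ n₄ n₅ eq → Geo.cis-trans u₂≉𝟏 ab bc ca c≁a ae ae′ n₁ n₂ n₃ n₄ n₅ (walk eq)
        ; no-squares = no-squares u₂≉𝟏 } }
      where
      open Representations.Representation rep
      u₁ : K.Carrier
      u₁ = U x₀ y₀
      pair : Dec (∃ λ x → ∃ λ y → dist G x y ≡ 2)
      pair = Finₚ.any? λ x → Finₚ.any? λ y → dist G x y ℕ.≟ 2
      constant₂ : Dec (∃ λ x → ∃ λ y → dist G x y ≡ 2) → ∃ λ u → ∀ {x y} → Dist2 x y → K._≈_ (U x y) u
      constant₂ (yes (x , y , e)) = U x y , λ d → walk (equivalent-dist2 d (dist₂⁻ n≥3 e))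
      -- A placeholder for the case that no pair has distance two.
      constant₂ (no none) = K.0# , λ {x} {y} d → ⊥-elim (none (x , y , dist₂⁺ n≥3 d))
      u₂ : K.Carrier
      u₂ = proj₁ (constant₂ pair)
      module Geo = Geometry K S.stable-eq char0′ G k reg x₀ k≥3 θ (λ e → agree e θ≉k)
        (λ e → ≡.subst (λ t → K._≈_ θ (K.- t)) (S.×-agree k _) e θ≉-k) rep u₁ u₂ (λ e → walk (equivalent-adj e x₀~y₀)) (proj₂ (constant₂ pair))
      no-squares : ¬ K._≈_ u₂ Geo.𝟏 → (∀ {x y} → x ~ y → Square G x y) → ⊥
      -- The path starts with `y₃`, `x₀`, `y₀`, whose inner products with `y₃` are 1, `u₁ = −1/2`
      -- and `u₂ = 1/4`.
      no-squares u₂≉𝟏 squares = X.impossible continue y₃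
        (X.path (~-sym x₃) x₀~y₀ ≢₃₁ ≁₃₁) (K.trans (unit y₃) Geo.1≈𝟏)
        (begin
          ι (pos 2) * U y₃ x₀ ≈⟨ *-congˡ (walk (equivalent-adj (~-sym x₃) x₀~y₀)) ⟩
          ι (pos 2) * u₁ ≈⟨ solve 1 (λ u → :2 :* u := (:1 :+ :2 :* u) :- :1) refl u₁ ⟩
          Geo.𝟏 + ι (pos 2) * u₁ - ι (pos 1) ≈⟨ +-congʳ half ⟩
          0# - ι (pos 1) ≈⟨ trans (+-identityˡ _) (sym (ι-neg (pos 1))) ⟩
          ι (ℤ.- pos 1) ∎)
        (begin
          ι (pos 2) * (ι (pos 2) * U y₃ y₀) ≈⟨ *-congˡ (*-congˡ (trans (Geo.beyond u₂≉𝟏 x₀~y₀ x₃ ≢₃₁ ≁₃₁) quarter)) ⟩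
          ι (pos 2) * (ι (pos 2) * (u₁ * u₁)) ≈⟨ solve 1 (λ u → :2 :* (:2 :* (u :* u)) := :1 :- (:1 :+ :2 :* u) :* (:1 :- :2 :* u)) refl u₁ ⟩
          Geo.𝟏 - (Geo.𝟏 + ι (pos 2) * u₁) * (Geo.𝟏 - ι (pos 2) * u₁) ≈⟨ +-congˡ (-‿cong (trans (*-congʳ half) (zeroˡ _))) ⟩
          Geo.𝟏 - 0# ≈⟨ solve 0 (:1 :- :0 := :1) refl ⟩
          Geo.𝟏 ∎)
        where
        open Square (squares x₀~y₀)
        open Field K using (_+_; _*_; -_; _-_; 0#; refl; sym; trans; *-congˡ; *-congʳ; +-congˡ; +-congʳ; -‿cong; +-identityˡ; zeroˡ)
        open Initial K.commutativeRing using (ι; ι-neg)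
        open Initial.Solver K.commutativeRing
        open import Relation.Binary.Reasoning.Setoid K.setoid
        module X = SquareExclusion K char0′ G U
        values = Geo.square u₂≉𝟏 x₀~y₀ x₂ x₃ x₄ adj₂₁ ≢₃₁ ≢₄₁ ≢₃₂ ≢₄₂ ≢₃₄ ≁₃₁ ≁₄₁ ≁₃₂ ≁₄₂
        half = proj₁ values
        quarter = proj₂ values
        continue : ∀ {a b d} → X.Path a b d → ¬ ¬ (∃ λ e → X.Path b d e × X.Continues a b d e)
        continue {a} {b} {d} (X.path ab bd a≢d a≁d) κ =
          Geo.continue u₂≉𝟏 half quarter ab bd a≢d a≁d Q.x₃ Q.x₄ Q.≢₃₁ Q.≢₄₁ Q.≁₃₁ Q.≁₄₁ Q.≢₃₄ λ
          { (inj₁ cont) → κ (Q.y₃ , X.path bd Q.x₃ (λ e → Q.≢₃₁ (≡.sym e)) (λ e → Q.≁₃₁ (~-sym e)) , cont)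
          ; (inj₂ cont) → κ (Q.y₄ , X.path bd Q.x₄ (λ e → Q.≢₄₁ (≡.sym e)) (λ e → Q.≁₄₁ (~-sym e)) , cont) }
          where module Q = Square (squares (~-sym bd))

    ¬¬facts : ¬ ¬ GeometricFacts G
    ¬¬facts κ = Kernel.eigenbasis F G θ mult λ { (B , 1≤d , d≤3) →
      let (B′ , d′≡d) = S.stable-basis G θ B in
      Representations.represent K G char0′ θ B′ (≡.subst (1 ≤_) (≡.sym d′≡d) 1≤d) (≡.subst (_≤ 3) (≡.sym d′≡d) d≤3) x₀ equivalent-refl λ rep →
      facts rep κ }

  geometricFacts : GeometricFacts G
  geometricFacts = record
    { three-common = λ a b c d e f g h i j → ¬¬facts λ F → GeometricFacts.three-common F a b c d e f g h i j
    ; three-beyond = λ a b c d e f g h i j l m n → ¬¬facts λ F → GeometricFacts.three-beyond F a b c d e f g h i j l m n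
    ; cis-trans = λ a b c d e f g h i j l m → ¬¬facts λ F → GeometricFacts.cis-trans F a b c d e f g h i j l m
    ; no-squares = λ a → ¬¬facts λ F → GeometricFacts.no-squares F a }

-- Recognition of graphs by their distance matrices

-- A graph encoded by its distance matrix: i and j are adjacent when D i j ≡ 1.
record Model (m k : ℕ) : Set where
  field
    D : Fin m → Fin m → ℕ
    D-refl : ∀ i → D i i ≡ 0
    D-zero : ∀ i j → D i j ≡ 0 → i ≡ j
    D-sym : ∀ i j → D i j ≡ D j i
    -- This field and the next make `D` the path metric: no edge changes it by more than one, and
    -- some edge at `i` decreases it as long as it is not zero.
    D-step : ∀ i j → D i j ≡ 1 → ∀ l → D i l ≤ suc (D j l)
    D-down : ∀ i j → D i j ≡ 0 ⊎ ∃ λ l → D i l ≡ 1 × suc (D l j) ≡ D i j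
    D-bound : ∀ i j → D i j ≤ m
    valency : ∀ i → Σᴺ (λ j → [ D i j ℕ.≡ᵇ 1 ]) ≡ k
    c a b : ℕ → ℕ
    c-count : ∀ i j → Σᴺ (λ l → [ (D j l ℕ.≡ᵇ 1) ∧ (suc (D i l) ℕ.≡ᵇ D i j) ]) ≡ c (D i j)
    a-count : ∀ i j → Σᴺ (λ l → [ (D j l ℕ.≡ᵇ 1) ∧ (D i l ℕ.≡ᵇ D i j) ]) ≡ a (D i j)
    b-count : ∀ i j → Σᴺ (λ l → [ (D j l ℕ.≡ᵇ 1) ∧ (D i l ℕ.≡ᵇ suc (D i j)) ]) ≡ b (D i j)

  open ≡ using (sym; trans)

  D-pred : ∀ {i j d} → D i j ≡ suc d → ∃ λ l → D i l ≡ 1 × D l j ≡ d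
  D-pred {i} {j} e with D-down i j
  ... | inj₁ z with () ← trans (sym z) e
  ... | inj₂ (l , il , lj) = l , il , ℕₚ.suc-injective (trans lj e)

module Recognition (G : Graph) {m k : ℕ} (M : Model m k) (conn : Connected G)
  (degree-enum : ∀ x → Enum k (Graph.adj G x))
  (φ : Fin m → Fin (Graph.n G)) (φ-injective : ∀ i j → i ≢ j → φ i ≢ φ j)
  (φ-edge : ∀ i j → Model.D M i j ≡ 1 → Graph.adj G (φ i) (φ j) ≡ true) (i₀ : Fin m) where
  open ≡ using (refl; sym; trans; cong; cong₂; subst)
  open Graph G
  open GraphBasics G
  open Model M

  private
    reflect : ∀ {p q} → (p ℕ.≡ᵇ q) ≡ true → p ≡ q
    reflect {p} {q} e = ℕₚ.≡ᵇ⇒≡ p q (subst Data.Bool.T (sym e) tt)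

    injective : ∀ {i j} → φ i ≡ φ j → i ≡ j
    injective {i} {j} e with i Fin.≟ j
    ... | yes eq = eq
    ... | no ne = ⊥-elim (φ-injective i j ne e)

    model-enum : ∀ i → Enum k (λ j → D i j ℕ.≡ᵇ 1)
    model-enum i = subst (λ d → Enum d (λ j → D i j ℕ.≡ᵇ 1)) (valency i) (enumerate (λ j → D i j ℕ.≡ᵇ 1))

    -- The model and the graph have the same valency, so the distinct images of the model neighbours
    -- exhaust the neighbourhood. This makes the image closed under adjacency, hence everything, and
    -- lets edges be reflected.
    neighbours : ∀ {i z} → φ i ~ z → ∃ λ j → D i j ≡ 1 × z ≡ φ j
    neighbours {i} {z} iz = let (l , e) = ∈-tabulate⁻ z∈ in at l , reflect (sound l) , e
      where
      open Enum (model-enum i) hiding (injective)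
      z∈ = Cardinality.full (degree-enum (φ i)) {tabulate (λ l → φ (at l))}
        (Uniqueₚ.tabulate⁺ λ e → Enum.injective (model-enum i) (injective e))
        (Allₚ.tabulate⁺ λ l → φ-edge i (at l) (reflect (sound l)))
        (ℕₚ.≤-reflexive (sym (Listₚ.length-tabulate (λ l → φ (at l))))) z iz

    surjective : ∀ z → ∃ λ i → φ i ≡ z
    surjective = reach conn (λ z → ∃ λ i → φ i ≡ z) (i₀ , refl) λ { yz (i , refl) →
      let (j , _ , e) = neighbours yz in j , sym e }

    ψ : V → Fin m
    ψ z = proj₁ (surjective z)

    φψ : ∀ z → φ (ψ z) ≡ z
    φψ z = proj₂ (surjective z)

    ψφ : ∀ i → ψ (φ i) ≡ i
    ψφ i = injective (φψ (φ i))

    adjacency : ∀ i j → (D i j ℕ.≡ᵇ 1) ≡ adj (φ i) (φ j)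
    adjacency i j with D i j ℕ.≡ᵇ 1 in eD | adj (φ i) (φ j) in eA
    ... | true | true = refl
    ... | false | false = refl
    ... | true | false = trans (sym (φ-edge i j (reflect eD))) eA
    ... | false | true with neighbours {i} {φ j} eA
    ... | l , il , e with injective e
    ... | refl = trans (sym eD) (cong (ℕ._≡ᵇ 1) il)

  isomorphic : (H : Fin m → Fin m → Bool) → (∀ i j → H i j ≡ (D i j ℕ.≡ᵇ 1)) → IsomorphicTo G m H
  isomorphic H spec = ψ , φ , φψ , ψφ , λ x y →
    trans (spec (ψ x) (ψ y)) (trans (adjacency (ψ x) (ψ y)) (cong₂ adj (φψ x) (φψ y)))

  private
    module S = Algebra.Properties.CommutativeMonoid.Sum ℕₚ.+-0-commutativeMonoid

    Σᴺ-sum : ∀ {r} (f : Fin r → ℕ) → Σᴺ f ≡ S.sum f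
    Σᴺ-sum {zero} f = refl
    Σᴺ-sum {suc r} f = trans (Σᴺ-suc f) (cong (f zero ℕ.+_) (Σᴺ-sum (λ i → f (suc i))))

    reindex : ∀ f → Σᴺ f ≡ Σᴺ (λ i → f (φ i))
    reindex f = trans (Σᴺ-sum f) (trans (S.sum-permute f (permutation φ ψ φψ ψφ)) (sym (Σᴺ-sum (λ i → f (φ i)))))

    walks⇒≤ : ∀ l i j → walks G l (φ i) (φ j) ≢ 0 → D i j ≤ l
    walks⇒≤ zero i j w with injective (walks₀ w)
    ... | refl = ℕₚ.≤-reflexive (D-refl i)
    walks⇒≤ (suc l) i j w with walks-unstep l (φ i) (φ j) w
    ... | z , iz , w′ with neighbours iz
    ... | i′ , ii′ , refl = ℕₚ.≤-trans (D-step i i′ ii′ j) (s≤s (walks⇒≤ l i′ j w′))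

    geodesic : ∀ d i j → D i j ≡ d → walks G d (φ i) (φ j) ≢ 0
    geodesic zero i j e z with D-zero i j e
    ... | refl with () ← trans (sym (walks₀-refl (φ i))) z
    geodesic (suc d) i j e = let (l , il , lj) = D-pred e in
      walks-step d (φ j) (φ-edge i l il) (geodesic d l j lj)

    distance : ∀ i j → dist G (φ i) (φ j) ≡ D i j
    distance i j = dist-value (D i j) (geodesic (D i j) i j refl) below
      (ℕₚ.≤-trans (D-bound i j) (Finₚ.injective⇒≤ injective))
      where
      below : ∀ l → l < D i j → walks G l (φ i) (φ j) ≡ 0
      below l lt with walks G l (φ i) (φ j) ℕ.≟ 0
      ... | yes z = z
      ... | no nz = ⊥-elim (ℕₚ.<⇒≱ lt (walks⇒≤ l i j nz))

    -- `φ` is a bijection that preserves distances, so one argument carries over all three counts;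
    -- `f` is the condition that selects `c`, `a` or `b`.
    transfer : ∀ (f : ℕ → ℕ → Bool) (t : ℕ → ℕ) →
      (∀ i j → Σᴺ (λ l → [ (D j l ℕ.≡ᵇ 1) ∧ f (D i l) (D i j) ]) ≡ t (D i j)) →
      ∀ x y → Σᴺ (λ z → [ adj y z ∧ f (dist G x z) (dist G x y) ]) ≡ t (dist G x y)
    transfer f t count x y = subst₂ (λ x y → Σᴺ (λ z → [ adj y z ∧ f (dist G x z) (dist G x y) ]) ≡ t (dist G x y))
      (φψ x) (φψ y) (trans (reindex _) (trans (Σᴺ-cong λ l → cong [_] (cong₂ _∧_ (sym (adjacency (ψ y) l))
        (cong₂ f (distance (ψ x) l) (distance (ψ x) (ψ y))))) (trans (count (ψ x) (ψ y)) (cong t (sym (distance (ψ x) (ψ y)))))))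
      where open ≡ using (subst₂)

  distanceRegular : DistanceRegular G
  distanceRegular x y x′ y′ e =
    same c (transfer (λ p q → suc p ℕ.≡ᵇ q) c c-count) , same a (transfer ℕ._≡ᵇ_ a a-count) ,
    same b (transfer (λ p q → p ℕ.≡ᵇ suc q) b b-count)
    where
    same : ∀ {f : V → V → ℕ} (t : ℕ → ℕ) → (∀ x y → f x y ≡ t (dist G x y)) → f x y ≡ f x′ y′
    same t h = trans (h x y) (trans (cong t e) (sym (h x′ y′)))

private
  module Pairs (m : ℕ) = DecMem {A = Fin m × Fin m} (Productₚ.≡-dec Fin._≟_ Fin._≟_)

  entry : ∀ {m} → Vec (Vec ℕ m) m → Fin m → Fin m → ℕ
  entry t i j = lookupᵛ (lookupᵛ t i) j

  intersection : ∀ {m} → Vec ℕ m → ℕ → ℕ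
  intersection [] _ = 0
  intersection (x ∷ xs) zero = x
  intersection (x ∷ xs) (suc i) = intersection xs i

module Verification {m : ℕ} (D : Fin m → Fin m → ℕ) where
  private
    ∀∀? : {P : Fin m → Fin m → Set} → (∀ i j → Dec (P i j)) → Dec (∀ i j → P i j)
    ∀∀? P? = Finₚ.all? λ i → Finₚ.all? λ j → P? i j

  refl? = Finₚ.all? λ i → D i i ℕ.≟ 0
  zero? = ∀∀? λ i j → (D i j ℕ.≟ 0) →-dec (i Fin.≟ j)
  sym? = ∀∀? λ i j → D i j ℕ.≟ D j i
  step? = ∀∀? λ i j → (D i j ℕ.≟ 1) →-dec Finₚ.all? λ l → D i l ℕ.≤? suc (D j l)
  down? = ∀∀? λ i j → (D i j ℕ.≟ 0) ⊎-dec Finₚ.any? λ l → (D i l ℕ.≟ 1) ×-dec (suc (D l j) ℕ.≟ D i j)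
  bound? : ∀ d → Dec (∀ i j → D i j ≤ d)
  bound? d = ∀∀? λ i j → D i j ℕ.≤? d
  valency? = λ k → Finₚ.all? λ i → Σᴺ (λ j → [ D i j ℕ.≡ᵇ 1 ]) ℕ.≟ k
  c? = λ (c : ℕ → ℕ) → ∀∀? λ i j → Σᴺ (λ l → [ (D j l ℕ.≡ᵇ 1) ∧ (suc (D i l) ℕ.≡ᵇ D i j) ]) ℕ.≟ c (D i j)
  a? = λ (a : ℕ → ℕ) → ∀∀? λ i j → Σᴺ (λ l → [ (D j l ℕ.≡ᵇ 1) ∧ (D i l ℕ.≡ᵇ D i j) ]) ℕ.≟ a (D i j)
  b? = λ (b : ℕ → ℕ) → ∀∀? λ i j → Σᴺ (λ l → [ (D j l ℕ.≡ᵇ 1) ∧ (D i l ℕ.≡ᵇ suc (D i j)) ]) ℕ.≟ b (D i j)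

  spec? : (H : Fin m → Fin m → Bool) → Dec (∀ i j → H i j ≡ (D i j ℕ.≡ᵇ 1))
  spec? H = ∀∀? λ i j → H i j Boolₚ.≟ (D i j ℕ.≡ᵇ 1)

  -- The lists name each pair once; accepting both orders means that symmetric facts about the
  -- images have to be supplied for one order only.
  covered? : (d : ℕ) (E : List (Fin m × Fin m)) → Dec (∀ i j → D i j ≡ d → (i , j) ∈ E ⊎ (j , i) ∈ E)
  covered? d E = ∀∀? λ i j → (D i j ℕ.≟ d) →-dec (Pairs._∈?_ m (i , j) E ⊎-dec Pairs._∈?_ m (j , i) E)

cube-edges : List (Fin 8 × Fin 8)
cube-edges =
  ((# 0 , # 1) ∷ (# 0 , # 2) ∷ (# 0 , # 4) ∷ (# 1 , # 3) ∷ (# 1 , # 5) ∷ (# 2 , # 3)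
     ∷ (# 2 , # 6) ∷ (# 3 , # 7) ∷ (# 4 , # 5) ∷ (# 4 , # 6) ∷ (# 5 , # 7) ∷ (# 6 , # 7) ∷ [])

cube-diagonals : List (Fin 8 × Fin 8)
cube-diagonals =
  ((# 0 , # 3) ∷ (# 0 , # 5) ∷ (# 0 , # 6) ∷ (# 1 , # 2) ∷ (# 1 , # 4) ∷ (# 1 , # 7) ∷ (# 2 , # 4) ∷ (# 2 , # 7) ∷ (# 3 , # 5) ∷ (# 3 , # 6) ∷ (# 4 , # 7) ∷ (# 5 , # 6) ∷ [])

abstract
  cubeD : Fin 8 → Fin 8 → ℕ
  cubeD = entry
    ((0 ∷ 1 ∷ 1 ∷ 2 ∷ 1 ∷ 2 ∷ 2 ∷ 3 ∷ [])
    ∷ (1 ∷ 0 ∷ 2 ∷ 1 ∷ 2 ∷ 1 ∷ 3 ∷ 2 ∷ [])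
    ∷ (1 ∷ 2 ∷ 0 ∷ 1 ∷ 2 ∷ 3 ∷ 1 ∷ 2 ∷ [])
    ∷ (2 ∷ 1 ∷ 1 ∷ 0 ∷ 3 ∷ 2 ∷ 2 ∷ 1 ∷ [])
    ∷ (1 ∷ 2 ∷ 2 ∷ 3 ∷ 0 ∷ 1 ∷ 1 ∷ 2 ∷ [])
    ∷ (2 ∷ 1 ∷ 3 ∷ 2 ∷ 1 ∷ 0 ∷ 2 ∷ 1 ∷ [])
    ∷ (2 ∷ 3 ∷ 1 ∷ 2 ∷ 1 ∷ 2 ∷ 0 ∷ 1 ∷ [])
    ∷ (3 ∷ 2 ∷ 2 ∷ 1 ∷ 2 ∷ 1 ∷ 1 ∷ 0 ∷ []) ∷ [])

  cube-model : Model 8 3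
  cube-model = record
    { D = cubeD
    ; c = intersection (0 ∷ 1 ∷ 2 ∷ 3 ∷ []) ; a = intersection (0 ∷ 0 ∷ 0 ∷ 0 ∷ []) ; b = intersection (3 ∷ 2 ∷ 1 ∷ 0 ∷ [])
    ; D-refl = from-yes (Verification.refl? cubeD) ; D-zero = from-yes (Verification.zero? cubeD)
    ; D-sym = from-yes (Verification.sym? cubeD) ; D-step = from-yes (Verification.step? cubeD)
    ; D-down = from-yes (Verification.down? cubeD) ; D-bound = from-yes (Verification.bound? cubeD 8)
    ; valency = from-yes (Verification.valency? cubeD 3) ; c-count = from-yes (Verification.c? cubeD (intersection (0 ∷ 1 ∷ 2 ∷ 3 ∷ [])))
    ; a-count = from-yes (Verification.a? cubeD (intersection (0 ∷ 0 ∷ 0 ∷ 0 ∷ []))) ; b-count = from-yes (Verification.b? cubeD (intersection (3 ∷ 2 ∷ 1 ∷ 0 ∷ []))) }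

  cube-spec : ∀ i j → cubeAdj i j ≡ (Model.D cube-model i j ℕ.≡ᵇ 1)
  cube-spec = from-yes (Verification.spec? cubeD cubeAdj)

  cube-diameter : ∀ i j → Model.D cube-model i j ≤ 3
  cube-diameter = from-yes (Verification.bound? cubeD 3)

  cube-edge : ∀ i j → Model.D cube-model i j ≡ 1 → (i , j) ∈ cube-edges ⊎ (j , i) ∈ cube-edges
  cube-edge = from-yes (Verification.covered? cubeD 1 cube-edges)

  cube-diagonal : ∀ i j → Model.D cube-model i j ≡ 2 → (i , j) ∈ cube-diagonals ⊎ (j , i) ∈ cube-diagonals
  cube-diagonal = from-yes (Verification.covered? cubeD 2 cube-diagonals)

icosahedron-edges : List (Fin 12 × Fin 12)
icosahedron-edges =
  ((# 0 , # 1) ∷ (# 0 , # 2) ∷ (# 0 , # 3) ∷ (# 0 , # 4) ∷ (# 0 , # 5) ∷ (# 1 , # 2)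
     ∷ (# 2 , # 3) ∷ (# 3 , # 4) ∷ (# 4 , # 5) ∷ (# 5 , # 1) ∷ (# 6 , # 7) ∷ (# 7 , # 8)
     ∷ (# 8 , # 9) ∷ (# 9 , # 10) ∷ (# 10 , # 6) ∷ (# 1 , # 6) ∷ (# 1 , # 7) ∷ (# 2 , # 7)
     ∷ (# 2 , # 8) ∷ (# 3 , # 8) ∷ (# 3 , # 9) ∷ (# 4 , # 9) ∷ (# 4 , # 10) ∷ (# 5 , # 10)
     ∷ (# 5 , # 6) ∷ (# 11 , # 6) ∷ (# 11 , # 7) ∷ (# 11 , # 8) ∷ (# 11 , # 9) ∷ (# 11 , # 10) ∷ [])

abstract
  icosahedronD : Fin 12 → Fin 12 → ℕ
  icosahedronD = entry
    ((0 ∷ 1 ∷ 1 ∷ 1 ∷ 1 ∷ 1 ∷ 2 ∷ 2 ∷ 2 ∷ 2 ∷ 2 ∷ 3 ∷ [])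
    ∷ (1 ∷ 0 ∷ 1 ∷ 2 ∷ 2 ∷ 1 ∷ 1 ∷ 1 ∷ 2 ∷ 3 ∷ 2 ∷ 2 ∷ [])
    ∷ (1 ∷ 1 ∷ 0 ∷ 1 ∷ 2 ∷ 2 ∷ 2 ∷ 1 ∷ 1 ∷ 2 ∷ 3 ∷ 2 ∷ [])
    ∷ (1 ∷ 2 ∷ 1 ∷ 0 ∷ 1 ∷ 2 ∷ 3 ∷ 2 ∷ 1 ∷ 1 ∷ 2 ∷ 2 ∷ [])
    ∷ (1 ∷ 2 ∷ 2 ∷ 1 ∷ 0 ∷ 1 ∷ 2 ∷ 3 ∷ 2 ∷ 1 ∷ 1 ∷ 2 ∷ [])
    ∷ (1 ∷ 1 ∷ 2 ∷ 2 ∷ 1 ∷ 0 ∷ 1 ∷ 2 ∷ 3 ∷ 2 ∷ 1 ∷ 2 ∷ [])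
    ∷ (2 ∷ 1 ∷ 2 ∷ 3 ∷ 2 ∷ 1 ∷ 0 ∷ 1 ∷ 2 ∷ 2 ∷ 1 ∷ 1 ∷ [])
    ∷ (2 ∷ 1 ∷ 1 ∷ 2 ∷ 3 ∷ 2 ∷ 1 ∷ 0 ∷ 1 ∷ 2 ∷ 2 ∷ 1 ∷ [])
    ∷ (2 ∷ 2 ∷ 1 ∷ 1 ∷ 2 ∷ 3 ∷ 2 ∷ 1 ∷ 0 ∷ 1 ∷ 2 ∷ 1 ∷ [])
    ∷ (2 ∷ 3 ∷ 2 ∷ 1 ∷ 1 ∷ 2 ∷ 2 ∷ 2 ∷ 1 ∷ 0 ∷ 1 ∷ 1 ∷ [])
    ∷ (2 ∷ 2 ∷ 3 ∷ 2 ∷ 1 ∷ 1 ∷ 1 ∷ 2 ∷ 2 ∷ 1 ∷ 0 ∷ 1 ∷ [])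
    ∷ (3 ∷ 2 ∷ 2 ∷ 2 ∷ 2 ∷ 2 ∷ 1 ∷ 1 ∷ 1 ∷ 1 ∷ 1 ∷ 0 ∷ []) ∷ [])

  icosahedron-model : Model 12 5
  icosahedron-model = record
    { D = icosahedronD
    ; c = intersection (0 ∷ 1 ∷ 2 ∷ 5 ∷ []) ; a = intersection (0 ∷ 2 ∷ 2 ∷ 0 ∷ []) ; b = intersection (5 ∷ 2 ∷ 1 ∷ 0 ∷ [])
    ; D-refl = from-yes (Verification.refl? icosahedronD) ; D-zero = from-yes (Verification.zero? icosahedronD)
    ; D-sym = from-yes (Verification.sym? icosahedronD) ; D-step = from-yes (Verification.step? icosahedronD)
    ; D-down = from-yes (Verification.down? icosahedronD) ; D-bound = from-yes (Verification.bound? icosahedronD 12)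
    ; valency = from-yes (Verification.valency? icosahedronD 5) ; c-count = from-yes (Verification.c? icosahedronD (intersection (0 ∷ 1 ∷ 2 ∷ 5 ∷ [])))
    ; a-count = from-yes (Verification.a? icosahedronD (intersection (0 ∷ 2 ∷ 2 ∷ 0 ∷ []))) ; b-count = from-yes (Verification.b? icosahedronD (intersection (5 ∷ 2 ∷ 1 ∷ 0 ∷ []))) }

  icosahedron-spec : ∀ i j → icosahedronAdj i j ≡ (Model.D icosahedron-model i j ℕ.≡ᵇ 1)
  icosahedron-spec = from-yes (Verification.spec? icosahedronD icosahedronAdj)

  icosahedron-diameter : ∀ i j → Model.D icosahedron-model i j ≤ 3
  icosahedron-diameter = from-yes (Verification.bound? icosahedronD 3)

  icosahedron-edge : ∀ i j → Model.D icosahedron-model i j ≡ 1 → (i , j) ∈ icosahedron-edges ⊎ (j , i) ∈ icosahedron-edges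
  icosahedron-edge = from-yes (Verification.covered? icosahedronD 1 icosahedron-edges)

  -- The five neighbours of `x` form a pentagon `a b c d e`. In a graph without K₄ this separates
  -- the images of `a` and `c`: if these were equal, `c d e` would become a triangle around `x`, and
  -- if they were adjacent, `a b c` would.
  icosahedron-wheel : let D = Model.D icosahedron-model in ∀ x a c → D a x ≡ 1 → D x c ≡ 1 → D a c ≡ 2 →
    ∃ λ b → (D x b ≡ 1 × D a b ≡ 1 × D b c ≡ 1) × ∃ λ d → (D x d ≡ 1 × D c d ≡ 1) × ∃ λ e → D x e ≡ 1 × D d e ≡ 1 × D e a ≡ 1
  icosahedron-wheel = from-yes (Finₚ.all? λ x → Finₚ.all? λ a → Finₚ.all? λ c →
    (icosahedronD a x ℕ.≟ 1) →-dec ((icosahedronD x c ℕ.≟ 1) →-dec ((icosahedronD a c ℕ.≟ 2) →-dec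
    Finₚ.any? λ b → ((icosahedronD x b ℕ.≟ 1) ×-dec (icosahedronD a b ℕ.≟ 1) ×-dec (icosahedronD b c ℕ.≟ 1)) ×-dec
    Finₚ.any? λ d → ((icosahedronD x d ℕ.≟ 1) ×-dec (icosahedronD c d ℕ.≟ 1)) ×-dec
    Finₚ.any? λ e → (icosahedronD x e ℕ.≟ 1) ×-dec (icosahedronD d e ℕ.≟ 1) ×-dec (icosahedronD e a ℕ.≟ 1))))

dodecahedron-edges : List (Fin 20 × Fin 20)
dodecahedron-edges =
  ((# 0 , # 1) ∷ (# 1 , # 2) ∷ (# 2 , # 3) ∷ (# 3 , # 4) ∷ (# 4 , # 0) ∷ (# 5 , # 6)
     ∷ (# 6 , # 7) ∷ (# 7 , # 8) ∷ (# 8 , # 9) ∷ (# 9 , # 10) ∷ (# 10 , # 11) ∷ (# 11 , # 12)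
     ∷ (# 12 , # 13) ∷ (# 13 , # 14) ∷ (# 14 , # 5) ∷ (# 0 , # 5) ∷ (# 1 , # 7) ∷ (# 2 , # 9)
     ∷ (# 3 , # 11) ∷ (# 4 , # 13) ∷ (# 15 , # 6) ∷ (# 16 , # 8) ∷ (# 17 , # 10) ∷ (# 18 , # 12)
     ∷ (# 19 , # 14) ∷ (# 15 , # 16) ∷ (# 16 , # 17) ∷ (# 17 , # 18) ∷ (# 18 , # 19) ∷ (# 19 , # 15) ∷ [])

abstract
  dodecahedronD : Fin 20 → Fin 20 → ℕ
  dodecahedronD = entry
    ((0 ∷ 1 ∷ 2 ∷ 2 ∷ 1 ∷ 1 ∷ 2 ∷ 2 ∷ 3 ∷ 3 ∷ 4 ∷ 3 ∷ 3 ∷ 2 ∷ 2 ∷ 3 ∷ 4 ∷ 5 ∷ 4 ∷ 3 ∷ [])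
    ∷ (1 ∷ 0 ∷ 1 ∷ 2 ∷ 2 ∷ 2 ∷ 2 ∷ 1 ∷ 2 ∷ 2 ∷ 3 ∷ 3 ∷ 4 ∷ 3 ∷ 3 ∷ 3 ∷ 3 ∷ 4 ∷ 5 ∷ 4 ∷ [])
    ∷ (2 ∷ 1 ∷ 0 ∷ 1 ∷ 2 ∷ 3 ∷ 3 ∷ 2 ∷ 2 ∷ 1 ∷ 2 ∷ 2 ∷ 3 ∷ 3 ∷ 4 ∷ 4 ∷ 3 ∷ 3 ∷ 4 ∷ 5 ∷ [])
    ∷ (2 ∷ 2 ∷ 1 ∷ 0 ∷ 1 ∷ 3 ∷ 4 ∷ 3 ∷ 3 ∷ 2 ∷ 2 ∷ 1 ∷ 2 ∷ 2 ∷ 3 ∷ 5 ∷ 4 ∷ 3 ∷ 3 ∷ 4 ∷ [])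
    ∷ (1 ∷ 2 ∷ 2 ∷ 1 ∷ 0 ∷ 2 ∷ 3 ∷ 3 ∷ 4 ∷ 3 ∷ 3 ∷ 2 ∷ 2 ∷ 1 ∷ 2 ∷ 4 ∷ 5 ∷ 4 ∷ 3 ∷ 3 ∷ [])
    ∷ (1 ∷ 2 ∷ 3 ∷ 3 ∷ 2 ∷ 0 ∷ 1 ∷ 2 ∷ 3 ∷ 4 ∷ 5 ∷ 4 ∷ 3 ∷ 2 ∷ 1 ∷ 2 ∷ 3 ∷ 4 ∷ 3 ∷ 2 ∷ [])
    ∷ (2 ∷ 2 ∷ 3 ∷ 4 ∷ 3 ∷ 1 ∷ 0 ∷ 1 ∷ 2 ∷ 3 ∷ 4 ∷ 5 ∷ 4 ∷ 3 ∷ 2 ∷ 1 ∷ 2 ∷ 3 ∷ 3 ∷ 2 ∷ [])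
    ∷ (2 ∷ 1 ∷ 2 ∷ 3 ∷ 3 ∷ 2 ∷ 1 ∷ 0 ∷ 1 ∷ 2 ∷ 3 ∷ 4 ∷ 5 ∷ 4 ∷ 3 ∷ 2 ∷ 2 ∷ 3 ∷ 4 ∷ 3 ∷ [])
    ∷ (3 ∷ 2 ∷ 2 ∷ 3 ∷ 4 ∷ 3 ∷ 2 ∷ 1 ∷ 0 ∷ 1 ∷ 2 ∷ 3 ∷ 4 ∷ 5 ∷ 4 ∷ 2 ∷ 1 ∷ 2 ∷ 3 ∷ 3 ∷ [])
    ∷ (3 ∷ 2 ∷ 1 ∷ 2 ∷ 3 ∷ 4 ∷ 3 ∷ 2 ∷ 1 ∷ 0 ∷ 1 ∷ 2 ∷ 3 ∷ 4 ∷ 5 ∷ 3 ∷ 2 ∷ 2 ∷ 3 ∷ 4 ∷ [])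
    ∷ (4 ∷ 3 ∷ 2 ∷ 2 ∷ 3 ∷ 5 ∷ 4 ∷ 3 ∷ 2 ∷ 1 ∷ 0 ∷ 1 ∷ 2 ∷ 3 ∷ 4 ∷ 3 ∷ 2 ∷ 1 ∷ 2 ∷ 3 ∷ [])
    ∷ (3 ∷ 3 ∷ 2 ∷ 1 ∷ 2 ∷ 4 ∷ 5 ∷ 4 ∷ 3 ∷ 2 ∷ 1 ∷ 0 ∷ 1 ∷ 2 ∷ 3 ∷ 4 ∷ 3 ∷ 2 ∷ 2 ∷ 3 ∷ [])
    ∷ (3 ∷ 4 ∷ 3 ∷ 2 ∷ 2 ∷ 3 ∷ 4 ∷ 5 ∷ 4 ∷ 3 ∷ 2 ∷ 1 ∷ 0 ∷ 1 ∷ 2 ∷ 3 ∷ 3 ∷ 2 ∷ 1 ∷ 2 ∷ [])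
    ∷ (2 ∷ 3 ∷ 3 ∷ 2 ∷ 1 ∷ 2 ∷ 3 ∷ 4 ∷ 5 ∷ 4 ∷ 3 ∷ 2 ∷ 1 ∷ 0 ∷ 1 ∷ 3 ∷ 4 ∷ 3 ∷ 2 ∷ 2 ∷ [])
    ∷ (2 ∷ 3 ∷ 4 ∷ 3 ∷ 2 ∷ 1 ∷ 2 ∷ 3 ∷ 4 ∷ 5 ∷ 4 ∷ 3 ∷ 2 ∷ 1 ∷ 0 ∷ 2 ∷ 3 ∷ 3 ∷ 2 ∷ 1 ∷ [])
    ∷ (3 ∷ 3 ∷ 4 ∷ 5 ∷ 4 ∷ 2 ∷ 1 ∷ 2 ∷ 2 ∷ 3 ∷ 3 ∷ 4 ∷ 3 ∷ 3 ∷ 2 ∷ 0 ∷ 1 ∷ 2 ∷ 2 ∷ 1 ∷ [])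
    ∷ (4 ∷ 3 ∷ 3 ∷ 4 ∷ 5 ∷ 3 ∷ 2 ∷ 2 ∷ 1 ∷ 2 ∷ 2 ∷ 3 ∷ 3 ∷ 4 ∷ 3 ∷ 1 ∷ 0 ∷ 1 ∷ 2 ∷ 2 ∷ [])
    ∷ (5 ∷ 4 ∷ 3 ∷ 3 ∷ 4 ∷ 4 ∷ 3 ∷ 3 ∷ 2 ∷ 2 ∷ 1 ∷ 2 ∷ 2 ∷ 3 ∷ 3 ∷ 2 ∷ 1 ∷ 0 ∷ 1 ∷ 2 ∷ [])
    ∷ (4 ∷ 5 ∷ 4 ∷ 3 ∷ 3 ∷ 3 ∷ 3 ∷ 4 ∷ 3 ∷ 3 ∷ 2 ∷ 2 ∷ 1 ∷ 2 ∷ 2 ∷ 2 ∷ 2 ∷ 1 ∷ 0 ∷ 1 ∷ [])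
    ∷ (3 ∷ 4 ∷ 5 ∷ 4 ∷ 3 ∷ 2 ∷ 2 ∷ 3 ∷ 3 ∷ 4 ∷ 3 ∷ 3 ∷ 2 ∷ 2 ∷ 1 ∷ 1 ∷ 2 ∷ 2 ∷ 1 ∷ 0 ∷ []) ∷ [])

  dodecahedron-model : Model 20 3
  dodecahedron-model = record
    { D = dodecahedronD
    ; c = intersection (0 ∷ 1 ∷ 1 ∷ 1 ∷ 2 ∷ 3 ∷ []) ; a = intersection (0 ∷ 0 ∷ 1 ∷ 1 ∷ 0 ∷ 0 ∷ []) ; b = intersection (3 ∷ 2 ∷ 1 ∷ 1 ∷ 1 ∷ 0 ∷ [])
    ; D-refl = from-yes (Verification.refl? dodecahedronD) ; D-zero = from-yes (Verification.zero? dodecahedronD)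
    ; D-sym = from-yes (Verification.sym? dodecahedronD) ; D-step = from-yes (Verification.step? dodecahedronD)
    ; D-down = from-yes (Verification.down? dodecahedronD) ; D-bound = from-yes (Verification.bound? dodecahedronD 20)
    ; valency = from-yes (Verification.valency? dodecahedronD 3) ; c-count = from-yes (Verification.c? dodecahedronD (intersection (0 ∷ 1 ∷ 1 ∷ 1 ∷ 2 ∷ 3 ∷ [])))
    ; a-count = from-yes (Verification.a? dodecahedronD (intersection (0 ∷ 0 ∷ 1 ∷ 1 ∷ 0 ∷ 0 ∷ []))) ; b-count = from-yes (Verification.b? dodecahedronD (intersection (3 ∷ 2 ∷ 1 ∷ 1 ∷ 1 ∷ 0 ∷ []))) }

  dodecahedron-spec : ∀ i j → dodecahedronAdj i j ≡ (Model.D dodecahedron-model i j ℕ.≡ᵇ 1)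
  dodecahedron-spec = from-yes (Verification.spec? dodecahedronD dodecahedronAdj)

  dodecahedron-diameter : ∀ i j → Model.D dodecahedron-model i j ≤ 5
  dodecahedron-diameter = from-yes (Verification.bound? dodecahedronD 5)

  dodecahedron-edge : ∀ i j → Model.D dodecahedron-model i j ≡ 1 → (i , j) ∈ dodecahedron-edges ⊎ (j , i) ∈ dodecahedron-edges
  dodecahedron-edge = from-yes (Verification.covered? dodecahedronD 1 dodecahedron-edges)

  -- Every 2-path runs along a pentagonal face. In a triangle-free graph the image of the face shows
  -- that the ends of the path stay distinct.
  dodecahedron-face : let D = Model.D dodecahedron-model in ∀ a b c → D a b ≡ 1 → D b c ≡ 1 → a ≢ c →
    ∃ λ d → D c d ≡ 1 × ∃ λ e → D d e ≡ 1 × D e a ≡ 1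
  dodecahedron-face = from-yes (Finₚ.all? λ a → Finₚ.all? λ b → Finₚ.all? λ c →
    (dodecahedronD a b ℕ.≟ 1) →-dec ((dodecahedronD b c ℕ.≟ 1) →-dec (¬? (a Fin.≟ c) →-dec
    Finₚ.any? λ d → (dodecahedronD c d ℕ.≟ 1) ×-dec Finₚ.any? λ e → (dodecahedronD d e ℕ.≟ 1) ×-dec (dodecahedronD e a ℕ.≟ 1))))

module Covering (G : Graph) {m k : ℕ} (M : Model m k) (φ : Fin m → Fin (Graph.n G))
  (edge : ∀ i j → Model.D M i j ≡ 1 → Graph.adj G (φ i) (φ j) ≡ true) where
  open ≡ using (subst)
  open GraphBasics G
  open Model M using (D; D-zero; D-pred)

  -- In diameter three the pairs at distance two decide: adjacent images differ anyway, and if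
  -- images at distance three agreed, the next vertex of a geodesic, at distance two from its end,
  -- would have an image adjacent to that end.
  from-level₂ : (∀ i j → D i j ≤ 3) → (∀ i j → D i j ≡ 2 → φ i ≢ φ j × φ i ≁ φ j) → ∀ i j → i ≢ j → φ i ≢ φ j
  from-level₂ diam lv₂ i j i≢j with D i j in e | diam i j
  ... | zero | _ = ⊥-elim (i≢j (D-zero i j e))
  ... | suc zero | _ = ~⇒≢ (edge i j e)
  ... | suc (suc zero) | _ = proj₁ (lv₂ i j e)
  ... | suc (suc (suc zero)) | _ = let (l , il , lj) = D-pred e in
    λ eq → proj₂ (lv₂ l j lj) (subst (φ l ~_) eq (~-sym (edge i l il)))
  ... | suc (suc (suc (suc _))) | s≤s (s≤s (s≤s ()))

edge-from-list : (G : Graph) {m k : ℕ} (M : Model m k) (φ : Fin m → Fin (Graph.n G)) (E : List (Fin m × Fin m)) →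
  (∀ i j → Model.D M i j ≡ 1 → (i , j) ∈ E ⊎ (j , i) ∈ E) →
  All (λ e → Graph.adj G (φ (proj₁ e)) (φ (proj₂ e)) ≡ true) E →
  ∀ i j → Model.D M i j ≡ 1 → Graph.adj G (φ i) (φ j) ≡ true
edge-from-list G M φ E cover edges i j e with cover i j e
... | inj₁ ij = All.lookup edges ij
... | inj₂ ji = GraphBasics.~-sym G (All.lookup edges ji)

-- Cubic triangle-free graphs: the cube and the dodecahedron

nx : Fin 5 → Fin 5
nx 0F = 1F
nx 1F = 2F
nx 2F = 3F
nx 3F = 4F
nx 4F = 0F

module Cubic (G : Graph) (conn : Connected G) (degree-enum : ∀ x → Enum 3 (Graph.adj G x))
  (triangle-free : ∀ {x y} → GraphBasics._~_ G x y → ∀ {z} → GraphBasics._~_ G x z → GraphBasics._≁_ G z y) where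
  open ≡ using (refl; sym; trans; subst)
  open Graph G
  open GraphBasics G

  abstract
    third : ∀ {x a b} → x ~ a → x ~ b → a ≢ b → ∃ λ c → x ~ c × c ≢ a × c ≢ b
    third {x} {a} {b} xa xb a≢b = let (c , xc , c∉) = Cardinality.extend (degree-enum x) (a ∷ b ∷ []) ℕₚ.≤-refl in
      c , xc , (λ e → c∉ (here e)) , λ e → c∉ (there (here e))

    neighbours : ∀ {x a b c} → x ~ a → x ~ b → x ~ c → a ≢ b → a ≢ c → b ≢ c → ∀ {z} → x ~ z → z ≡ a ⊎ z ≡ b ⊎ z ≡ c
    neighbours {x} xa xb xc ab ac bc {z} xz with Cardinality.full (degree-enum x) (unique₃ ab ac bc) (xa ∷ xb ∷ xc ∷ []) ℕₚ.≤-refl z xz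
    ... | here e = inj₁ e
    ... | there (here e) = inj₂ (inj₁ e)
    ... | there (there (here e)) = inj₂ (inj₂ e)

  dist2 : ∀ {x y z} → x ~ y → x ~ z → y ≢ z → Dist2 y z
  dist2 xy xz ne = mk ne (λ yz → triangle-free xz xy yz) (~-sym xy) xz

  module Cube (common-enum : ∀ {x y} → Dist2 x y → Enum 2 (common x y)) where

    abstract
      other : ∀ {x y} (d : Dist2 x y) → ∃ λ z → x ~ z × z ~ y × z ≢ Dist2.mid d
      other {x} {y} d = let (z , p , z∉) = Cardinality.extend (common-enum d) (Dist2.mid d ∷ []) ℕₚ.≤-refl ; (xz , zy) = common⁻ p in
        z , xz , zy , λ e → z∉ (here e)

      no-three : ∀ {x y a b c} → Dist2 x y → x ~ a → a ~ y → x ~ b → b ~ y → x ~ c → c ~ y → a ≢ b → a ≢ c → b ≢ c → ⊥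
      no-three d xa ay xb by xc cy ab ac bc with Cardinality.length≤ (common-enum d) (unique₃ ab ac bc)
        (common⁺ xa ay ∷ common⁺ xb by ∷ common⁺ xc cy ∷ [])
      ... | s≤s (s≤s ())

    -- Subscripts are read in binary: two vertices are to be joined when their subscripts differ in
    -- one digit. `v₃`, `v₅`, `v₆` are the second common neighbours of pairs of neighbours of `v₀`,
    -- and `v₇` is the third neighbour of `v₃`.
    module Build {v₀ v₁ v₂ v₄ : V} (e₀₁ : v₀ ~ v₁) (e₀₂ : v₀ ~ v₂) (e₀₄ : v₀ ~ v₄)
        (n₁₂ : v₁ ≢ v₂) (n₁₄ : v₁ ≢ v₄) (n₂₄ : v₂ ≢ v₄) where

      opposite : ∀ {a b} → v₀ ~ a → v₀ ~ b → a ≢ b → ∃ λ c → a ~ c × c ~ b × c ≢ v₀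
      opposite p q ne = other (dist2 p q ne)

      -- `x` and `v₀` are at distance two, and such vertices have only two common neighbours.
      apart : ∀ {a b c x} → v₀ ~ a → v₀ ~ b → v₀ ~ c → a ≢ b → a ≢ c → b ≢ c → x ≢ v₀ → a ~ x → b ~ x → c ~ x → ⊥
      apart p q r ab ac bc x≢v₀ ax bx cx =
        no-three (mk (≢-sym x≢v₀) (λ v₀x → triangle-free v₀x p ax) p ax) p ax q bx r cx ab ac bc

      v₃ = proj₁ (opposite e₀₁ e₀₂ n₁₂)
      e₁₃ = proj₁ (proj₂ (opposite e₀₁ e₀₂ n₁₂))
      e₃₂ = proj₁ (proj₂ (proj₂ (opposite e₀₁ e₀₂ n₁₂)))
      n₃₀ = proj₂ (proj₂ (proj₂ (opposite e₀₁ e₀₂ n₁₂)))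
      v₅ = proj₁ (opposite e₀₁ e₀₄ n₁₄)
      e₁₅ = proj₁ (proj₂ (opposite e₀₁ e₀₄ n₁₄))
      e₅₄ = proj₁ (proj₂ (proj₂ (opposite e₀₁ e₀₄ n₁₄)))
      n₅₀ = proj₂ (proj₂ (proj₂ (opposite e₀₁ e₀₄ n₁₄)))
      v₆ = proj₁ (opposite e₀₂ e₀₄ n₂₄)
      e₂₆ = proj₁ (proj₂ (opposite e₀₂ e₀₄ n₂₄))
      e₆₄ = proj₁ (proj₂ (proj₂ (opposite e₀₂ e₀₄ n₂₄)))
      n₆₀ = proj₂ (proj₂ (proj₂ (opposite e₀₂ e₀₄ n₂₄)))

      n₃₅ : v₃ ≢ v₅
      n₃₅ e = apart e₀₁ e₀₂ e₀₄ n₁₂ n₁₄ n₂₄ n₃₀ e₁₃ (~-sym e₃₂) (subst (v₄ ~_) (sym e) (~-sym e₅₄))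
      n₃₆ : v₃ ≢ v₆
      n₃₆ e = apart e₀₁ e₀₂ e₀₄ n₁₂ n₁₄ n₂₄ n₃₀ e₁₃ (~-sym e₃₂) (subst (v₄ ~_) (sym e) (~-sym e₆₄))
      n₅₆ : v₅ ≢ v₆
      n₅₆ e = apart e₀₁ e₀₂ e₀₄ n₁₂ n₁₄ n₂₄ n₅₀ e₁₅ (subst (v₂ ~_) (sym e) e₂₆) (~-sym e₅₄)

      N₁ : ∀ {z} → v₁ ~ z → z ≡ v₀ ⊎ z ≡ v₃ ⊎ z ≡ v₅
      N₁ = neighbours (~-sym e₀₁) e₁₃ e₁₅ (≢-sym n₃₀) (≢-sym n₅₀) n₃₅
      N₂ : ∀ {z} → v₂ ~ z → z ≡ v₀ ⊎ z ≡ v₃ ⊎ z ≡ v₆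
      N₂ = neighbours (~-sym e₀₂) (~-sym e₃₂) e₂₆ (≢-sym n₃₀) (≢-sym n₆₀) n₃₆
      N₄ : ∀ {z} → v₄ ~ z → z ≡ v₀ ⊎ z ≡ v₅ ⊎ z ≡ v₆
      N₄ = neighbours (~-sym e₀₄) (~-sym e₅₄) (~-sym e₆₄) (≢-sym n₅₀) (≢-sym n₆₀) n₅₆

      none : ∀ {z a b c : V} → z ≢ a → z ≢ b → z ≢ c → z ≡ a ⊎ z ≡ b ⊎ z ≡ c → ⊥
      none a b c (inj₁ e) = a e
      none a b c (inj₂ (inj₁ e)) = b e
      none a b c (inj₂ (inj₂ e)) = c e

      t = third (~-sym e₁₃) e₃₂ n₁₂
      v₇ = proj₁ t
      e₃₇ = proj₁ (proj₂ t)
      n₇₁ = proj₁ (proj₂ (proj₂ t))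
      n₇₂ = proj₂ (proj₂ (proj₂ t))

      N₃ : ∀ {z} → v₃ ~ z → z ≡ v₁ ⊎ z ≡ v₂ ⊎ z ≡ v₇
      N₃ = neighbours (~-sym e₁₃) e₃₂ e₃₇ n₁₂ (≢-sym n₇₁) (≢-sym n₇₂)

      -- The second common neighbour of `v₃` and `v₅` is a neighbour of `v₃` other than `v₁`. It is
      -- not `v₂`, whose neighbours are already known, so it is `v₇`.
      e₇₅ : v₇ ~ v₅
      e₇₅ with other (dist2 e₁₃ e₁₅ n₃₅)
      ... | q , q₃ , q₅ , q≢ with N₃ q₃
      ... | inj₁ e = ⊥-elim (q≢ e)
      ... | inj₂ (inj₁ refl) = ⊥-elim (none n₅₀ (≢-sym n₃₅) n₅₆ (N₂ q₅))
      ... | inj₂ (inj₂ refl) = q₅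

      e₇₆ : v₇ ~ v₆
      e₇₆ with other (dist2 (~-sym e₃₂) e₂₆ n₃₆)
      ... | q , q₃ , q₆ , q≢ with N₃ q₃
      ... | inj₁ refl = ⊥-elim (none n₆₀ (≢-sym n₃₆) (≢-sym n₅₆) (N₁ q₆))
      ... | inj₂ (inj₁ e) = ⊥-elim (q≢ e)
      ... | inj₂ (inj₂ refl) = q₆

      n₄₇ : v₄ ≢ v₇
      n₄₇ e = none n₃₀ n₃₅ n₃₆ (N₄ (subst (_~ v₃) (sym e) (~-sym e₃₇)))

      φ : Fin 8 → V
      φ = lookupᵛ (v₀ ∷ v₁ ∷ v₂ ∷ v₃ ∷ v₄ ∷ v₅ ∷ v₆ ∷ v₇ ∷ [])

      edge : ∀ i j → Model.D cube-model i j ≡ 1 → φ i ~ φ j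
      edge = edge-from-list G cube-model φ cube-edges cube-edge
        (e₀₁ ∷ e₀₂ ∷ e₀₄ ∷ e₁₃ ∷ e₁₅ ∷ ~-sym e₃₂ ∷ e₂₆ ∷ e₃₇ ∷ ~-sym e₅₄ ∷ ~-sym e₆₄ ∷ ~-sym e₇₅ ∷ ~-sym e₇₆ ∷ [])

      diagonals : All (λ e → φ (proj₁ e) ≢ φ (proj₂ e)) cube-diagonals
      diagonals = ≢-sym n₃₀ ∷ ≢-sym n₅₀ ∷ ≢-sym n₆₀ ∷ n₁₂ ∷ n₁₄ ∷ ≢-sym n₇₁ ∷ n₂₄ ∷ ≢-sym n₇₂ ∷ n₃₅ ∷ n₃₆ ∷ n₄₇ ∷ n₅₆ ∷ []

      level₂ : ∀ i j → Model.D cube-model i j ≡ 2 → φ i ≢ φ j × φ i ≁ φ j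
      level₂ i j e = ne (cube-diagonal i j e) , λ a →
        let (l , il , lj) = Model.D-pred cube-model e in triangle-free (edge l j lj) (~-sym (edge i l il)) a
        where
        ne : (i , j) ∈ cube-diagonals ⊎ (j , i) ∈ cube-diagonals → φ i ≢ φ j
        ne (inj₁ ∈) = All.lookup diagonals ∈
        ne (inj₂ ∈) = ≢-sym (All.lookup diagonals ∈)

      conclusion : IsomorphicTo G 8 cubeAdj × DistanceRegular G
      conclusion = Recognition.isomorphic G cube-model conn degree-enum φ injective edge zero cubeAdj cube-spec ,
        Recognition.distanceRegular G cube-model conn degree-enum φ injective edge zero
        where injective = Covering.from-level₂ G cube-model φ edge cube-diameter level₂

    isCube : V → IsomorphicTo G 8 cubeAdj × DistanceRegular G
    isCube v₀ = Build.conclusion (sound 0F) (sound 1F) (sound 2F)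
        (distinct {0F} {1F} λ ()) (distinct {0F} {2F} λ ()) (distinct {1F} {2F} λ ())
      where
      open Enum (degree-enum v₀)
      distinct : ∀ {i j : Fin 3} → i ≢ j → at i ≢ at j
      distinct ne e = ne (injective e)

  record Pentagon (a b c d e : V) : Set where
    constructor pent
    field
      ab : a ~ b
      bc : b ~ c
      cd : c ~ d
      de : d ~ e
      ea : e ~ a

  turn : ∀ {a b c d e} → Pentagon a b c d e → Pentagon b c d e a
  turn (pent ab bc cd de ea) = pent bc cd de ea ab

  flip : ∀ {a b c d e} → Pentagon a b c d e → Pentagon e d c b a
  flip (pent ab bc cd de ea) = pent (~-sym de) (~-sym cd) (~-sym bc) (~-sym ab) (~-sym ea)

  pentagon-≢ : ∀ {a b c d e} → Pentagon a b c d e → a ≢ c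
  pentagon-≢ (pent ab bc cd de ea) refl = triangle-free ea (~-sym de) (~-sym cd)

  module Dodecahedron
    (unique-common : ∀ {x y u v} → x ≢ y → u ~ x → u ~ y → v ~ x → v ~ y → u ≡ v)
    (pentagon : ∀ {a b c} → a ~ b → b ~ c → a ≢ c → ∃ λ d → ∃ λ e → Pentagon a b c d e)
    (pentagon-unique : ∀ {a b c d e d′ e′} → Pentagon a b c d e → Pentagon a b c d′ e′ → d ≡ d′ × e ≡ e′) where

    abstract
      -- The pentagon on the path `a′ a b` must continue to `b′`: continuing to `c`, it would be a
      -- second pentagon on the path `a b c`. It is the face on the other side of the edge `a b`.
      face : ∀ {a b c d e a′ b′} → Pentagon a b c d e → a ~ a′ → a′ ≢ b → a′ ≢ e → b ~ b′ → b′ ≢ a → b′ ≢ c →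
        ∃ λ t → a′ ~ t × t ~ b′
      face P aa′ a′≢b a′≢e bb′ b′≢a b′≢c with pentagon (~-sym aa′) (Pentagon.ab P) a′≢b
      ... | u , v , Q with neighbours (~-sym (Pentagon.ab P)) (Pentagon.bc P) bb′ (pentagon-≢ P) (≢-sym b′≢a) (≢-sym b′≢c) (Pentagon.cd Q)
      ... | inj₁ refl = ⊥-elim (pentagon-≢ (turn Q) refl)
      ... | inj₂ (inj₁ refl) = ⊥-elim (a′≢e (sym (proj₂ (pentagon-unique P (turn Q)))))
      ... | inj₂ (inj₂ refl) = v , ~-sym (Pentagon.ea Q) , ~-sym (Pentagon.de Q)

    pv : Fin 5 → Fin 5
    pv i = nx (nx (nx (nx i)))

    pv-nx : ∀ i → pv (nx i) ≡ i
    pv-nx zero = refl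
    pv-nx 1F = refl
    pv-nx 2F = refl
    pv-nx 3F = refl
    pv-nx 4F = refl

    -- Four layers of five vertices: the pentagon `p`, the outer neighbours `s i` of `p i`, the
    -- vertices `t i` that close the faces on its edges, and the third neighbours `r i` of the
    -- `t i`, which form the opposite pentagon.
    module Build {a b c d e : V} (P₀ : Pentagon a b c d e) where
      p : Fin 5 → V
      p = lookupᵛ (a ∷ b ∷ c ∷ d ∷ e ∷ [])

      P : ∀ i → Pentagon (p i) (p (nx i)) (p (nx (nx i))) (p (nx (nx (nx i)))) (p (pv i))
      P zero = P₀
      P 1F = turn P₀
      P 2F = turn (turn P₀)
      P 3F = turn (turn (turn P₀))
      P 4F = turn (turn (turn (turn P₀)))

      p-adj : ∀ i → p i ~ p (nx i)
      p-adj i = Pentagon.ab (P i)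

      abstract
        sᵗ : ∀ i → ∃ λ s → p i ~ s × s ≢ p (pv i) × s ≢ p (nx i)
        sᵗ i = third (~-sym (Pentagon.ea (P i))) (p-adj i) (pentagon-≢ (turn (turn (turn (turn (P i))))))

      s : Fin 5 → V
      s i = proj₁ (sᵗ i)
      ps : ∀ i → p i ~ s i
      ps i = proj₁ (proj₂ (sᵗ i))
      s≢pv : ∀ i → s i ≢ p (pv i)
      s≢pv i = proj₁ (proj₂ (proj₂ (sᵗ i)))
      s≢nx : ∀ i → s i ≢ p (nx i)
      s≢nx i = proj₂ (proj₂ (proj₂ (sᵗ i)))
      s-nx≢ : ∀ i → s (nx i) ≢ p i
      s-nx≢ i = subst (λ j → s (nx i) ≢ p j) (pv-nx i) (s≢pv (nx i))

      abstract
        tᵗ : ∀ i → ∃ λ t → s i ~ t × t ~ s (nx i)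
        tᵗ i = face (P i) (ps i) (s≢nx i) (s≢pv i) (ps (nx i)) (s-nx≢ i) (s≢nx (nx i))

      t : Fin 5 → V
      t i = proj₁ (tᵗ i)
      st : ∀ i → s i ~ t i
      st i = proj₁ (proj₂ (tᵗ i))
      ts : ∀ i → t i ~ s (nx i)
      ts i = proj₂ (proj₂ (tᵗ i))

      F : ∀ i → Pentagon (s i) (t i) (s (nx i)) (p (nx i)) (p i)
      F i = pent (st i) (ts i) (~-sym (ps (nx i))) (~-sym (p-adj i)) (ps i)

      -- Otherwise two consecutive faces would be pentagons on the same path `t i`, `s (nx i)`,
      -- `p (nx i)`, and `p i` would equal `p (nx (nx i))`.
      t≢t : ∀ i → t i ≢ t (nx i)
      t≢t i eq = pentagon-≢ (P i) (proj₁ (pentagon-unique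
        (subst (λ x → Pentagon x (s (nx i)) (p (nx i)) (p i) (s i)) eq (turn (F i)))
        (flip (turn (turn (F (nx i)))))))

      abstract
        rᵗ : ∀ i → ∃ λ r → t i ~ r × r ≢ s i × r ≢ s (nx i)
        rᵗ i = third (~-sym (st i)) (ts i) (pentagon-≢ (F i))

      r : Fin 5 → V
      r i = proj₁ (rᵗ i)
      tr : ∀ i → t i ~ r i
      tr i = proj₁ (proj₂ (rᵗ i))
      r≢s : ∀ i → r i ≢ s i
      r≢s i = proj₁ (proj₂ (proj₂ (rᵗ i)))
      r≢s-nx : ∀ i → r i ≢ s (nx i)
      r≢s-nx i = proj₂ (proj₂ (proj₂ (rᵗ i)))

      -- The face across the edge from `s (nx i)` to `t (nx i)` supplies a common neighbour `y` of
      -- `t i` and `r (nx i)`. If `y` were `s i`, there would be two pentagons on the path `s i`,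
      -- `t i`, `s (nx i)`; if it were `s (nx i)`, a triangle.
      rr : ∀ i → r i ~ r (nx i)
      rr i with face (F (nx i)) (~-sym (ts i)) (t≢t i) (pentagon-≢ (turn (F i))) (tr (nx i)) (r≢s (nx i)) (r≢s-nx (nx i))
      ... | y , ty , yr with neighbours (~-sym (st i)) (ts i) (tr i) (pentagon-≢ (F i)) (≢-sym (r≢s i)) (≢-sym (r≢s-nx i)) ty
      ... | inj₁ refl = ⊥-elim (pentagon-≢ (turn (turn (turn (turn (F (nx i)))))) (proj₁ (pentagon-unique
                (F i) (pent (st i) (ts i) (st (nx i)) (tr (nx i)) (~-sym yr)))))
      ... | inj₂ (inj₁ refl) = ⊥-elim (triangle-free (tr (nx i)) (~-sym (st (nx i))) yr)
      ... | inj₂ (inj₂ refl) = yr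

      i₀ i₁ i₂ i₃ i₄ : Fin 5
      i₀ = zero
      i₁ = nx i₀
      i₂ = nx i₁
      i₃ = nx i₂
      i₄ = nx i₃

      φ : Fin 20 → V
      φ = lookupᵛ (p i₀ ∷ p i₁ ∷ p i₂ ∷ p i₃ ∷ p i₄ ∷ s i₀ ∷ t i₀ ∷ s i₁ ∷ t i₁ ∷ s i₂ ∷ t i₂ ∷ s i₃ ∷ t i₃ ∷ s i₄ ∷ t i₄
        ∷ r i₀ ∷ r i₁ ∷ r i₂ ∷ r i₃ ∷ r i₄ ∷ [])

      open Model dodecahedron-model using (D; D-refl; D-zero; D-sym; D-pred)

      edge : ∀ i j → D i j ≡ 1 → φ i ~ φ j
      edge = edge-from-list G dodecahedron-model φ dodecahedron-edges dodecahedron-edge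
        (p-adj i₀ ∷ p-adj i₁ ∷ p-adj i₂ ∷ p-adj i₃ ∷ p-adj i₄
        ∷ st i₀ ∷ ts i₀ ∷ st i₁ ∷ ts i₁ ∷ st i₂ ∷ ts i₂ ∷ st i₃ ∷ ts i₃ ∷ st i₄ ∷ ts i₄
        ∷ ps i₀ ∷ ps i₁ ∷ ps i₂ ∷ ps i₃ ∷ ps i₄
        ∷ ~-sym (tr i₀) ∷ ~-sym (tr i₁) ∷ ~-sym (tr i₂) ∷ ~-sym (tr i₃) ∷ ~-sym (tr i₄)
        ∷ rr i₀ ∷ rr i₁ ∷ rr i₂ ∷ rr i₃ ∷ rr i₄ ∷ [])

      facePentagon : ∀ a b c → D a b ≡ 1 → D b c ≡ 1 → a ≢ c → ∃ λ d → ∃ λ e → (D c d ≡ 1 × D d e ≡ 1 × D e a ≡ 1) ×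
        Pentagon (φ a) (φ b) (φ c) (φ d) (φ e)
      facePentagon a b c ab bc a≢c = let (d , cd , e , de , ea) = dodecahedron-face a b c ab bc a≢c in
        d , e , (cd , de , ea) , pent (edge a b ab) (edge b c bc) (edge c d cd) (edge d e de) (edge e a ea)

      local : ∀ a b c → D a b ≡ 1 → D b c ≡ 1 → a ≢ c → φ a ≢ φ c
      local a b c ab bc a≢c = let (_ , _ , _ , P) = facePentagon a b c ab bc a≢c in pentagon-≢ P

      D-≢ : ∀ {i j d} → D i j ≡ suc d → i ≢ j
      D-≢ {i} e refl with () ← trans (sym (D-refl i)) e

      level₂ : ∀ i j → D i j ≡ 2 → φ i ≢ φ j × φ i ≁ φ j
      level₂ i j e = let (l , il , lj) = D-pred e in
        local i l j il lj (D-≢ e) , λ a → triangle-free (edge l j lj) (~-sym (edge i l il)) a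

      -- Adjacent images would close a 4-cycle, in which opposite vertices have two common
      -- neighbours.
      level₃ : ∀ i j → D i j ≡ 3 → φ i ≢ φ j × φ i ≁ φ j
      level₃ i j e = let (a , ia , aj) = D-pred e ; (b , ab , bj) = D-pred aj in
        (λ eq → proj₂ (level₂ a j aj) (subst (φ a ~_) eq (~-sym (edge i a ia)))) ,
        λ ij → proj₁ (level₂ a j aj) (unique-common (local i a b ia ab (i≢b b bj))
          (~-sym (edge i a ia)) (edge a b ab) (~-sym ij) (~-sym (edge b j bj)))
        where
        i≢b : ∀ b → D b j ≡ 1 → i ≢ b
        i≢b b bj refl with () ← trans (sym e) bj

      -- Adjacent images would close a pentagon on the path `a b c`. By uniqueness it is the image
      -- of a face of the model; as the map is injective on 2-paths, `i` and `j` would be neighbours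
      -- on that face.
      level₄ : ∀ i j → D i j ≡ 4 → φ i ≢ φ j × φ i ≁ φ j
      level₄ i j e with D-pred e
      ... | a , ia , aj with D-pred aj
      ... | b , ab , bj with D-pred bj
      ... | c , bc , cj = (λ eq → proj₂ (level₃ a j aj) (subst (φ a ~_) eq (~-sym (edge i a ia)))) , nonadj
        where
        a≢c : a ≢ c
        a≢c refl with () ← trans (sym aj) cj
        nonadj : φ i ≁ φ j
        nonadj ij with facePentagon a b c ab bc a≢c
        ... | d , f , (cd , df , fa) , Q with pentagon-unique Q (pent (edge a b ab) (edge b c bc) (edge c j cj) (~-sym ij) (edge i a ia))
        ... | eqd , eqf with d Fin.≟ j | f Fin.≟ i
        ... | no ne | _ = local d c j (trans (D-sym d c) cd) cj ne eqd
        ... | yes _ | no ne = local f a i fa (trans (D-sym a i) ia) ne eqf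
        ... | yes refl | yes refl with () ← trans (sym e) (trans (D-sym i j) df)

      injective : ∀ i j → i ≢ j → φ i ≢ φ j
      injective i j i≢j with D i j in e | dodecahedron-diameter i j
      ... | zero | _ = ⊥-elim (i≢j (D-zero i j e))
      ... | suc zero | _ = ~⇒≢ (edge i j e)
      ... | suc (suc zero) | _ = proj₁ (level₂ i j e)
      ... | suc (suc (suc zero)) | _ = proj₁ (level₃ i j e)
      ... | suc (suc (suc (suc zero))) | _ = proj₁ (level₄ i j e)
      ... | suc (suc (suc (suc (suc zero)))) | _ = let (a , ia , aj) = D-pred e in
        λ eq → proj₂ (level₄ a j aj) (subst (φ a ~_) eq (~-sym (edge i a ia)))
      ... | suc (suc (suc (suc (suc (suc _))))) | s≤s (s≤s (s≤s (s≤s (s≤s ()))))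

      conclusion : IsomorphicTo G 20 dodecahedronAdj × DistanceRegular G
      conclusion = Recognition.isomorphic G dodecahedron-model conn degree-enum φ injective edge zero dodecahedronAdj dodecahedron-spec ,
        Recognition.distanceRegular G dodecahedron-model conn degree-enum φ injective edge zero

    isDodecahedron : V → IsomorphicTo G 20 dodecahedronAdj × DistanceRegular G
    isDodecahedron x = Build.conclusion (proj₂ (proj₂ start))
      where
      open Enum (degree-enum x) hiding (injective)
      start : ∃ λ d → ∃ λ e → Pentagon (at 0F) x (at 1F) d e
      start = pentagon (~-sym (sound 0F)) (sound 1F) λ e → 0≢1 (Enum.injective (degree-enum x) e)

-- Graphs of valency five with two triangles on each edge: the icosahedron

module FiveValent (G : Graph) (conn : Connected G) (degree-enum : ∀ x → Enum 5 (Graph.adj G x))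
  (common-enum : ∀ {x y} → GraphBasics._~_ G x y → Enum 2 (GraphBasics.common G x y)) where
  open ≡ using (refl; sym; trans; subst)
  open Graph G
  open GraphBasics G

  module _ {x y : V} (xy : x ~ y) where
    abstract
      no-three : ∀ {a b c} → x ~ a → x ~ b → x ~ c → a ~ y → b ~ y → c ~ y → a ≢ b → a ≢ c → b ≢ c → ⊥
      no-three xa xb xc ay by cy ab ac bc with Cardinality.length≤ (common-enum xy) (unique₃ ab ac bc)
        (common⁺ xa ay ∷ common⁺ xb by ∷ common⁺ xc cy ∷ [])
      ... | s≤s (s≤s ())

      other : ∀ a → ∃ λ b → x ~ b × b ~ y × b ≢ a
      other a = let (b , p , b∉) = Cardinality.extend (common-enum xy) (a ∷ []) ℕₚ.≤-refl ; (xb , by) = common⁻ p in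
        b , xb , by , λ e → b∉ (here e)

      two : ∀ {a b} → x ~ a → a ~ y → x ~ b → b ~ y → a ≢ b → ∀ {z} → x ~ z → z ~ y → z ≡ a ⊎ z ≡ b
      two xa ay xb by ab {z} xz zy with Cardinality.full (common-enum xy) (unique₂ ab) (common⁺ xa ay ∷ common⁺ xb by ∷ []) ℕₚ.≤-refl z (common⁺ xz zy)
      ... | here e = inj₁ e
      ... | there (here e) = inj₂ e

      not-both : ∀ {w} → (∀ {z} → x ~ z → z ~ y → z ≡ w) → ⊥
      not-both {w} only with other w
      ... | b , xb , by , b≢w = b≢w (only xb by)

  abstract
    -- Inside the neighbourhood of `x` each of `a`, `b`, `c` already has its two neighbours. Of the
    -- two vertices that remain there, each could only be joined to the other.
    K₄-free : ∀ {x a b c} → x ~ a → x ~ b → x ~ c → a ~ b → b ~ c → c ~ a → ⊥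
    K₄-free {x} {a} {b} {c} xa xb xc ab bc ca
      with Cardinality.extend (degree-enum x) (a ∷ b ∷ c ∷ []) (s≤s (s≤s (s≤s (s≤s z≤n))))
    ... | d , xd , d∉ with Cardinality.extend (degree-enum x) (a ∷ b ∷ c ∷ d ∷ []) ℕₚ.≤-refl
    ... | e , xe , e∉ = not-both xd {e} only
      where
      d≢a : d ≢ a
      d≢a eq = d∉ (here eq)
      d≢b : d ≢ b
      d≢b eq = d∉ (there (here eq))
      d≢c : d ≢ c
      d≢c eq = d∉ (there (there (here eq)))
      only : ∀ {z} → x ~ z → z ~ d → z ≡ e
      only {z} xz zd with Cardinality.full (degree-enum x) {a ∷ b ∷ c ∷ d ∷ e ∷ []}
        (((~⇒≢ ab) ∷ ≢-sym (~⇒≢ ca) ∷ ≢-sym d≢a ∷ (λ eq → e∉ (here (sym eq))) ∷ []) ∷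
         (~⇒≢ bc ∷ ≢-sym d≢b ∷ (λ eq → e∉ (there (here (sym eq)))) ∷ []) ∷
         (≢-sym d≢c ∷ (λ eq → e∉ (there (there (here (sym eq))))) ∷ []) ∷
         ((λ eq → e∉ (there (there (there (here (sym eq)))))) ∷ []) ∷ [] ∷ [])
        (xa ∷ xb ∷ xc ∷ xd ∷ xe ∷ []) ℕₚ.≤-refl z xz
      ... | here refl = ⊥-elim (no-three xa xb xc xd (~-sym ab) ca (~-sym zd) (~⇒≢ bc) (≢-sym d≢b) (≢-sym d≢c))
      ... | there (here refl) = ⊥-elim (no-three xb xa xc xd ab (~-sym bc) (~-sym zd) (≢-sym (~⇒≢ ca)) (≢-sym d≢a) (≢-sym d≢c))
      ... | there (there (here refl)) = ⊥-elim (no-three xc xa xb xd (~-sym ca) bc (~-sym zd) (~⇒≢ ab) (≢-sym d≢a) (≢-sym d≢b))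
      ... | there (there (there (here refl))) = ⊥-elim (~⇒≢ zd refl)
      ... | there (there (there (there (here eq)))) = eq

  -- A path on four neighbours of x closes up to a 5-cycle.
  record Fifth (x a b c d : V) : Set where
    field
      e : V
      xe : x ~ e
      ea : e ~ a
      ed : e ~ d
      e≢a : e ≢ a
      e≢b : e ≢ b
      e≢c : e ≢ c
      e≢d : e ≢ d

  abstract
    -- Among the neighbours of `x`, `b` and `c` have their two already. So `a` and `d` are not
    -- joined, or `e` could not get two; hence the second neighbour of `a`, and likewise of `d`, can
    -- only be `e`.
    fifth : ∀ {x a b c d} → x ~ a → x ~ b → x ~ c → x ~ d → a ~ b → b ~ c → c ~ d → a ≢ c → a ≢ d → b ≢ d → Fifth x a b c d
    fifth {x} {a} {b} {c} {d} xa xb xc xd ab bc cd ac ad bd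
      with Cardinality.extend (degree-enum x) (a ∷ b ∷ c ∷ d ∷ []) ℕₚ.≤-refl
    ... | e , xe , e∉ = record { e = e ; xe = xe ; ea = ea ; ed = ed ; e≢a = e≢a ; e≢b = e≢b ; e≢c = e≢c ; e≢d = e≢d }
      where
      e≢a : e ≢ a
      e≢a eq = e∉ (here eq)
      e≢b : e ≢ b
      e≢b eq = e∉ (there (here eq))
      e≢c : e ≢ c
      e≢c eq = e∉ (there (there (here eq)))
      e≢d : e ≢ d
      e≢d eq = e∉ (there (there (there (here eq))))
      cases : ∀ {z} → x ~ z → z ∈ (a ∷ b ∷ c ∷ d ∷ e ∷ [])
      cases {z} = Cardinality.full (degree-enum x) {a ∷ b ∷ c ∷ d ∷ e ∷ []}
        ((~⇒≢ ab ∷ ac ∷ ad ∷ ≢-sym e≢a ∷ []) ∷ (~⇒≢ bc ∷ bd ∷ ≢-sym e≢b ∷ []) ∷ (~⇒≢ cd ∷ ≢-sym e≢c ∷ []) ∷ (≢-sym e≢d ∷ []) ∷ [] ∷ [])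
        (xa ∷ xb ∷ xc ∷ xd ∷ xe ∷ []) ℕₚ.≤-refl z
      b≁e : b ≁ e
      b≁e be = no-three xb xa xc xe ab (~-sym bc) (~-sym be) ac (≢-sym e≢a) (≢-sym e≢c)
      c≁e : c ≁ e
      c≁e ce = no-three xc xb xd xe bc (~-sym cd) (~-sym ce) bd (≢-sym e≢b) (≢-sym e≢d)
      a≁d : a ≁ d
      a≁d da with other xe a
      ... | z , xz , ze , z≢a with cases xz
      ... | here eq = z≢a eq
      ... | there (here refl) = b≁e ze
      ... | there (there (here refl)) = c≁e ze
      ... | there (there (there (here refl))) = no-three xd xc xa xe cd da (~-sym ze) (≢-sym ac) (≢-sym e≢c) (≢-sym e≢a)
      ... | there (there (there (there (here refl)))) = ~⇒≢ ze refl
      ea : e ~ a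
      ea with other xa b
      ... | z , xz , za , z≢b with cases xz
      ... | here refl = ⊥-elim (~⇒≢ za refl)
      ... | there (here eq) = ⊥-elim (z≢b eq)
      ... | there (there (here refl)) = ⊥-elim (K₄-free xa xb xc ab bc za)
      ... | there (there (there (here refl))) = ⊥-elim (a≁d (~-sym za))
      ... | there (there (there (there (here refl)))) = za
      ed : e ~ d
      ed with other xd c
      ... | z , xz , zd , z≢c with cases xz
      ... | here refl = ⊥-elim (a≁d zd)
      ... | there (here refl) = ⊥-elim (K₄-free xb xc xd bc cd (~-sym zd))
      ... | there (there (here eq)) = ⊥-elim (z≢c eq)
      ... | there (there (there (here refl))) = ⊥-elim (~⇒≢ zd refl)
      ... | there (there (there (there (here refl)))) = zd

  module Build (x : V) (y : Fin 5 → V) (xy : ∀ i → x ~ y i) (yy : ∀ i → y i ~ y (nx i)) (y≢ : ∀ i → y i ≢ y (nx (nx i))) where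

    abstract
      zᵗ : ∀ i → ∃ λ z → y i ~ z × z ~ y (nx i) × z ≢ x
      zᵗ i = other (yy i) x

    z : Fin 5 → V
    z i = proj₁ (zᵗ i)
    yz : ∀ i → y i ~ z i
    yz i = proj₁ (proj₂ (zᵗ i))
    zy : ∀ i → z i ~ y (nx i)
    zy i = proj₁ (proj₂ (proj₂ (zᵗ i)))
    z≢x : ∀ i → z i ≢ x
    z≢x i = proj₂ (proj₂ (proj₂ (zᵗ i)))

    z≁x : ∀ i → z i ≁ x
    z≁x i zx = K₄-free (xy i) (xy (nx i)) (~-sym zx) (yy i) (~-sym (zy i)) (~-sym (yz i))

    z≢y : ∀ i j → z i ≢ y j
    z≢y i j eq = z≁x i (subst (_~ x) (sym eq) (~-sym (xy j)))

    abstract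
      -- Around `y (nx i)` the path `z i`, `y i`, `x`, `y (nx (nx i))` closes to a 5-cycle. The
      -- closing vertex is joined to `y (nx (nx i))` and is not `x`, so it is `z (nx i)`.
      zz : ∀ i → z i ~ z (nx i)
      zz i = subst (z i ~_) (e≡z (two (yy (nx i)) (~-sym (xy (nx i))) (xy (nx (nx i))) (yz (nx i)) (zy (nx i)) (≢-sym (z≢x (nx i))) xe ed)) (~-sym ea)
        where
        open Fifth (fifth {y (nx i)} {z i} {y i} {x} {y (nx (nx i))} (~-sym (zy i)) (~-sym (yy i)) (~-sym (xy (nx i))) (yy (nx i))
          (~-sym (yz i)) (~-sym (xy i)) (xy (nx (nx i))) (z≢x i) (z≢y i (nx (nx i))) (y≢ i))
        e≡z : e ≡ x ⊎ e ≡ z (nx i) → e ≡ z (nx i)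
        e≡z (inj₁ eq) = ⊥-elim (e≢c eq)
        e≡z (inj₂ eq) = eq

    z≢z : ∀ i → z i ≢ z (nx (nx i))
    z≢z i eq with two (yy (nx i)) (~-sym (xy (nx i))) (xy (nx (nx i))) (yz (nx i)) (zy (nx i)) (≢-sym (z≢x (nx i)))
      (~-sym (zy i)) (subst (_~ y (nx (nx i))) (sym eq) (~-sym (yz (nx (nx i)))))
    ... | inj₁ e = z≢x i e
    ... | inj₂ e = ~⇒≢ (zz i) e

    abstract
      V′ : ∀ i → Fifth (z (nx i)) (z i) (y (nx i)) (y (nx (nx i))) (z (nx (nx i)))
      V′ i = fifth (~-sym (zz i)) (~-sym (yz (nx i))) (zy (nx i)) (zz (nx i)) (zy i) (yy (nx i)) (yz (nx (nx i)))
        (z≢y i (nx (nx i))) (z≢z i) (≢-sym (z≢y (nx (nx i)) (nx i)))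

    v : Fin 5 → V
    v i = Fifth.e (V′ i)

    -- Both are common neighbours of `z (nx i)` and `z (nx (nx i))` different from `y (nx (nx i))`,
    -- and an edge has only two common neighbours.
    v-constant : ∀ i → v i ≡ v (nx i)
    v-constant i with two (zz (nx i)) (zy (nx i)) (yz (nx (nx i))) (Fifth.xe (V′ i)) (Fifth.ed (V′ i)) (≢-sym (Fifth.e≢c (V′ i)))
      (~-sym (Fifth.ea (V′ (nx i)))) (~-sym (Fifth.xe (V′ (nx i))))
    ... | inj₁ eq = ⊥-elim (Fifth.e≢b (V′ (nx i)) eq)
    ... | inj₂ eq = sym eq

    i₀ i₁ i₂ i₃ i₄ : Fin 5
    i₀ = zero
    i₁ = nx i₀
    i₂ = nx i₁
    i₃ = nx i₂
    i₄ = nx i₃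

    apex : V
    apex = v i₀

    apex-adj : ∀ i → apex ~ z (nx i)
    apex-adj i = subst (_~ z (nx i)) (sym (all i)) (~-sym (Fifth.xe (V′ i)))
      where
      v₂ : v i₀ ≡ v i₂
      v₂ = trans (v-constant i₀) (v-constant i₁)
      v₃ : v i₀ ≡ v i₃
      v₃ = trans v₂ (v-constant i₂)
      all : ∀ i → v i₀ ≡ v i
      all zero = refl
      all 1F = v-constant i₀
      all 2F = v₂
      all 3F = v₃
      all 4F = trans v₃ (v-constant i₃)

    φ : Fin 12 → V
    -- In the edge list vertex 6 is joined to 1 and 5, that is to `y i₀` and `y i₄`, so the lower
    -- pentagon begins with `z i₄`.
    φ = lookupᵛ (x ∷ y i₀ ∷ y i₁ ∷ y i₂ ∷ y i₃ ∷ y i₄ ∷ z i₄ ∷ z i₀ ∷ z i₁ ∷ z i₂ ∷ z i₃ ∷ apex ∷ [])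

    open Model icosahedron-model using (D; D-pred)

    edge : ∀ i j → D i j ≡ 1 → φ i ~ φ j
    edge = edge-from-list G icosahedron-model φ icosahedron-edges icosahedron-edge
      (xy i₀ ∷ xy i₁ ∷ xy i₂ ∷ xy i₃ ∷ xy i₄
      ∷ yy i₀ ∷ yy i₁ ∷ yy i₂ ∷ yy i₃ ∷ yy i₄
      ∷ zz i₄ ∷ zz i₀ ∷ zz i₁ ∷ zz i₂ ∷ zz i₃
      ∷ ~-sym (zy i₄) ∷ yz i₀ ∷ ~-sym (zy i₀) ∷ yz i₁ ∷ ~-sym (zy i₁) ∷ yz i₂ ∷ ~-sym (zy i₂)
      ∷ yz i₃ ∷ ~-sym (zy i₃) ∷ yz i₄
      ∷ apex-adj i₃ ∷ apex-adj i₄ ∷ apex-adj i₀ ∷ apex-adj i₁ ∷ apex-adj i₂ ∷ [])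

    level₂ : ∀ i j → D i j ≡ 2 → φ i ≢ φ j × φ i ≁ φ j
    level₂ i j e =
      let (l , il , lj) = D-pred e
          (b , (lb , ib , bj) , d , (ld , jd) , f , lf , df , fi) = icosahedron-wheel l i j il lj e
      in (λ eq → K₄-free (edge l j lj) (edge l d ld) (edge l f lf) (edge j d jd) (edge d f df) (subst (φ f ~_) eq (edge f i fi)))
       , (λ ij → K₄-free (~-sym (edge i l il)) (edge l b lb) (edge l j lj) (edge i b ib) (edge b j bj) (~-sym ij))

    conclusion : IsomorphicTo G 12 icosahedronAdj × DistanceRegular G
    conclusion = Recognition.isomorphic G icosahedron-model conn degree-enum φ injective edge zero icosahedronAdj icosahedron-spec ,
      Recognition.distanceRegular G icosahedron-model conn degree-enum φ injective edge zero
      where injective = Covering.from-level₂ G icosahedron-model φ edge icosahedron-diameter level₂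

  isIcosahedron : V → IsomorphicTo G 12 icosahedronAdj × DistanceRegular G
  isIcosahedron x with Cardinality.extend (degree-enum x) [] (s≤s z≤n)
  ... | b , xb , _ with other xb b
  ... | a , xa , ab , _ with other xb a
  ... | c , xc , cb , c≢a with other xc b
  ... | d , xd , dc , d≢b = Build.conclusion x y
      (λ { 0F → xa ; 1F → xb ; 2F → xc ; 3F → xd ; 4F → xe })
      (λ { 0F → ab ; 1F → ~-sym cb ; 2F → ~-sym dc ; 3F → ~-sym ed ; 4F → ea })
      (λ { 0F → ≢-sym c≢a ; 1F → ≢-sym d≢b ; 2F → ≢-sym e≢c ; 3F → ≢-sym a≢d ; 4F → e≢b })
    where
    a≢d : a ≢ d
    a≢d refl = K₄-free xa xb xc ab (~-sym cb) (~-sym dc)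
    open Fifth (fifth xa xb xc xd ab (~-sym cb) (~-sym dc) (≢-sym c≢a) a≢d (≢-sym d≢b))
    y : Fin 5 → V
    y = lookupᵛ (a ∷ b ∷ c ∷ d ∷ e ∷ [])

-- Valency and number of triangles on an edge

module CaseAnalysis (G : Graph) (k : ℕ) (conn : Connected G) (¬cm : ¬ CompleteMultipartite G) (k≥3 : 3 ≤ k)
  (degree-enum : ∀ x → Enum k (Graph.adj G x)) (n≥3 : 3 ≤ Graph.n G)
  (equivalent-adj : ∀ {x y x′ y′} → GraphBasics._~_ G x y → GraphBasics._~_ G x′ y′ → ∀ l → walks G l x y ≡ walks G l x′ y′)
  (equivalent-dist2 : ∀ {x y x′ y′} → GraphBasics.Dist2 G x y → GraphBasics.Dist2 G x′ y′ → ∀ l → walks G l x y ≡ walks G l x′ y′)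
  (facts : GeometricFacts G) (x₀ y₀ : Fin (Graph.n G)) (x₀~y₀ : GraphBasics._~_ G x₀ y₀) where
  open ≡ using (refl; sym; trans; cong; subst)
  open Graph G
  open GraphBasics G
  open GeometricFacts facts

  Goal : Set
  Goal = (((k ≡ 3) × aZero G 1 × aZero G 2) ⊎ DistanceRegular G)
    × (DistanceRegular G → IsomorphicTo G 8 cubeAdj ⊎ IsomorphicTo G 20 dodecahedronAdj ⊎ IsomorphicTo G 12 icosahedronAdj)

  a₁ : ℕ
  a₁ = walks G 2 x₀ y₀

  private
    single : ∀ {p : V → Bool} {u v} → Enum 1 p → p u ≡ true → p v ≡ true → u ≢ v → ⊥
    single E pu pv ne with Cardinality.length≤ E (unique₂ ne) (pu ∷ pv ∷ [])
    ... | s≤s ()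

    common-enum : ∀ {x y} → x ~ y → Enum a₁ (common x y)
    common-enum {x} {y} e = subst (λ r → Enum r (common x y)) (trans (sym (walks₂ x y)) (equivalent-adj e x₀~y₀ 2)) (enumerate (common x y))

  module _ {x y : V} (xy : x ~ y) where
    private module E = Enum (common-enum xy)

    common-at : ∀ i → x ~ E.at i × E.at i ~ y
    common-at i = common⁻ (E.sound i)

    a₁≤2 : a₁ ≤ 2
    a₁≤2 with a₁ ℕ.≤? 2
    ... | yes le = le
    ... | no gt = ⊥-elim (three-common xy (proj₁ (common-at i)) (proj₁ (common-at j)) (proj₁ (common-at l))
          (proj₂ (common-at i)) (proj₂ (common-at j)) (proj₂ (common-at l)) (distinct λ ()) (distinct λ ()) (distinct λ ()))
      where
      emb : Fin 3 → Fin a₁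
      emb i = Fin.inject≤ i (ℕₚ.≰⇒> gt)
      i = emb zero
      j = emb 1F
      l = emb 2F
      distinct : ∀ {r s : Fin 3} → r ≢ s → E.at (emb r) ≢ E.at (emb s)
      distinct ne e = ne (Finₚ.inject≤-injective _ _ _ _ (E.injective e))

    -- Besides `y` and the `a₁` common neighbours at most two neighbours of `x` remain: they are at
    -- distance two from `y`, where `three-beyond` applies.
    k≤a₁+3 : k ≤ 3 ℕ.+ a₁
    k≤a₁+3 with k ℕ.≤? 3 ℕ.+ a₁
    ... | yes le = le
    ... | no gt = ⊥-elim (beyond (Cardinality.extend (degree-enum x) ds₀ (ℕₚ.≤-trans (s≤s (ℕₚ.≤-trans len₀ (ℕₚ.m≤n+m _ 2))) (ℕₚ.≰⇒> gt))))
      where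
      commons : List V
      commons = tabulate E.at
      ds₀ : List V
      ds₀ = y ∷ commons
      len₀ : length ds₀ ≤ suc a₁
      len₀ = ℕₚ.≤-reflexive (cong suc (Listₚ.length-tabulate E.at))
      outside : ∀ {z} → x ~ z → z ∉ ds₀ → z ≢ y × z ≁ y
      outside {z} xz z∉ = (λ e → z∉ (here e)) , λ zy →
        let (i , e) = E.complete z (common⁺ xz zy) in z∉ (there (subst (_∈ commons) e (∈-tabulate⁺ i)))
      beyond : (∃ λ c → x ~ c × c ∉ ds₀) → ⊥
      beyond (c₁ , x₁ , c₁∉) with Cardinality.extend (degree-enum x) (c₁ ∷ ds₀) (ℕₚ.≤-trans (s≤s (s≤s (ℕₚ.≤-trans len₀ (ℕₚ.n≤1+n _)))) (ℕₚ.≰⇒> gt))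
      ... | c₂ , x₂ , c₂∉ with Cardinality.extend (degree-enum x) (c₂ ∷ c₁ ∷ ds₀) (ℕₚ.≤-trans (s≤s (s≤s (s≤s len₀))) (ℕₚ.≰⇒> gt))
      ... | c₃ , x₃ , c₃∉ =
        let (m₁ , f₁) = outside x₁ c₁∉
            (m₂ , f₂) = outside x₂ (λ z → c₂∉ (there z))
            (m₃ , f₃) = outside x₃ (λ z → c₃∉ (there (there z)))
        in three-beyond xy x₁ x₂ x₃ m₁ m₂ m₃ f₁ f₂ f₃ (λ e → c₂∉ (here (sym e))) (λ e → c₃∉ (there (here (sym e)))) (λ e → c₃∉ (here (sym e)))

  module Valency3 (deg : ∀ x → Enum 3 (adj x)) where

    -- a₁ = 1: the three neighbours of a vertex cannot be perfectly matched.
    one : (∀ {x y} → x ~ y → Enum 1 (common x y)) → ⊥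
    one com with Cardinality.extend (com x₀~y₀) [] (s≤s z≤n)
    ... | y₁ , p , _ with common⁻ p
    ... | x₁ , y₁~y₀ with Cardinality.extend (deg x₀) (y₀ ∷ y₁ ∷ []) ℕₚ.≤-refl
    ... | y₂ , x₂ , y₂∉ with Cardinality.extend (com x₂) [] (s≤s z≤n)
    ... | u , q , _ with common⁻ q
    ... | xu , uy₂ with Cardinality.full (deg x₀) (unique₃ (≢-sym (~⇒≢ y₁~y₀)) (λ e → y₂∉ (here (sym e))) (λ e → y₂∉ (there (here (sym e)))))
                    (x₀~y₀ ∷ x₁ ∷ x₂ ∷ []) ℕₚ.≤-refl u xu
    ... | here refl = single (com x₀~y₀) (common⁺ x₁ y₁~y₀) (common⁺ x₂ (~-sym uy₂)) (λ e → y₂∉ (there (here (sym e))))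
    ... | there (here refl) = single (com x₁) (common⁺ x₀~y₀ (~-sym y₁~y₀)) (common⁺ x₂ (~-sym uy₂)) (λ e → y₂∉ (here (sym e)))
    ... | there (there (here refl)) = ~⇒≢ uy₂ refl

    module TriangleFree (com : ∀ {x y} → x ~ y → Enum 0 (common x y)) (k≡3 : k ≡ 3) where
      triangle-free : ∀ {x y} → x ~ y → ∀ {z} → x ~ z → z ≁ y
      triangle-free xy {z} xz zy with Enum.complete (com xy) z (common⁺ xz zy)
      ... | () , _

      open Cubic G conn deg triangle-free using (third; dist2; Pentagon; pent; module Cube; module Pentagon; module Dodecahedron)

      a b c : V
      a = proj₁ (Cardinality.extend (deg x₀) [] (s≤s z≤n))
      b = x₀
      c = proj₁ (Cardinality.extend (deg x₀) (a ∷ []) (s≤s (s≤s z≤n)))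
      ba : b ~ a
      ba = proj₁ (proj₂ (Cardinality.extend (deg x₀) [] (s≤s z≤n)))
      bc : b ~ c
      bc = proj₁ (proj₂ (Cardinality.extend (deg x₀) (a ∷ []) (s≤s (s≤s z≤n))))
      c≢a : c ≢ a
      c≢a e = proj₂ (proj₂ (Cardinality.extend (deg x₀) (a ∷ []) (s≤s (s≤s z≤n)))) (here e)
      ac : Dist2 a c
      ac = dist2 ba bc (≢-sym c≢a)

      c₂ : ℕ
      c₂ = walks G 2 a c

      common₂ : ∀ {x y} → Dist2 x y → Enum c₂ (common x y)
      common₂ {x} {y} d = subst (λ r → Enum r (common x y)) (trans (sym (walks₂ x y)) (equivalent-dist2 d ac 2)) (enumerate (common x y))

      aZero₁ : aZero G 1
      aZero₁ x y e = Σᴺ≡0 λ z → zero-term z (adj y z) refl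
        where
        zero-term : ∀ z b → adj y z ≡ b → [ adj y z ∧ (dist G x z ℕ.≡ᵇ dist G x y) ] ≡ 0
        zero-term z false yz rewrite yz = refl
        zero-term z true yz with dist G x z ℕ.≡ᵇ dist G x y in eq
        ... | false = cong [_] (Boolₚ.∧-zeroʳ (adj y z))
        ... | true = ⊥-elim (triangle-free (~-sym (dist₁⁻ n≥3 e)) yz (~-sym (dist₁⁻ n≥3
              (trans (ℕₚ.≡ᵇ⇒≡ (dist G x z) (dist G x y) (subst Data.Bool.T (sym eq) tt)) e))))

      -- All neighbours of a vertex are then shared with each vertex at distance two, which makes
      -- non-adjacency an equivalence.
      complete : c₂ ≡ 3 → ⊥
      complete eq = ¬cm (completeMultipartite conn λ {x} {z} d {w} xw →
        let module E = Enum (subst (λ r → Enum r (common x z)) eq (common₂ d))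
            w∈ = Cardinality.full (deg x) {tabulate E.at} (Uniqueₚ.tabulate⁺ E.injective)
              (Allₚ.tabulate⁺ λ i → proj₁ (common⁻ {x} {z} (E.sound i))) ℕₚ.≤-refl w xw
            (i , w≡) = ∈-tabulate⁻ {f = E.at} w∈
        in ~-sym (subst (_~ z) (sym w≡) (proj₂ (common⁻ {x} {z} (E.sound i)))))

      module UniqueCommon (c₂≡1 : c₂ ≡ 1) where

        common₁ : ∀ {x y} → Dist2 x y → Enum 1 (common x y)
        common₁ {x} {y} d = subst (λ r → Enum r (common x y)) c₂≡1 (common₂ d)

        unique-common : ∀ {x y u v} → x ≢ y → u ~ x → u ~ y → v ~ x → v ~ y → u ≡ v
        unique-common x≢y ux uy vx vy with Cardinality.full (common₁ (dist2 ux uy x≢y)) ([] ∷ []) (common⁺ (~-sym ux) uy ∷ []) ℕₚ.≤-refl _ (common⁺ (~-sym vx) vy)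
        ... | here e = sym e

        w₃ : ℕ
        w₃ = walks G 3 a c

        -- The walks of length 3 between vertices at distance two are the pentagons through a 2-path.
        starts : V → V → V → Bool
        starts x y z = adj x z ∧ (walks G 2 z y ℕ.≡ᵇ 1)

        -- A neighbour of `x` with a 2-walk to `y` is itself at distance two from `y`, and `c₂ = 1`.
        -- So the sum for `w₃` has only terms 0 and 1 and counts first vertices.
        walks₂≡1 : ∀ {x y z} → Dist2 x y → x ~ z → walks G 2 z y ≢ 0 → walks G 2 z y ≡ 1
        walks₂≡1 {x} {y} {z} d xz ne = let (u , zu , uy) = walks₂⁻ ne in
          trans (equivalent-dist2 (mk (λ { refl → Dist2.nonadj d xz }) (λ zy → triangle-free zy zu uy) zu uy) ac 2) c₂≡1

        starts⁺ : ∀ {x y z u} → Dist2 x y → x ~ z → z ~ u → u ~ y → starts x y z ≡ true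
        starts⁺ {x} {y} {z} d xz zu uy rewrite xz | walks₂≡1 d xz (walks-step 1 y zu (walks₁⁺ uy)) = refl

        starts⁻ : ∀ {x y z} → starts x y z ≡ true → x ~ z × ∃ λ u → z ~ u × u ~ y
        starts⁻ {x} {y} {z} e with adj x z
        ... | true = refl , walks₂⁻ λ w≡0 → zero≢ (subst (λ w → (w ℕ.≡ᵇ 1) ≡ true) w≡0 e)
          where
          zero≢ : (0 ℕ.≡ᵇ 1) ≡ true → ⊥
          zero≢ ()

        starts-enum : ∀ {x y} → Dist2 x y → Enum w₃ (starts x y)
        starts-enum {x} {y} d = subst (λ r → Enum r (starts x y))
          (trans (sym (Σᴺ-cong term)) (equivalent-dist2 d ac 3)) (enumerate (starts x y))
          where
          term : ∀ z → [ adj x z ] ℕ.* walks G 2 z y ≡ [ starts x y z ]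
          term z with adj x z in xz
          ... | false = refl
          ... | true with walks G 2 z y ℕ.≟ 0
          ... | yes w≡0 rewrite w≡0 = refl
          ... | no ne rewrite walks₂≡1 d xz ne = refl

        mid-unique : ∀ {x y u v} → Dist2 x y → x ~ u → u ~ y → x ~ v → v ~ y → u ≡ v
        mid-unique d xu uy xv vy = unique-common (Dist2.distinct d) (~-sym xu) uy (~-sym xv) vy

        starts≢mid : ∀ {x y z m u} → Dist2 x y → x ~ m → m ~ y → z ~ u → u ~ y → z ≢ m
        starts≢mid d xm my zu uy refl = triangle-free my zu uy

        no-pentagons : w₃ ≡ 0 → (aZero G 2) × ¬ DistanceRegular G
        no-pentagons w₃≡0 = aZero₂ , ¬dr
          where
          absent : ∀ {x y z u} → Dist2 x y → x ~ z → z ~ u → u ~ y → ⊥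
          absent {x} {y} {z} d xz zu uy with Enum.complete (subst (λ r → Enum r (starts x y)) w₃≡0 (starts-enum d)) z (starts⁺ d xz zu uy)
          ... | () , _
          aZero₂ : aZero G 2
          aZero₂ x y e = Σᴺ≡0 λ z → zero-term z (adj y z) refl
            where
            zero-term : ∀ z b → adj y z ≡ b → [ adj y z ∧ (dist G x z ℕ.≡ᵇ dist G x y) ] ≡ 0
            zero-term z false yz rewrite yz = refl
            zero-term z true yz with dist G x z ℕ.≡ᵇ dist G x y in eq
            ... | false = cong [_] (Boolₚ.∧-zeroʳ (adj y z))
            ... | true with dist₂⁻ n≥3 (trans (ℕₚ.≡ᵇ⇒≡ (dist G x z) (dist G x y) (subst Data.Bool.T (sym eq) tt)) e)
            ... | mk _ _ xm mz = ⊥-elim (absent (dist₂⁻ n≥3 e) xm mz (~-sym yz))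
          ¬dr : ¬ DistanceRegular G
          ¬dr dr with Cardinality.extend (deg a) (b ∷ []) (s≤s (s≤s z≤n))
          ... | e , ae , e∉ with third (~-sym ba) ae (λ q → e∉ (here (sym q)))
          ... | e′ , ae′ , e′≢b , e′≢e = cis-trans (~-sym ba) bc c≢a (λ ca → Dist2.nonadj ac (~-sym ca)) ae ae′
              (λ q → e∉ (here q)) e′≢b (λ eb → triangle-free ae (~-sym ba) (~-sym eb)) (λ eb → triangle-free ae′ (~-sym ba) (~-sym eb)) (≢-sym e′≢e)
              -- Walk counts at distance three are compared by distance-regularity;
              -- 2-walk-regularity stops at distance two.
              (DistanceRegularity.dist⇒walkEquivalent G dr (trans (far ae (λ q → e∉ (here q))) (sym (far ae′ e′≢b))))
            where
            -- Distance one would give `a` and `c` a second common neighbour, distance two a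
            -- pentagon.
            far : ∀ {e} → a ~ e → e ≢ b → dist G c e ≡ 3
            far {e} ae e≢b = dist₃⁺ n≥3 (λ { refl → Dist2.nonadj ac ae })
              (λ ce → e≢b (unique-common (Dist2.distinct ac) (~-sym ae) (~-sym ce) ba bc))
              (λ d → absent ac ae (~-sym (Dist2.right d)) (~-sym (Dist2.left d))) (~-sym bc) ba ae

        -- Two starts are the two extensions of the path `c b a`, both at distance two from `c`.
        -- Their walk counts to `c` agree by 2-walk-regularity, against `cis-trans`.
        many-pentagons : 2 ≤ w₃ → ⊥
        many-pentagons w₃≥2 =
          let (ae , d , ed , dc) = starts⁻ {a} {c} (E.sound i)
              (ae′ , d′ , ed′ , dc′) = starts⁻ {a} {c} (E.sound j)
              n₁ = starts≢mid ac (~-sym ba) bc ed dc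
              n₂ = starts≢mid ac (~-sym ba) bc ed′ dc′
          in cis-trans (~-sym ba) bc c≢a (λ ca → Dist2.nonadj ac (~-sym ca)) ae ae′ n₁ n₂
            (λ eb → triangle-free ae (~-sym ba) (~-sym eb)) (λ eb → triangle-free ae′ (~-sym ba) (~-sym eb))
            (λ eq → 0≢1 (Finₚ.inject≤-injective _ _ _ _ (E.injective eq)))
            (equivalent-dist2 (at-two ae ed dc n₁) (at-two ae′ ed′ dc′ n₂))
          where
          module E = Enum (starts-enum ac)
          i j : Fin w₃
          i = Fin.inject≤ {2} zero w₃≥2
          j = Fin.inject≤ {2} 1F w₃≥2
          at-two : ∀ {e d} → a ~ e → e ~ d → d ~ c → e ≢ b → Dist2 e c
          at-two ae ed dc e≢b = mk (λ { refl → Dist2.nonadj ac ae }) (λ ec → e≢b (mid-unique ac ae ec (~-sym ba) bc)) ed dc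

        dodecahedron : w₃ ≡ 1 → IsomorphicTo G 20 dodecahedronAdj × DistanceRegular G
        dodecahedron w₃≡1 = Dodecahedron.isDodecahedron unique-common pentagon pentagon-unique x₀
          where
          starts₁ : ∀ {x y} → Dist2 x y → Enum 1 (starts x y)
          starts₁ {x} {y} d = subst (λ r → Enum r (starts x y)) w₃≡1 (starts-enum d)
          pentagon : ∀ {a b c} → a ~ b → b ~ c → a ≢ c → ∃ λ d → ∃ λ e → Pentagon a b c d e
          pentagon {a} {b} {c} ab bc a≢c =
            let d₂ = dist2 (~-sym ab) bc a≢c
                (e , p , _) = Cardinality.extend (starts₁ d₂) [] (s≤s z≤n)
                (ae , d , ed , dc) = starts⁻ {a} {c} p
            in d , e , pent ab bc (~-sym dc) (~-sym ed) (~-sym ae)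
          pentagon-unique : ∀ {a b c d e d′ e′} → Pentagon a b c d e → Pentagon a b c d′ e′ → d ≡ d′ × e ≡ e′
          pentagon-unique {a} {b} {c} {d} {e} {d′} {e′} P P′ = d≡d′ , e≡e′
            where
            open Pentagon P using (ab; cd; de; ea)
            module P = Pentagon P
            module P′ = Pentagon P′
            a≢c : a ≢ c
            a≢c refl = triangle-free ea (~-sym de) (~-sym cd)
            e≢c : e ≢ c
            e≢c refl = triangle-free ab (~-sym ea) (~-sym P.bc)
            d₂ = dist2 (~-sym ab) P.bc a≢c
            e≡e′ : e ≡ e′
            e≡e′ with Cardinality.full (starts₁ d₂) ([] ∷ []) (starts⁺ d₂ (~-sym ea) (~-sym de) (~-sym cd) ∷ []) ℕₚ.≤-refl
              e′ (starts⁺ d₂ (~-sym P′.ea) (~-sym P′.de) (~-sym P′.cd))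
            ... | here q = sym q
            d≡d′ : d ≡ d′
            d≡d′ = unique-common e≢c de (~-sym cd) (subst (d′ ~_) (sym e≡e′) P′.de) (~-sym P′.cd)

      conclusion : Goal
      conclusion = go c₂ refl
        where
        go : ∀ m → c₂ ≡ m → Goal
        go 0 eq with Enum.complete (subst (λ r → Enum r (common a c)) eq (common₂ ac)) b (common⁺ (~-sym ba) bc)
        ... | () , _
        go 1 eq = split w₃ refl
          where
          open UniqueCommon eq
          split : ∀ m → w₃ ≡ m → Goal
          split 0 e = let (z₂ , ¬dr) = no-pentagons e in inj₁ (k≡3 , aZero₁ , z₂) , λ dr → ⊥-elim (¬dr dr)
          split 1 e = let (iso , dr) = dodecahedron e in inj₂ dr , λ _ → inj₂ (inj₁ iso)
          split (suc (suc m)) e = ⊥-elim (many-pentagons (ℕₚ.≤-trans (s≤s (s≤s z≤n)) (ℕₚ.≤-reflexive (sym e))))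
        go 2 eq = let (iso , dr) = Cube.isCube (λ {x} {y} d → subst (λ r → Enum r (common x y)) eq (common₂ d)) x₀ in
          inj₂ dr , λ _ → inj₁ iso
        go 3 eq = ⊥-elim (complete eq)
        go (suc (suc (suc (suc m)))) eq = ⊥-elim (ℕₚ.<⇒≱ (ℕₚ.≤-trans (s≤s (s≤s (s≤s (s≤s z≤n)))) (ℕₚ.≤-reflexive (sym eq)))
          (Finₚ.injective⇒≤ {f = λ i → proj₁ (Enum.complete (deg a) (Enum.at (common₂ ac) i) (proj₁ (common⁻ {a} {c} (Enum.sound (common₂ ac) i))))}
            λ {i} {j} e → Enum.injective (common₂ ac) (trans (sym (index-of i)) (trans (cong (Enum.at (deg a)) e) (index-of j)))))
          where
          index-of : ∀ i → Enum.at (deg a) (proj₁ (Enum.complete (deg a) (Enum.at (common₂ ac) i) (proj₁ (common⁻ {a} {c} (Enum.sound (common₂ ac) i))))) ≡ Enum.at (common₂ ac) i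
          index-of i = proj₂ (Enum.complete (deg a) (Enum.at (common₂ ac) i) (proj₁ (common⁻ {a} {c} (Enum.sound (common₂ ac) i))))

  -- a₁ = 2: a vertex y between x and z at distance two has two further neighbours if k = 4, and none if k = 3.
  module TwoCommon (com : ∀ {x y} → x ~ y → Enum 2 (common x y)) where
    record Middle (x y z : V) : Set where
      field
        p q : V
        p≢q : p ≢ q
        yp : y ~ p
        yq : y ~ q
        xp : x ~ p
        xq : x ~ q
        p≢x : p ≢ x
        p≢z : p ≢ z
        q≢x : q ≢ x
        q≢z : q ≢ z

    middle : ∀ {x y z} → Dist2 x z → x ~ y → y ~ z → Middle x y z
    middle {x} {y} {z} d xy yz = record
      { p = at 0F ; q = at 1F ; p≢q = λ e → 0≢1 (injective e)
      ; yp = proj₁ (pair 0F) ; yq = proj₁ (pair 1F)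
      ; xp = ~-sym (proj₂ (pair 0F)) ; xq = ~-sym (proj₂ (pair 1F))
      ; p≢x = ~⇒≢ (proj₂ (pair 0F)) ; q≢x = ~⇒≢ (proj₂ (pair 1F))
      ; p≢z = λ { e → Dist2.nonadj d (~-sym (subst (_~ x) e (proj₂ (pair zero)))) }
      ; q≢z = λ { e → Dist2.nonadj d (~-sym (subst (_~ x) e (proj₂ (pair 1F)))) } }
      where
      open Enum (com (~-sym xy))
      pair : ∀ i → y ~ at i × at i ~ x
      pair i = common⁻ {y} {x} (sound i)

    unique-middle : ∀ {x y z} (d : Dist2 x z) (xy : x ~ y) (yz : y ~ z) → let open Middle (middle d xy yz) in Unique (x ∷ z ∷ p ∷ q ∷ [])
    unique-middle d xy yz = unique₄ (Dist2.distinct d) (≢-sym p≢x) (≢-sym q≢x) (≢-sym p≢z) (≢-sym q≢z) p≢q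
      where open Middle (middle d xy yz)

    three : (∀ x → Enum 3 (adj x)) → ⊥
    three deg = ¬cm (completeMultipartite conn λ d → ⊥-elim (absurd d))
      where
      absurd : ∀ {x z} → Dist2 x z → ⊥
      absurd d@(mk _ _ {y} xy yz) with Cardinality.length≤ (deg y) (unique-middle d xy yz)
        (~-sym xy ∷ yz ∷ Middle.yp (middle d xy yz) ∷ Middle.yq (middle d xy yz) ∷ [])
      ... | s≤s (s≤s (s≤s ()))

    four : (∀ x → Enum 4 (adj x)) → ⊥
    four deg = ¬cm (completeMultipartite conn twins)
      where
      -- With valency four, `x`, `z`, `p`, `q` are all the neighbours of `y`; the two common
      -- neighbours of `y` and `z` lie among them and are neither `x` nor `z`.
      around : ∀ {x y z} (d : Dist2 x z) (xy : x ~ y) (yz : y ~ z) → let open Middle (middle d xy yz) in z ~ p × z ~ q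
      around {x} {y} {z} d xy yz = both (e 0F) (e 1F) (λ eq → 0≢1 (injective eq))
        where
        open Middle (middle d xy yz)
        open Enum (com yz)
        e : ∀ i → (at i ≡ p × z ~ p) ⊎ (at i ≡ q × z ~ q)
        e i with common⁻ {y} {z} (sound i)
        ... | yu , uz with Cardinality.full (deg y) (unique-middle d xy yz) (~-sym xy ∷ yz ∷ yp ∷ yq ∷ []) ℕₚ.≤-refl (at i) yu
        ... | here eq = ⊥-elim (Dist2.nonadj d (subst (_~ z) eq uz))
        ... | there (here eq) = ⊥-elim (~⇒≢ uz eq)
        ... | there (there (here eq)) = inj₁ (eq , ~-sym (subst (_~ z) eq uz))
        ... | there (there (there (here eq))) = inj₂ (eq , ~-sym (subst (_~ z) eq uz))
        both : ∀ {u v} → (u ≡ p × z ~ p) ⊎ (u ≡ q × z ~ q) → (v ≡ p × z ~ p) ⊎ (v ≡ q × z ~ q) → u ≢ v → z ~ p × z ~ q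
        both (inj₁ (_ , zp)) (inj₂ (_ , zq)) _ = zp , zq
        both (inj₂ (_ , zq)) (inj₁ (_ , zp)) _ = zp , zq
        both (inj₁ (eu , _)) (inj₁ (ev , _)) ne = ⊥-elim (ne (trans eu (sym ev)))
        both (inj₂ (eu , _)) (inj₂ (ev , _)) ne = ⊥-elim (ne (trans eu (sym ev)))

      -- `y`, `p`, `q` and a further common neighbour `r` of `x` and `p` are all joined to `z`, and
      -- they are the four neighbours of `x`. The graph that arises is the octahedron.
      twins : ∀ {x z} → Dist2 x z → ∀ {w} → x ~ w → z ~ w
      twins {x} {z} d@(mk _ _ {y} xy yz) {w} xw = conclude fourth
        where
        open Middle (middle d xy yz)
        zp = proj₁ (around d xy yz)
        zq = proj₂ (around d xy yz)
        module N = Middle (middle d xp (~-sym zp))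
        p≁q : p ≁ q
        p≁q pq with Cardinality.length≤ (com yp) (unique₃ (Dist2.distinct d) (≢-sym q≢x) (≢-sym q≢z))
          (common⁺ (~-sym xy) xp ∷ common⁺ yz zp ∷ common⁺ yq (~-sym pq) ∷ [])
        ... | s≤s (s≤s ())
        fourth : ∃ λ r → p ~ r × x ~ r × z ~ r × r ≢ y
        fourth with N.p Fin.≟ y
        ... | no ne = N.p , N.yp , N.xp , proj₁ (around d xp (~-sym zp)) , ne
        ... | yes e = N.q , N.yq , N.xq , proj₂ (around d xp (~-sym zp)) , λ e′ → N.p≢q (trans e (sym e′))
        conclude : (∃ λ r → p ~ r × x ~ r × z ~ r × r ≢ y) → z ~ w
        conclude (r , pr , xr , zr , r≢y) with Cardinality.full (deg x)
          (unique₄ (~⇒≢ yp) (~⇒≢ yq) (≢-sym r≢y) p≢q (~⇒≢ pr) (λ { refl → p≁q pr }))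
          (xy ∷ xp ∷ xq ∷ xr ∷ []) ℕₚ.≤-refl w xw
        ... | here refl = ~-sym yz
        ... | there (here refl) = zp
        ... | there (there (here refl)) = zq
        ... | there (there (there (here refl))) = zr

  -- An edge between the two pairs of neighbours would be a second triangle on the edge `x y` or
  -- `x y₂`.
  squares : (∀ x → Enum 4 (adj x)) → (∀ {x y} → x ~ y → Enum 1 (common x y)) → ∀ {x y} → x ~ y → Square G x y
  squares deg com {x} {y} xy with Cardinality.extend (com xy) [] (s≤s z≤n)
  ... | y₂ , p , _ with common⁻ p
  ... | x₂ , y₂y with Cardinality.extend (deg x) (y ∷ y₂ ∷ []) (s≤s (s≤s (s≤s z≤n)))
  ... | y₃ , x₃ , y₃∉ with Cardinality.extend (deg x) (y₃ ∷ y ∷ y₂ ∷ []) ℕₚ.≤-refl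
  ... | y₄ , x₄ , y₄∉ = record
    { y₂ = y₂ ; y₃ = y₃ ; y₄ = y₄ ; x₂ = x₂ ; x₃ = x₃ ; x₄ = x₄ ; adj₂₁ = y₂y
    ; ≢₃₁ = λ e → y₃∉ (here e) ; ≢₄₁ = λ e → y₄∉ (there (here e))
    ; ≢₃₂ = λ e → y₃∉ (there (here e)) ; ≢₄₂ = λ e → y₄∉ (there (there (here e))) ; ≢₃₄ = λ e → y₄∉ (here (sym e))
    ; ≁₃₁ = λ e → single (com xy) (common⁺ x₂ y₂y) (common⁺ x₃ e) (λ q → y₃∉ (there (here (sym q))))
    ; ≁₄₁ = λ e → single (com xy) (common⁺ x₂ y₂y) (common⁺ x₄ e) (λ q → y₄∉ (there (there (here (sym q)))))
    ; ≁₃₂ = λ e → single (com x₂) (common⁺ xy (~-sym y₂y)) (common⁺ x₃ e) (λ q → y₃∉ (here (sym q)))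
    ; ≁₄₂ = λ e → single (com x₂) (common⁺ xy (~-sym y₂y)) (common⁺ x₄ e) (λ q → y₄∉ (there (here (sym q)))) }

  classification : Goal
  classification = go k a₁ refl refl (k≤a₁+3 x₀~y₀) (a₁≤2 x₀~y₀) k≥3
    where
    deg : ∀ {d} → k ≡ d → ∀ x → Enum d (adj x)
    deg e x = subst (λ d → Enum d (adj x)) e (degree-enum x)
    com : ∀ {d} → a₁ ≡ d → ∀ {x y} → x ~ y → Enum d (common x y)
    com e {x} {y} xy = subst (λ d → Enum d (common x y)) e (common-enum xy)
    go : ∀ d r → k ≡ d → a₁ ≡ r → d ≤ 3 ℕ.+ r → r ≤ 2 → 3 ≤ d → Goal
    go 3 0 ek ea _ _ _ = Valency3.TriangleFree.conclusion (deg ek) (com ea) ek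
    go 3 1 ek ea _ _ _ = ⊥-elim (Valency3.one (deg ek) (com ea))
    go 3 2 ek ea _ _ _ = ⊥-elim (TwoCommon.three (com ea) (deg ek))
    go 4 1 ek ea _ _ _ = ⊥-elim (no-squares (squares (deg ek) (com ea)))
    go 4 2 ek ea _ _ _ = ⊥-elim (TwoCommon.four (com ea) (deg ek))
    go 5 2 ek ea _ _ _ = let (iso , dr) = FiveValent.isIcosahedron G conn (deg ek) (com ea) x₀ in inj₂ dr , λ _ → inj₂ (inj₂ iso)
    go (suc (suc (suc (suc d)))) 0 _ _ (s≤s (s≤s (s≤s ()))) _ _
    go (suc (suc (suc (suc (suc d))))) 1 _ _ (s≤s (s≤s (s≤s (s≤s ())))) _ _
    go (suc (suc (suc (suc (suc (suc d)))))) 2 _ _ (s≤s (s≤s (s≤s (s≤s (s≤s ()))))) _ _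
    go _ (suc (suc (suc r))) _ _ _ (s≤s (s≤s ())) _
    go 0 _ _ _ _ _ ()
    go 1 _ _ _ _ _ (s≤s ())
    go 2 _ _ _ _ _ (s≤s (s≤s ()))

theorem6p8 : ∀ {c ℓ} (F : Field c ℓ) → CharZero F →
    (G : Graph) (k : ℕ) → Connected G → TwoWalkRegular G →
    ¬ CompleteMultipartite G → Regular G k → 3 ≤ k →
    (θ : Field.Carrier F) →
    ¬ Field._≈_ F θ (Field._×ᵣ_ F k (Field.1# F)) →
    ¬ Field._≈_ F θ (Field.-_ F (Field._×ᵣ_ F k (Field.1# F))) →
    EigenvalueOfMultiplicity F G θ 3 →
    (((k ≡ 3) × aZero G 1 × aZero G 2) ⊎ DistanceRegular G)
    × (DistanceRegular G →
    IsomorphicTo G 8 cubeAdj ⊎ IsomorphicTo G 20 dodecahedronAdj ⊎ IsomorphicTo G 12 icosahedronAdj)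
theorem6p8 F char0 G k conn twr ¬cm reg k≥3 θ θ≉k θ≉-k mult =
  CaseAnalysis.classification G k conn ¬cm k≥3 degree-enum n≥3 equivalent-adj equivalent-dist2 geometricFacts x₀ y₀ x₀~y₀
  where open GeometricConsequences F char0 G k conn twr ¬cm reg k≥3 θ θ≉k θ≉-k mult
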